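{- Let $n=2^vm$ with $m$ odd and $v>0$, and let $x^n+1=(x+1)^{2^v}r_1^{2^v}\cdots r_k^{2^v}$ in $\mathbb{F}_2[x]$, where $r_1,\ldots,r_k$ are monic prime self-reciprocal polynomials of even degree. Set \[ G_i(z)=1+\sum_{j=1}^{2^v}\left(2^{\frac{j\deg(r_i)}{2}}-2^{\frac{(j-1)\deg(r_i)}{2}}\right)z^{j\deg(r_i)}. \] Then \[ \mathcal{G}_n(z)=\sum_{t=0}^n\mathcal{N}_n(n-t)z^t=\left(1+\sum_{j=1}^{2^{v-1}-1}2^{j-1}z^{2j}\right)\prod_{i=1}^kG_i(z), \] and \[ \mathcal{H}_n(z)=\sum_{t=0}^n\mathcal{M}_n(n-t)z^t=\left(1+\sum_{j=1}^{2^{v-1}}2^{j-1}z^{2j}\right)\prod_{i=1}^kG_i(z). \]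
   Context: $\mathrm{Tr}_n:\mathbb{F}_{2^n}\to\mathbb{F}_2$ is the absolute trace and $\mathrm{Tr}_{n/2}:\mathbb{F}_{2^{n/2}}\to\mathbb{F}_2$ the absolute trace of $\mathbb{F}_{2^{n/2}}$. The Walsh transform of $f:\mathbb{F}_{2^n}\to\mathbb{F}_2$ is $\widehat f(b)=\sum_{x\in\mathbb{F}_{2^n}}(-1)^{f(x)+\mathrm{Tr}_n(bx)}$; for an integer $0\le s\le n$, $f$ is $s$-plateaued if $|\widehat f(b)|\in\{0,2^{(n+s)/2}\}$ for all $b$. $\mathcal{C}_1$: functions $Q(x)=\mathrm{Tr}_n\big(\sum_{i=1}^{\lfloor (n-1)/2\rfloor}a_ix^{2^i+1}\big)$, $a_i\in\mathbb{F}_2$; $\mathcal{C}_2$ (even $n$): $Q(x)=\mathrm{Tr}_n\big(\sum_{i=1}^{n/2-1}a_ix^{2^i+1}\big)+\mathrm{Tr}_{n/2}(a_{n/2}x^{2^{n/2}+1})$, $a_i\in\mathbb{F}_2$; the zero function (all $a_i=0$) is included and is $n$-plateaued. $\mathcal{N}_n(s)$ (resp. $\mathcal{M}_n(s)$) is the number of coefficient tuples for which the corresponding function in $\mathcal{C}_1$ (resp. $\mathcal{C}_2$) is $s$-plateaued. For $f\in\mathbb{F}_2[x]$ with $f(0)\ne0$, $f^*(x)=x^{\deg f}f(1/x)$; $f$ is self-reciprocal if $f^*=f$. A monic polynomial $f$ is prime self-reciprocal if either $f$ is irreducible and self-reciprocal, or $f=ugg^*$ with $g$ monic irreducible, $g^*$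 not a constant multiple of $g$, and $u$ a nonzero constant. -}

module Defs where

open import Data.Bool using (Bool; true; false; _xor_; _∧_)
open import Data.Nat as ℕ using (ℕ; zero; suc; _∸_)
open import Data.Nat.DivMod using (_/_)
open import Data.Integer as ℤ using (ℤ)
open import Data.Integer.Properties using () renaming (_≟_ to _≟ℤ_)
open import Data.List using (List; []; _∷_; length; reverse; map; foldr; filter; _++_; concatMap)
open import Data.List.Membership.Propositional using (_∈_)
open import Data.List.Relation.Unary.Unique.Propositional using (Unique)
open import Data.List.Relation.Unary.All as All using (All; all?)
open import Data.Vec using (Vec; []; _∷_)
open import Data.Product using (∃; _×_; _,_)
open import Data.Sum using (_⊎_; inj₁; inj₂)
open import Relation.Nullary using (¬_; Dec; yes; no)
open import Relation.Binary.Definitions using (DecidableEquality)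
open import Relation.Binary.PropositionalEquality using (_≡_)
open import Algebra.Structures using (IsCommutativeRing)

-- a_{k+1} where the tuple stores a_1, a_2, ... at indices 0, 1, ...
-- (index k; out of range gives false)
lookupℕ : ∀ {m} → Vec Bool m → ℕ → Bool
lookupℕ []       _       = false
lookupℕ (b ∷ bs) zero    = b
lookupℕ (b ∷ bs) (suc j) = lookupℕ bs j

allVecs : (m : ℕ) → List (Vec Bool m)
allVecs zero    = [] ∷ []
allVecs (suc m) = map (true ∷_) (allVecs m) ++ map (false ∷_) (allVecs m)

-- A finite field with exactly 2^n elements (a model of F_{2^n}).
-- Any two such fields are isomorphic, so quantifying over all of them
-- amounts to speaking about "the" field F_{2^n}.

record FiniteField (n : ℕ) : Set₁ where
  field
    Carrier  : Set
    _≟_      : DecidableEquality Carrier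
    0# 1#    : Carrier
    _+_ _*_  : Carrier → Carrier → Carrier
    -_       : Carrier → Carrier
    isCommutativeRing : IsCommutativeRing _≡_ _+_ _*_ -_ 0# 1#
    0≢1      : ¬ (0# ≡ 1#)
    inverse  : ∀ x → ¬ (x ≡ 0#) → ∃ λ y → x * y ≡ 1#
    elements : List Carrier
    complete : ∀ x → x ∈ elements
    unique   : Unique elements
    size     : length elements ≡ 2 ℕ.^ n

module FieldOps {n : ℕ} (F : FiniteField n) where
  open FiniteField F

  pow : Carrier → ℕ → Carrier
  pow x zero    = 1#
  pow x (suc k) = x * pow x k

  sumF : ℕ → (ℕ → Carrier) → Carrier
  sumF zero    f = 0#
  sumF (suc k) f = sumF k f + f k

  Tr : Carrier → Carrier
  Tr x = sumF n (λ i → pow x (2 ℕ.^ i))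

  -- absolute trace of the subfield F_{2^h}: Tr_h(y) = Σ_{i<h} y^{2^i}
  Trsub : ℕ → Carrier → Carrier
  Trsub h y = sumF h (λ i → pow y (2 ℕ.^ i))

  emb : Bool → Carrier
  emb true  = 1#
  emb false = 0#

  -- (-1)^c for c ∈ F_2 ⊆ F
  sign : Carrier → ℤ
  sign c with c ≟ 0#
  ... | yes _ = ℤ.+ 1
  ... | no  _ = ℤ.- (ℤ.+ 1)

  sumℤ : List ℤ → ℤ
  sumℤ = foldr ℤ._+_ (ℤ.+ 0)

  walsh : (Carrier → Carrier) → Carrier → ℤ
  walsh f b = sumℤ (map (λ x → sign (f x + Tr (b * x))) elements)

  -- |f^(b)| ∈ {0, 2^{(n+s)/2}}, written with squares
  PlatAt : (Carrier → Carrier) → ℕ → Carrier → Set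
  PlatAt f s b = (walsh f b ℤ.* walsh f b ≡ ℤ.+ 0)
               ⊎ (walsh f b ℤ.* walsh f b ≡ ℤ.+ (2 ℕ.^ (n ℕ.+ s)))

  Plateaued : (Carrier → Carrier) → ℕ → Set
  Plateaued f s = ∀ b → PlatAt f s b

  PlatAt? : ∀ f s b → Dec (PlatAt f s b)
  PlatAt? f s b with walsh f b ℤ.* walsh f b ≟ℤ ℤ.+ 0
  ... | yes p = yes (inj₁ p)
  ... | no ¬p with walsh f b ℤ.* walsh f b ≟ℤ ℤ.+ (2 ℕ.^ (n ℕ.+ s))
  ...   | yes q = yes (inj₂ q)
  ...   | no ¬q = no λ { (inj₁ p) → ¬p p ; (inj₂ q) → ¬q q }

  Plateaued? : ∀ f s → Dec (Plateaued f s)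
  Plateaued? f s with all? (PlatAt? f s) elements
  ... | yes a = yes (λ b → All.lookup a (complete b))
  ... | no ¬a = no (λ h → ¬a (All.tabulate (λ {b} _ → h b)))

  QC1 : Vec Bool ((n ∸ 1) / 2) → Carrier → Carrier
  QC1 a x = Tr (sumF ((n ∸ 1) / 2)
                 (λ k → emb (lookupℕ a k) * pow x (2 ℕ.^ suc k ℕ.+ 1)))

  -- Class C2 (n = 2h): tuple (a_1,…,a_h),
  -- Q(x) = Tr_n( Σ_{i=1}^{h-1} a_i x^{2^i+1} ) + Tr_h( a_h x^{2^h+1} )
  QC2 : (h : ℕ) → Vec Bool h → Carrier → Carrier
  QC2 h a x = Tr (sumF (h ∸ 1)
                   (λ k → emb (lookupℕ a k) * pow x (2 ℕ.^ suc k ℕ.+ 1)))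
            + Trsub h (emb (lookupℕ a (h ∸ 1)) * pow x (2 ℕ.^ h ℕ.+ 1))

  𝒩 : ℕ → ℕ
  𝒩 s = length (filter (λ a → Plateaued? (QC1 a) s) (allVecs ((n ∸ 1) / 2)))

  𝓜 : (h : ℕ) → ℕ → ℕ
  𝓜 h s = length (filter (λ a → Plateaued? (QC2 h a) s) (allVecs h))

-- Polynomials over F_2: coefficient lists, lowest degree first
-- (trailing zeros allowed; compared after normalisation).

Poly₂ : Set
Poly₂ = List Bool

norm : Poly₂ → Poly₂
norm []          = []
norm (c ∷ cs) with norm cs
... | []      = if c then true ∷ [] else []
  where open import Data.Bool using (if_then_else_)
... | d ∷ ds  = c ∷ d ∷ ds

_≈₂_ : Poly₂ → Poly₂ → Set
f ≈₂ g = norm f ≡ norm g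

_+₂_ : Poly₂ → Poly₂ → Poly₂
[]       +₂ g        = g
(c ∷ cs) +₂ []       = c ∷ cs
(c ∷ cs) +₂ (d ∷ ds) = (c xor d) ∷ (cs +₂ ds)

scale₂ : Bool → Poly₂ → Poly₂
scale₂ c = map (c ∧_)

_*₂_ : Poly₂ → Poly₂ → Poly₂
[]       *₂ g = []
(c ∷ cs) *₂ g = scale₂ c g +₂ (false ∷ (cs *₂ g))

one₂ : Poly₂
one₂ = true ∷ []

_^₂_ : Poly₂ → ℕ → Poly₂
f ^₂ zero  = one₂
f ^₂ suc k = f *₂ (f ^₂ k)

prod₂ : List Poly₂ → Poly₂
prod₂ = foldr _*₂_ one₂

xⁿ+1 : ℕ → Poly₂
xⁿ+1 n = (true ∷ []) +₂ ((false ∷ true ∷ []) ^₂ n)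

x+1 : Poly₂
x+1 = true ∷ true ∷ []

-- degree (of the normalised polynomial; deg 0 := 0)
deg : Poly₂ → ℕ
deg f = length (norm f) ∸ 1

const₂ : Poly₂ → Bool
const₂ []      = false
const₂ (c ∷ _) = c

-- reciprocal f*(x) = x^{deg f} f(1/x)
recip : Poly₂ → Poly₂
recip f = reverse (norm f)

Nonzero₂ : Poly₂ → Set
Nonzero₂ f = ¬ (norm f ≡ [])

-- monic: nonzero (over F_2 the leading coefficient is then 1)
Monic : Poly₂ → Set
Monic f = Nonzero₂ f

SelfReciprocal : Poly₂ → Set
SelfReciprocal f = (const₂ f ≡ true) × (recip f ≈₂ f)

Irreducible : Poly₂ → Set
Irreducible f = (1 ℕ.≤ deg f)
              × (∀ g h → (g *₂ h) ≈₂ f → (deg g ≡ 0) ⊎ (deg h ≡ 0))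

-- prime self-reciprocal (the only nonzero constant of F_2 is 1, so
-- "g* not a constant multiple of g" means g* ≠ g, and u = 1)
PrimeSelfReciprocal : Poly₂ → Set
PrimeSelfReciprocal f =
    (Monic f × Irreducible f × SelfReciprocal f)
  ⊎ (∃ λ g → Monic g × Irreducible g × (const₂ g ≡ true)
            × ¬ (recip g ≈₂ g) × (f ≈₂ (g *₂ recip g)))

PolyN : Set
PolyN = List ℕ

coeff : PolyN → ℕ → ℕ
coeff []       _       = 0
coeff (c ∷ cs) zero    = c
coeff (c ∷ cs) (suc t) = coeff cs t

_+ᴺ_ : PolyN → PolyN → PolyN
[]       +ᴺ g        = g
(c ∷ cs) +ᴺ []       = c ∷ cs
(c ∷ cs) +ᴺ (d ∷ ds) = (c ℕ.+ d) ∷ (cs +ᴺ ds)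

_*ᴺ_ : PolyN → PolyN → PolyN
[]       *ᴺ g = []
(c ∷ cs) *ᴺ g = map (c ℕ.*_) g +ᴺ (0 ∷ (cs *ᴺ g))

monoᴺ : ℕ → ℕ → PolyN
monoᴺ c zero    = c ∷ []
monoᴺ c (suc k) = 0 ∷ monoᴺ c k

sumᴺ : ℕ → (ℕ → PolyN) → PolyN
sumᴺ zero    f = []
sumᴺ (suc J) f = sumᴺ J f +ᴺ f (suc J)

prodᴺ : List PolyN → PolyN
prodᴺ = foldr _*ᴺ_ (1 ∷ [])

Gpoly : ℕ → Poly₂ → PolyN
Gpoly v r = (1 ∷ []) +ᴺ sumᴺ (2 ℕ.^ v) (λ j →
              monoᴺ ((2 ℕ.^ (j ℕ.* d / 2)) ∸ (2 ℕ.^ ((j ∸ 1) ℕ.* d / 2)))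
                    (j ℕ.* d))
  where d = deg r

Apoly : ℕ → PolyN
Apoly J = (1 ∷ []) +ᴺ sumᴺ J (λ j → monoᴺ (2 ℕ.^ (j ∸ 1)) (2 ℕ.* j))

genCoeff : ℕ → (ℕ → ℕ) → ℕ → ℕ
genCoeff n c t with t ℕ.≤? n
... | yes _ = c (n ∸ t)
... | no  _ = 0

{-# OPTIONS --safe #-}
-- Let σ be the Frobenius map of F = F_{2^n}, n = 2h.  A function Q of either class is a quadratic form
-- whose radical is the kernel of a polynomial in σ, and Q is s-plateaued exactly when this kernel has
-- 2^s elements.  With y = x + 1/x and Y = σ + σ⁻¹ one has xⁱ + x⁻ⁱ = y Eᵢ(y), so for C₁ the operator is
-- (y B)(Y) with B an arbitrary polynomial of degree < h - 1.  A self-reciprocal r of degree 2k is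
-- xᵏ s(y), and r prime self-reciprocal makes s irreducible; hence x^n + 1 = x^h f(y) with
-- f = y^e ∏ sᵢ^(2e), e = 2^(v-1), and f(Y) = 0.  For g | f the kernel of g(Y) has 4^(deg g) elements:
-- a monic linearised polynomial of degree 2^D has at most 2^D zeros, and applying this to both g and
-- f/g forces equality.  So the radical has 4^(deg gcd(y B, f)) elements, and the number of B with a
-- given gcd is multiplicative over the coprime factors y^(e-1), sᵢ^(2e) of f/y.
-- For C₂ with a_h = 1 the extra term is σ^h.  The resulting operator is injective on ker Y^e, so its
-- kernel lies in ker S(Y), S = ∏ sᵢ^(2e), where y is invertible and σ^h acts as a polynomial c in Y; the
-- radical is governed by gcd(c + y B, S), and B ↦ c + y B is equidistributed modulo S.
module Submission where

-- The substitution y = x + 1/x removes the palindromic constraint. The polynomials `E i` are monic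
-- of degree i - 1, so the coefficient tuple determines B by a triangular change of basis, and every
-- B of the allowed degree occurs exactly once.
--
-- The factor x + 1 behaves differently from the rᵢ because x² + 1 = x y: the power (x + 1)^(2^v)
-- becomes y^e up to a power of x, and the operator y B uses up one of these factors y. This is why
-- the first factor of the series for C₁ stops at 2^(v-1) - 1.
--
-- The factorisation hypothesis does not state that the rᵢ are distinct; their coprimality is
-- extracted from the separability of x^m + 1 for odd m, after taking a 2^v-th root of the given
-- identity.
--
-- The obstacle in C₂ is that σ^h Y is a polynomial in Y, but the factor y can be cancelled only
-- away from ker Y^e. Since the twisted operator has no kernel there, the tuples with a_h = 1 always
-- lose the whole factor y^e from the gcd; they contribute the single term 2^(e-1) z^(2e), the
-- difference between the two first factors of the theorem.

open import Defs

-- Finite sums in commutative monoids and their reindexing along injections.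

module FiniteSums where

  open import Level using (0ℓ)
  open import Algebra.Bundles using (CommutativeMonoid)
  open import Data.Empty using (⊥-elim)
  open import Data.Nat as ℕ using (ℕ)
  import Data.Nat.Properties as ℕP
  open import Data.List using (List; []; _∷_; length; map; _++_; cartesianProduct)
  open import Data.List.Properties using (length-map)
  open import Data.List.Membership.Propositional using (_∈_)
  open import Data.List.Membership.Propositional.Properties using (∈-∃++)
  open import Data.List.Relation.Unary.Any using (here; there)
  import Data.List.Relation.Unary.All as All
  open import Data.List.Relation.Unary.AllPairs using ([]; _∷_)
  open import Data.List.Relation.Unary.Unique.Propositional using (Unique)
  open import Data.List.Relation.Unary.Unique.Propositional.Properties using (map⁺)
  open import Data.List.Relation.Binary.Permutation.Propositional using (_↭_; ↭-sym; prep)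
  import Data.List.Relation.Binary.Permutation.Propositional as ↭
  open import Data.List.Relation.Binary.Permutation.Propositional.Properties using (shift; ∈-resp-↭; ↭-length)
  open import Data.Product using (_×_; _,_)
  open import Relation.Nullary using (¬_)
  open import Relation.Binary.PropositionalEquality using (_≡_; refl; subst; sym)

  -- Pigeonhole: cutting the head of `xs` out of `ys` keeps the rest included, by uniqueness, and
  -- keeps the length inequality, so nothing of `ys` can be left over at the end.
  unique⊆⇒↭ : ∀ {A : Set} {xs ys : List A} → Unique xs → (∀ {x} → x ∈ xs → x ∈ ys) →
              length ys ℕ.≤ length xs → xs ↭ ys
  unique⊆⇒↭ {xs = []} {[]} _ _ _ = ↭.refl
  unique⊆⇒↭ {xs = x ∷ xs} {ys} (x∉ ∷ u) sub le with ∈-∃++ (sub (here refl))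
  ... | as , bs , refl = ↭.trans (prep x (unique⊆⇒↭ u sub' le')) (↭-sym (shift x as bs))
    where
    sub' : ∀ {y} → y ∈ xs → y ∈ as ++ bs
    sub' {y} p with ∈-resp-↭ (shift x as bs) (sub (there p))
    ... | here refl = ⊥-elim (All.lookup x∉ p refl)
    ... | there q = q
    le' : length (as ++ bs) ℕ.≤ length xs
    le' = ℕP.≤-pred (subst (ℕ._≤ _) (↭-length (shift x as bs)) le)

  injection-↭ : ∀ {A B : Set} {xs : List A} {ys : List B} (f : A → B) → (∀ {x y} → f x ≡ f y → x ≡ y) →
                Unique xs → (∀ y → y ∈ ys) → length ys ℕ.≤ length xs → map f xs ↭ ys
  injection-↭ {xs = xs} f inj u c le =
    unique⊆⇒↭ (map⁺ inj u) (λ {x} _ → c x) (subst (_ ℕ.≤_) (sym (length-map f xs)) le)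

  -- Generic in the monoid because five instances occur: sums in ℕ, in ℤ, in the field and of
  -- generating polynomials, and products in the field.
  module Sum (M : CommutativeMonoid 0ℓ 0ℓ) where
    open CommutativeMonoid M renaming (refl to ≈-refl; sym to ≈-sym; trans to ≈-trans)
    open import Algebra.Properties.CommutativeSemigroup commutativeSemigroup using (interchange; x∙yz≈y∙xz)

    ∑ : {A : Set} → List A → (A → Carrier) → Carrier
    ∑ []       f = ε
    ∑ (x ∷ xs) f = f x ∙ ∑ xs f

    module _ {A : Set} where
      ∑-cong : (xs : List A) {f g : A → Carrier} → (∀ x → f x ≈ g x) → ∑ xs f ≈ ∑ xs g
      ∑-cong []       eq = ≈-refl
      ∑-cong (x ∷ xs) eq = ∙-cong (eq x) (∑-cong xs eq)

      ∑-ε : (xs : List A) → ∑ xs (λ _ → ε) ≈ ε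
      ∑-ε []       = ≈-refl
      ∑-ε (x ∷ xs) = ≈-trans (identityˡ _) (∑-ε xs)

      ∑-∙ : (xs : List A) (f g : A → Carrier) → ∑ xs (λ x → f x ∙ g x) ≈ ∑ xs f ∙ ∑ xs g
      ∑-∙ []       f g = ≈-sym (identityˡ _)
      ∑-∙ (x ∷ xs) f g = ≈-trans (∙-congˡ (∑-∙ xs f g)) (interchange _ _ _ _)

      ∑-++ : (xs ys : List A) (f : A → Carrier) → ∑ (xs ++ ys) f ≈ ∑ xs f ∙ ∑ ys f
      ∑-++ []       ys f = ≈-sym (identityˡ _)
      ∑-++ (x ∷ xs) ys f = ≈-trans (∙-congˡ (∑-++ xs ys f)) (≈-sym (assoc _ _ _))

      ∑-↭ : {xs ys : List A} (f : A → Carrier) → xs ↭ ys → ∑ xs f ≈ ∑ ys f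
      ∑-↭ f ↭.refl          = ≈-refl
      ∑-↭ f (↭.prep x p)    = ∙-congˡ (∑-↭ f p)
      ∑-↭ f (↭.swap x y p)  = ≈-trans (∙-congˡ (∙-congˡ (∑-↭ f p))) (x∙yz≈y∙xz _ _ _)
      ∑-↭ f (↭.trans p q)   = ≈-trans (∑-↭ f p) (∑-↭ f q)

    module _ {A B : Set} where
      ∑-swap : (xs : List A) (ys : List B) (f : A → B → Carrier) →
               ∑ xs (λ x → ∑ ys (f x)) ≈ ∑ ys (λ y → ∑ xs (λ x → f x y))
      ∑-swap []       ys f = ≈-sym (∑-ε ys)
      ∑-swap (x ∷ xs) ys f = ≈-trans (∙-congˡ (∑-swap xs ys f)) (≈-sym (∑-∙ ys _ _))

      ∑-map : (g : A → B) (xs : List A) (f : B → Carrier) → ∑ (map g xs) f ≈ ∑ xs (λ x → f (g x))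
      ∑-map g []       f = ≈-refl
      ∑-map g (x ∷ xs) f = ∙-congˡ (∑-map g xs f)

      -- Surjectivity of `g` is never checked at the point of use; the comparison of lengths
      -- replaces it.
      ∑-inj : {xs : List A} {ys : List B} (g : A → B) → (∀ {x y} → g x ≡ g y → x ≡ y) →
              Unique xs → (∀ y → y ∈ ys) → length ys ℕ.≤ length xs →
              (f : B → Carrier) → ∑ xs (λ x → f (g x)) ≈ ∑ ys f
      ∑-inj {xs} g inj u c le f = ≈-trans (≈-sym (∑-map g xs f)) (∑-↭ f (injection-↭ g inj u c le))

    module _ {A : Set} where
      ∑-ε∈ : (xs : List A) (f : A → Carrier) → (∀ {x} → x ∈ xs → f x ≈ ε) → ∑ xs f ≈ ε
      ∑-ε∈ []       f z = ≈-refl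
      ∑-ε∈ (x ∷ xs) f z = ≈-trans (∙-cong (z (here refl)) (∑-ε∈ xs f (λ p → z (there p)))) (identityˡ ε)

      ∑-δ : {xs : List A} {a : A} (f : A → Carrier) → Unique xs → a ∈ xs → (∀ x → ¬ (x ≡ a) → f x ≈ ε) → ∑ xs f ≈ f a
      ∑-δ {x ∷ xs} f (x∉ ∷ u) (here refl) z =
        ≈-trans (∙-congˡ (∑-ε∈ xs f (λ p → z _ (λ e → All.lookup x∉ p (sym e))))) (identityʳ _)
      ∑-δ {x ∷ xs} f (x∉ ∷ u) (there p)   z =
        ≈-trans (∙-cong (z x (λ e → All.lookup x∉ p e)) (∑-δ f u p z)) (identityˡ _)

    ∑-× : {A B : Set} (xs : List A) (ys : List B) (f : A × B → Carrier) →
          ∑ (cartesianProduct xs ys) f ≈ ∑ xs (λ x → ∑ ys (λ y → f (x , y)))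
    ∑-× []       ys f = ≈-refl
    ∑-× (x ∷ xs) ys f =
      ≈-trans (∑-++ (map (x ,_) ys) (cartesianProduct xs ys) f) (∙-cong (∑-map (x ,_) ys f) (∑-× xs ys f))

-- Commutative rings of characteristic 2: equational solver, divisibility, Bézout gcds.

module CharacteristicTwo where

  open import Level using (0ℓ)
  open import Algebra.Bundles using (CommutativeRing; RawRing)
  open import Algebra.Solver.Ring.AlmostCommutativeRing using (fromCommutativeRing; _-Raw-AlmostCommutative⟶_; Induced-equivalence)
  open import Data.Bool using (Bool; true; false; _xor_; _∧_)
  open import Data.Maybe using (just; nothing)
  open import Data.Product using (∃; ∃₂; _,_)
  open import Relation.Binary.Definitions using (WeaklyDecidable)
  open import Relation.Binary.PropositionalEquality using (_≡_)

  module Char2Ring (R : CommutativeRing 0ℓ 0ℓ)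
    (char2 : CommutativeRing._≈_ R (CommutativeRing._+_ R (CommutativeRing.1# R) (CommutativeRing.1# R)) (CommutativeRing.0# R)) where

    open CommutativeRing R

    -- With F₂ as coefficient ring of the solver, x + x = 0 and -x = x hold by normalisation, so
    -- identities special to characteristic 2 need no manual cancellation.
    boolRing : RawRing 0ℓ 0ℓ
    boolRing = record { Carrier = Bool ; _≈_ = _≡_ ; _+_ = _xor_ ; _*_ = _∧_ ; -_ = λ b → b ; 0# = false ; 1# = true }

    private
      ⟦_⟧ᵇ : Bool → Carrier
      ⟦ true  ⟧ᵇ = 1#
      ⟦ false ⟧ᵇ = 0#

      1≈-1 : 1# ≈ - 1#
      1≈-1 = trans (sym (+-identityʳ 1#)) (trans (+-congˡ (sym (-‿inverseʳ 1#)))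
               (trans (sym (+-assoc 1# 1# (- 1#))) (trans (+-congʳ char2) (+-identityˡ _))))

      morphism : boolRing -Raw-AlmostCommutative⟶ fromCommutativeRing R
      morphism = record
        { ⟦_⟧ = ⟦_⟧ᵇ
        ; +-homo = λ { true true → sym char2 ; true false → sym (+-identityʳ _)
                     ; false true → sym (+-identityˡ _) ; false false → sym (+-identityˡ _) }
        ; *-homo = λ { true b → sym (*-identityˡ _) ; false b → sym (zeroˡ _) }
        ; -‿homo = λ { true → 1≈-1 ; false → trans (sym (-‿inverseʳ 0#)) (+-identityˡ _) }
        ; 0-homo = refl
        ; 1-homo = refl
        }

      _≟ᵇ_ : WeaklyDecidable (Induced-equivalence morphism)
      true  ≟ᵇ true  = just refl
      false ≟ᵇ false = just refl
      _     ≟ᵇ _     = nothing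

    open import Algebra.Solver.Ring boolRing (fromCommutativeRing R) morphism _≟ᵇ_ public
      using (solve; _:=_; con; _:+_; _:*_)

    x+x : ∀ x → x + x ≈ 0#
    x+x = solve 1 (λ x → x :+ x := con false) refl

    +≈0⇒≈ : ∀ {x y} → x + y ≈ 0# → x ≈ y
    +≈0⇒≈ {x} {y} p =
      trans (solve 2 (λ x y → x := (x :+ y) :+ y) refl x y) (trans (+-congʳ p) (+-identityˡ y))

    ≈⇒+≈0 : ∀ {x y} → x ≈ y → x + y ≈ 0#
    ≈⇒+≈0 {x} {y} p = trans (+-congʳ p) (x+x y)

    infix 4 _∣_
    _∣_ : Carrier → Carrier → Set
    a ∣ b = ∃ λ q → q * a ≈ b

    Coprime : Carrier → Carrier → Set
    Coprime a b = ∃₂ λ u v → u * a + v * b ≈ 1#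

    -- The Bézout identity replaces maximality: it implies it, and it is the part that carries over
    -- to kernels of operators.
    record IsGcd (g a b : Carrier) : Set where
      constructor gcd✓
      field
        g∣a   : g ∣ a
        g∣b   : g ∣ b
        bézout : ∃₂ λ u v → u * a + v * b ≈ g

    open IsGcd public

    ∣-trans : ∀ {a b c} → a ∣ b → b ∣ c → a ∣ c
    ∣-trans (p , e) (q , f) = q * p , trans (*-assoc q p _) (trans (*-congˡ e) f)

    ∣-comb : ∀ {d a b} u v → d ∣ a → d ∣ b → d ∣ (u * a + v * b)
    ∣-comb {d} u v (p , e) (q , f) = u * p + v * q ,
      trans (solve 5 (λ u p v q d → (u :* p :+ v :* q) :* d := u :* (p :* d) :+ v :* (q :* d)) refl u p v q d)
            (+-cong (*-congˡ e) (*-congˡ f))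

    ∣-resp : ∀ {a b c} → a ∣ b → b ≈ c → a ∣ c
    ∣-resp (q , e) f = q , trans e f

    ∣-respˡ : ∀ {a b c} → a ≈ b → a ∣ c → b ∣ c
    ∣-respˡ f (q , e) = q , trans (*-congˡ (sym f)) e

    coprime-sym : ∀ {a b} → Coprime a b → Coprime b a
    coprime-sym (u , v , e) = v , u , trans (+-comm _ _) e

    coprime-resp : ∀ {a b a' b'} → a ≈ a' → b ≈ b' → Coprime a b → Coprime a' b'
    coprime-resp p q (u , v , e) = u , v , trans (+-cong (*-congˡ (sym p)) (*-congˡ (sym q))) e

    coprime-1 : ∀ {a} → Coprime a 1#
    coprime-1 {a} = 0# , 1# , solve 1 (λ a → con false :* a :+ con true :* con true := con true) refl a

    coprime-* : ∀ {a b c} → Coprime a b → Coprime a c → Coprime a (b * c)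
    coprime-* {a} {b} {c} (u , v , e) (p , q , f) =
      u * p * a + u * q * c + v * b * p , v * q ,
      trans (solve 7 (λ a b c u v p q → (u :* p :* a :+ u :* q :* c :+ v :* b :* p) :* a :+ v :* q :* (b :* c)
                          := (u :* a :+ v :* b) :* (p :* a :+ q :* c)) refl a b c u v p q)
            (trans (*-cong e f) (*-identityˡ 1#))

    coprime-*ʳ : ∀ {a b c} → Coprime a (b * c) → Coprime a c
    coprime-*ʳ {a} {b} {c} (u , v , e) = u , v * b , trans (+-congˡ (*-assoc v b c)) e

    coprime-∣ : ∀ {a b d} → Coprime a b → d ∣ a → d ∣ b → d ∣ 1#
    coprime-∣ (u , v , e) p q = ∣-resp (∣-comb u v p q) e

    coprime⇒gcd : ∀ {a b} → Coprime a b → IsGcd 1# a b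
    coprime⇒gcd {a} {b} c = gcd✓ (a , *-identityʳ a) (b , *-identityʳ b) c

    gcd-∣ : ∀ {g g' a b} → IsGcd g a b → IsGcd g' a b → g ∣ g'
    gcd-∣ G G' with bézout G'
    ... | u , v , e = ∣-resp (∣-comb u v (g∣a G) (g∣b G)) e

    gcd-sym : ∀ {g a b} → IsGcd g a b → IsGcd g b a
    gcd-sym (gcd✓ p q (u , v , e)) = gcd✓ q p (v , u , trans (+-comm _ _) e)

    gcd-resp : ∀ {g a b a' b'} → a ≈ a' → b ≈ b' → IsGcd g a b → IsGcd g a' b'
    gcd-resp p q (gcd✓ x y (u , v , e)) =
      gcd✓ (∣-resp x p) (∣-resp y q) (u , v , trans (+-cong (*-congˡ (sym p)) (*-congˡ (sym q))) e)

    gcd-scale : ∀ {g a b} c → IsGcd g a b → IsGcd (c * g) (c * a) (c * b)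
    gcd-scale {g} {a} {b} c (gcd✓ (p , e) (q , f) (u , v , k)) =
      gcd✓ (p , trans (solve 3 (λ p c g → p :* (c :* g) := c :* (p :* g)) refl p c g) (*-congˡ e))
           (q , trans (solve 3 (λ p c g → p :* (c :* g) := c :* (p :* g)) refl q c g) (*-congˡ f))
           (u , v , trans (solve 5 (λ u v a b c → u :* (c :* a) :+ v :* (c :* b) := c :* (u :* a :+ v :* b)) refl u v a b c)
                          (*-congˡ k))

    gcd-addmul : ∀ {g a b} q → IsGcd g a b → IsGcd g (a + q * b) b
    gcd-addmul {g} {a} {b} q (gcd✓ x y (u , v , k)) =
      gcd✓ (∣-resp (∣-comb 1# q x y) (+-congʳ (*-identityˡ a))) y
           (u , u * q + v , trans (solve 5 (λ u v a b q → u :* (a :+ q :* b) :+ (u :* q :+ v) :* b := u :* a :+ v :* b) refl u v a b q) k)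

    gcd-unit : ∀ {g a b c} → Coprime c b → IsGcd g (c * a) b → IsGcd g a b
    gcd-unit {g} {a} {b} {c} (s , t , k) (gcd✓ x y (u , v , e)) =
      gcd✓ (∣-resp (∣-comb s (t * a) x y)
              (trans (solve 5 (λ s t a b c → s :* (c :* a) :+ t :* a :* b := (s :* c :+ t :* b) :* a) refl s t a b c)
                (trans (*-congʳ k) (*-identityˡ a))))
           y (u * c , v , trans (+-congʳ (*-assoc u c a)) e)

    -- With 1 = α p + β q the ideal (a q + b p, p q) contains a q = α a (p q) + β q (a q), hence g q,
    -- and symmetrically h p; finally g h = α g (h p) + β h (g q).
    gcd-CRT : ∀ {g h a b p q} → Coprime p q → IsGcd g a p → IsGcd h b q →
              IsGcd (g * h) (a * q + b * p) (p * q)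
    gcd-CRT {g} {h} {a} {b} {p} {q} (α , β , k) (gcd✓ (a' , ea) (p' , ep) (u , v , e)) (gcd✓ (b' , eb) (q' , eq) (s , t , f)) =
      gcd✓ (a' * q' + b' * p' ,
             trans (solve 6 (λ a' b' p' q' g h → (a' :* q' :+ b' :* p') :* (g :* h) := (a' :* g) :* (q' :* h) :+ (b' :* h) :* (p' :* g)) refl a' b' p' q' g h)
               (+-cong (*-cong ea eq) (*-cong eb ep)))
           (p' * q' , trans (solve 4 (λ p' q' g h → (p' :* q') :* (g :* h) := (p' :* g) :* (q' :* h)) refl p' q' g h) (*-cong ep eq))
           (α * g * (s * α * p) + β * h * (u * β * q) ,
            α * g * (s * (α * a + β * b) + t) + β * h * (u * (α * a + β * b) + v) ,
            trans (solve 12 (λ α β g h s t u v a b p q →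
                (α :* g :* (s :* α :* p) :+ β :* h :* (u :* β :* q)) :* (a :* q :+ b :* p)
                  :+ (α :* g :* (s :* (α :* a :+ β :* b) :+ t) :+ β :* h :* (u :* (α :* a :+ β :* b) :+ v)) :* (p :* q)
                := α :* g :* (p :* (s :* (b :* (α :* p :+ β :* q)) :+ t :* q)) :+ β :* h :* (q :* (u :* (a :* (α :* p :+ β :* q)) :+ v :* p))) refl α β g h s t u v a b p q)
            (trans (+-cong (*-congˡ (trans (*-congˡ (trans (+-congʳ (*-congˡ (trans (*-congˡ k) (*-identityʳ b)))) f)) (*-comm p h)))
                           (*-congˡ (trans (*-congˡ (trans (+-congʳ (*-congˡ (trans (*-congˡ k) (*-identityʳ a)))) e)) (*-comm q g))))
            (trans (solve 6 (λ α β g h p q → α :* g :* (h :* p) :+ β :* h :* (g :* q) := (g :* h) :* (α :* p :+ β :* q)) refl α β g h p q)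
            (trans (*-congˡ k) (*-identityʳ (g * h))))))

-- The ring F₂[x]: degrees, Euclidean algorithm, irreducible polynomials.

module BinaryPolynomials where

  open import Level using (0ℓ)
  open CharacteristicTwo
  open import Algebra.Bundles using (CommutativeRing)
  open import Data.Bool using (Bool; true; false; _xor_; _∧_; if_then_else_)
  open import Data.Bool.Properties using (xor-assoc; xor-comm; xor-identityʳ; xor-same; ∧-comm; ∧-distribʳ-xor; ∧-zeroʳ)
  open import Data.Nat as ℕ using (ℕ; zero; suc; z≤n; s≤s)
  import Data.Nat.Properties as ℕP
  open import Data.List using ([]; _∷_; length)
  open import Data.Product using (∃; _×_; _,_; proj₁; proj₂)
  open import Data.Sum using (_⊎_; inj₁; inj₂)
  open import Data.Empty using (⊥-elim)
  open import Relation.Nullary using (¬_)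
  open import Relation.Binary.PropositionalEquality as ≡ using (_≡_; cong; cong₂; subst)

  co : Poly₂ → ℕ → Bool
  co []      _       = false
  co (c ∷ f) zero    = c
  co (c ∷ f) (suc k) = co f k

  infix 4 _≋_
  -- Coefficientwise equality ignores trailing zeros, so the ring laws can be proved without `norm`;
  -- it is shown below to agree with `_≈₂_`. The record wrapper keeps the two polynomials
  -- recoverable by unification.
  record _≋_ (f g : Poly₂) : Set where
    constructor mk≋
    field at : ∀ k → co f k ≡ co g k
  open _≋_ public

  co-+ : ∀ f g k → co (f +₂ g) k ≡ co f k xor co g k
  co-+ []      g       k       = ≡.refl
  co-+ (c ∷ f) []      k       = ≡.sym (xor-identityʳ _)
  co-+ (c ∷ f) (d ∷ g) zero    = ≡.refl
  co-+ (c ∷ f) (d ∷ g) (suc k) = co-+ f g k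

  co-scale : ∀ c f k → co (scale₂ c f) k ≡ c ∧ co f k
  co-scale c []      k       = ≡.sym (∧-zeroʳ c)
  co-scale c (d ∷ f) zero    = ≡.refl
  co-scale c (d ∷ f) (suc k) = co-scale c f k

  private
    ≋-refl : ∀ {f} → f ≋ f
    ≋-refl = mk≋ λ _ → ≡.refl
    ≋-sym : ∀ {f g} → f ≋ g → g ≋ f
    ≋-sym p = mk≋ λ k → ≡.sym (at p k)
    ≋-trans : ∀ {f g h} → f ≋ g → g ≋ h → f ≋ h
    ≋-trans p q = mk≋ λ k → ≡.trans (at p k) (at q k)

    +-cong₂ : ∀ {f f' g g'} → f ≋ f' → g ≋ g' → (f +₂ g) ≋ (f' +₂ g')
    +-cong₂ {f} {f'} {g} {g'} p q = mk≋ λ k → ≡.trans (co-+ f g k) (≡.trans (cong₂ _xor_ (at p k) (at q k)) (≡.sym (co-+ f' g' k)))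
    +-assoc₂ : ∀ f g h → ((f +₂ g) +₂ h) ≋ (f +₂ (g +₂ h))
    +-assoc₂ f g h = mk≋ λ k → ≡.trans (≡.trans (co-+ (f +₂ g) h k) (cong (_xor co h k) (co-+ f g k)))
      (≡.trans (xor-assoc (co f k) (co g k) (co h k)) (≡.sym (≡.trans (co-+ f (g +₂ h) k) (cong (co f k xor_) (co-+ g h k)))))
    +-comm₂ : ∀ f g → (f +₂ g) ≋ (g +₂ f)
    +-comm₂ f g = mk≋ λ k → ≡.trans (co-+ f g k) (≡.trans (xor-comm (co f k) (co g k)) (≡.sym (co-+ g f k)))
    +-idʳ : ∀ f → (f +₂ []) ≋ f
    +-idʳ f = mk≋ λ k → ≡.trans (co-+ f [] k) (xor-identityʳ _)
    +-self : ∀ f → (f +₂ f) ≋ []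
    +-self f = mk≋ λ k → ≡.trans (co-+ f f k) (xor-same (co f k))
    +-left-swap : ∀ f g h → (f +₂ (g +₂ h)) ≋ (g +₂ (f +₂ h))
    +-left-swap f g h = ≋-trans (≋-sym (+-assoc₂ f g h)) (≋-trans (+-cong₂ (+-comm₂ f g) ≋-refl) (+-assoc₂ g f h))
    +-interchange : ∀ f g h k → ((f +₂ g) +₂ (h +₂ k)) ≋ ((f +₂ h) +₂ (g +₂ k))
    +-interchange f g h k = ≋-trans (+-assoc₂ f g (h +₂ k)) (≋-trans (+-cong₂ (≋-refl {f}) (+-left-swap g h k)) (≋-sym (+-assoc₂ f h (g +₂ k))))

  ∷-cong : ∀ {c d f g} → c ≡ d → f ≋ g → (c ∷ f) ≋ (d ∷ g)
  ∷-cong p q = mk≋ λ { zero → p ; (suc k) → at q k }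

  tail-≋ : ∀ {c d f g} → (c ∷ f) ≋ (d ∷ g) → f ≋ g
  tail-≋ p = mk≋ λ k → at p (suc k)

  0∷≋ : ∀ {f} → f ≋ [] → (false ∷ f) ≋ []
  0∷≋ p = mk≋ λ { zero → ≡.refl ; (suc k) → at p k }

  scale-true : ∀ f → scale₂ true f ≋ f
  scale-true f = mk≋ λ k → co-scale true f k
  scale-false : ∀ f → scale₂ false f ≋ []
  scale-false f = mk≋ λ k → co-scale false f k
  scale-cong : ∀ c {f g} → f ≋ g → scale₂ c f ≋ scale₂ c g
  scale-cong c {f} {g} p = mk≋ λ k → ≡.trans (co-scale c f k) (≡.trans (cong (c ∧_) (at p k)) (≡.sym (co-scale c g k)))

  private
    scale-xor : ∀ c d f → scale₂ (c xor d) f ≋ (scale₂ c f +₂ scale₂ d f)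
    scale-xor c d f = mk≋ λ k → ≡.trans (co-scale (c xor d) f k) (≡.trans (∧-distribʳ-xor (co f k) c d)
      (≡.sym (≡.trans (co-+ (scale₂ c f) (scale₂ d f) k) (cong₂ _xor_ (co-scale c f k) (co-scale d f k)))))

    *-congʳ₂ : ∀ f {g h} → g ≋ h → (f *₂ g) ≋ (f *₂ h)
    *-congʳ₂ []      p = ≋-refl
    *-congʳ₂ (c ∷ f) p = +-cong₂ (scale-cong c p) (∷-cong ≡.refl (*-congʳ₂ f p))
    *-zeroʳ₂ : ∀ f → (f *₂ []) ≋ []
    *-zeroʳ₂ []      = ≋-refl
    *-zeroʳ₂ (c ∷ f) = 0∷≋ (*-zeroʳ₂ f)
    *-cons : ∀ f c g → (f *₂ (c ∷ g)) ≋ (scale₂ c f +₂ (false ∷ (f *₂ g)))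
    *-cons []      c g = mk≋ λ { zero → ≡.refl ; (suc k) → ≡.refl }
    *-cons (a ∷ f) c g = ∷-cong (cong (_xor false) (∧-comm a c))
      (≋-trans (+-cong₂ (≋-refl {scale₂ a g}) (*-cons f c g)) (+-left-swap (scale₂ a g) (scale₂ c f) (false ∷ (f *₂ g))))
    *-comm₂ : ∀ f g → (f *₂ g) ≋ (g *₂ f)
    *-comm₂ []      g = ≋-sym (*-zeroʳ₂ g)
    *-comm₂ (c ∷ f) g = ≋-trans (+-cong₂ (≋-refl {scale₂ c g}) (∷-cong ≡.refl (*-comm₂ f g))) (≋-sym (*-cons g c f))
    *-cong₂ : ∀ {f f' g g'} → f ≋ f' → g ≋ g' → (f *₂ g) ≋ (f' *₂ g')
    *-cong₂ {f} {f'} {g} {g'} p q = ≋-trans (*-congʳ₂ f q) (≋-trans (*-comm₂ f g') (≋-trans (*-congʳ₂ g' p) (*-comm₂ g' f')))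
    *-distribʳ₂ : ∀ h f g → ((f +₂ g) *₂ h) ≋ ((f *₂ h) +₂ (g *₂ h))
    *-distribʳ₂ h []      g       = ≋-refl
    *-distribʳ₂ h (c ∷ f) []      = ≋-sym (+-idʳ _)
    *-distribʳ₂ h (c ∷ f) (d ∷ g) =
      ≋-trans (+-cong₂ (scale-xor c d h) (∷-cong ≡.refl (*-distribʳ₂ h f g)))
        (+-interchange (scale₂ c h) (scale₂ d h) (false ∷ (f *₂ h)) (false ∷ (g *₂ h)))
    scale-* : ∀ c f g → (scale₂ c f *₂ g) ≋ scale₂ c (f *₂ g)
    scale-* true  f g = ≋-trans (*-cong₂ (scale-true f) (≋-refl {g})) (≋-sym (scale-true (f *₂ g)))
    scale-* false f g = ≋-trans (*-cong₂ (scale-false f) (≋-refl {g})) (≋-sym (scale-false (f *₂ g)))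
    *-assoc₂ : ∀ f g h → ((f *₂ g) *₂ h) ≋ (f *₂ (g *₂ h))
    *-assoc₂ []      g h = ≋-refl
    *-assoc₂ (c ∷ f) g h = ≋-trans (*-distribʳ₂ h (scale₂ c g) (false ∷ (f *₂ g)))
      (+-cong₂ (scale-* c g h) (≋-trans (+-cong₂ (scale-false h) (∷-cong ≡.refl (*-assoc₂ f g h))) ≋-refl))
    *-idˡ : ∀ f → (one₂ *₂ f) ≋ f
    *-idˡ f = ≋-trans (+-cong₂ (scale-true f) (0∷≋ ≋-refl)) (+-idʳ f)

  polyRing : CommutativeRing 0ℓ 0ℓ
  polyRing = record
    { Carrier = Poly₂ ; _≈_ = _≋_ ; _+_ = _+₂_ ; _*_ = _*₂_ ; -_ = λ f → f ; 0# = [] ; 1# = one₂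
    ; isCommutativeRing = record
      { isRing = record
        { +-isAbelianGroup = record
          { isGroup = record
            { isMonoid = record
              { isSemigroup = record
                { isMagma = record { isEquivalence = record { refl = ≋-refl ; sym = ≋-sym ; trans = ≋-trans } ; ∙-cong = +-cong₂ }
                ; assoc = +-assoc₂ }
              ; identity = (λ f → ≋-refl) , +-idʳ }
            ; inverse = +-self , +-self
            ; ⁻¹-cong = λ p → p }
          ; comm = +-comm₂ }
        ; *-cong = *-cong₂
        ; *-assoc = *-assoc₂
        ; *-identity = *-idˡ , (λ f → ≋-trans (*-comm₂ f one₂) (*-idˡ f))
        ; distrib = (λ h f g → ≋-trans (*-comm₂ h (f +₂ g)) (≋-trans (*-distribʳ₂ h f g) (+-cong₂ (*-comm₂ f h) (*-comm₂ g h)))) , *-distribʳ₂ }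
      ; *-comm = *-comm₂ } }

  open CommutativeRing polyRing public hiding (_≈_; 0#; 1#; -_; Carrier)
  one+one : one₂ + one₂ ≋ []
  one+one = mk≋ λ { zero → ≡.refl ; (suc k) → ≡.refl }

  open Char2Ring polyRing one+one public

  private
    consN : Bool → Poly₂ → Poly₂
    consN c []       = if c then true ∷ [] else []
    consN c (d ∷ ds) = c ∷ d ∷ ds

    norm-∷ : ∀ c cs → norm (c ∷ cs) ≡ consN c (norm cs)
    norm-∷ c cs with norm cs
    ... | []     = ≡.refl
    ... | d ∷ ds = ≡.refl

    consN-≋ : ∀ c f → consN c f ≋ (c ∷ f)
    consN-≋ true  []      = refl
    consN-≋ false []      = mk≋ λ { zero → ≡.refl ; (suc k) → ≡.refl }
    consN-≋ c     (d ∷ f) = refl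

  norm-≋ : ∀ f → norm f ≋ f
  norm-≋ []      = refl
  norm-≋ (c ∷ f) rewrite norm-∷ c f = trans (consN-≋ c (norm f)) (∷-cong ≡.refl (norm-≋ f))

  ≈₂⇒≋ : ∀ {f g} → f ≈₂ g → f ≋ g
  ≈₂⇒≋ {f} {g} p = trans (sym (norm-≋ f)) (trans (reflexive p) (norm-≋ g))

  ≋⇒≈₂ : ∀ {f g} → f ≋ g → f ≈₂ g
  ≋⇒≈₂ {[]}    {[]}    p = ≡.refl
  ≋⇒≈₂ {[]}    {d ∷ g} p rewrite norm-∷ d g | ≡.sym (≋⇒≈₂ {[]} {g} (mk≋ λ k → at p (suc k))) | ≡.sym (at p 0) = ≡.refl
  ≋⇒≈₂ {c ∷ f} {[]}    p rewrite norm-∷ c f | ≋⇒≈₂ {f} {[]} (mk≋ λ k → at p (suc k)) | at p 0 = ≡.refl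
  ≋⇒≈₂ {c ∷ f} {d ∷ g} p rewrite norm-∷ c f | norm-∷ d g | ≋⇒≈₂ (tail-≋ p) | at p 0 = ≡.refl

  -- A strict bound, so the zero polynomial satisfies every `Lt d` and the convention deg 0 = 0 of
  -- `deg` never interferes.
  record Lt (d : ℕ) (f : Poly₂) : Set where
    constructor mkLt
    field above : ∀ k → d ℕ.≤ k → co f k ≡ false
  open Lt public

  record Mon (d : ℕ) (f : Poly₂) : Set where
    constructor mkMon
    field
      top : co f d ≡ true
      bnd : Lt (suc d) f
  open Mon public

  Lt-resp : ∀ {d f g} → f ≋ g → Lt d f → Lt d g
  Lt-resp p l = mkLt λ k le → ≡.trans (≡.sym (at p k)) (above l k le)
  Mon-resp : ∀ {d f g} → f ≋ g → Mon d f → Mon d g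
  Mon-resp {d} p (mkMon t b) = mkMon (≡.trans (≡.sym (at p d)) t) (Lt-resp p b)

  Lt-mono : ∀ {d e f} → d ℕ.≤ e → Lt d f → Lt e f
  Lt-mono p l = mkLt λ k le → above l k (ℕP.≤-trans p le)

  Lt0⇒≋ : ∀ {f} → Lt 0 f → f ≋ []
  Lt0⇒≋ l = mk≋ λ k → above l k z≤n

  Lt-[] : ∀ {d} → Lt d []
  Lt-[] = mkLt λ _ _ → ≡.refl

  Lt-tail : ∀ {d c f} → Lt (suc d) (c ∷ f) → Lt d f
  Lt-tail l = mkLt λ k le → above l (suc k) (s≤s le)

  Lt-∷ : ∀ {d c f} → Lt d f → Lt (suc d) (c ∷ f)
  Lt-∷ l = mkLt λ { (suc k) (s≤s le) → above l k le }

  Mon-tail : ∀ {d c f} → Mon (suc d) (c ∷ f) → Mon d f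
  Mon-tail (mkMon t b) = mkMon t (Lt-tail b)

  Mon-∷ : ∀ {d c f} → Mon d f → Mon (suc d) (c ∷ f)
  Mon-∷ (mkMon t b) = mkMon t (Lt-∷ b)

  Lt-+ : ∀ {d f g} → Lt d f → Lt d g → Lt d (f + g)
  Lt-+ {d} {f} {g} p q = mkLt λ k le → ≡.trans (co-+ f g k) (cong₂ _xor_ (above p k le) (above q k le))

  Lt-scale : ∀ {d f} c → Lt d f → Lt d (scale₂ c f)
  Lt-scale {d} {f} c p = mkLt λ k le → ≡.trans (co-scale c f k) (≡.trans (cong (c ∧_) (above p k le)) (∧-zeroʳ c))

  Mon-+Lt : ∀ {d f g} → Mon d f → Lt d g → Mon d (f + g)
  Mon-+Lt {d} {f} {g} (mkMon t b) q =
    mkMon (≡.trans (co-+ f g d) (cong₂ _xor_ t (above q d ℕP.≤-refl))) (Lt-+ b (Lt-mono (ℕP.n≤1+n d) q))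

  Lt+-Mon : ∀ {d f g} → Lt d f → Mon d g → Mon d (f + g)
  Lt+-Mon {d} {f} {g} p q = Mon-resp (+-comm g f) (Mon-+Lt q p)

  Lt-pred : ∀ {d f} → Lt (suc d) f → co f d ≡ false → Lt d f
  Lt-pred {d} {f} l e = mkLt λ k le → go k le (ℕP.m≤n⇒m<n∨m≡n le)
    where
    go : ∀ k → d ℕ.≤ k → d ℕ.< k ⊎ d ≡ k → co f k ≡ false
    go k _ (inj₁ lt) = above l k lt
    go k _ (inj₂ ≡.refl) = e

  Mon+Mon : ∀ {d f g} → Mon d f → Mon d g → Lt d (f + g)
  Mon+Mon {d} {f} {g} (mkMon t b) (mkMon t' b') =
    Lt-pred (Lt-+ b b') (≡.trans (co-+ f g d) (cong₂ _xor_ t t'))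

  -- One strict and one weak bound: deg f < d and deg g ≤ e. This avoids a truncated subtraction and
  -- allows d = 0.
  Lt-* : ∀ {d e f g} → Lt d f → Lt (suc e) g → Lt (d ℕ.+ e) (f * g)
  Lt-* {d}     {e} {[]}    p q = Lt-[]
  Lt-* {zero}  {e} {c ∷ f} {g} p q = Lt-resp (sym (trans (*-congʳ {g} (Lt0⇒≋ p)) refl)) Lt-[]
  Lt-* {suc d} {e} {c ∷ f} p q = Lt-+ (Lt-scale c (Lt-mono (s≤s (ℕP.m≤n+m e d)) q)) (Lt-∷ (Lt-* (Lt-tail p) q))

  Mon-* : ∀ {d e f g} → Mon d f → Mon e g → Mon (d ℕ.+ e) (f * g)
  Mon-* {d}     {e} {[]}    (mkMon () _) q
  Mon-* {zero}  {e} {c ∷ f} {g} p q = Mon-resp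
    (sym (trans (*-congʳ {g} {c ∷ f} {one₂} (∷-cong (top p) (Lt0⇒≋ (Lt-tail (bnd p))))) (*-identityˡ g))) q
  Mon-* {suc d} {e} {c ∷ f} p q =
    Lt+-Mon (Lt-scale c (Lt-mono (s≤s (ℕP.m≤n+m e d)) (bnd q))) (Mon-∷ (Mon-* (Mon-tail p) q))

  Mon-one : Mon 0 one₂
  Mon-one = mkMon ≡.refl (mkLt λ { (suc k) _ → ≡.refl })

  Mon0⇒1 : ∀ {f} → Mon 0 f → f ≋ one₂
  Mon0⇒1 {[]} (mkMon () _)
  Mon0⇒1 {c ∷ f} m = ∷-cong (top m) (Lt0⇒≋ (Lt-tail (bnd m)))

  private
    norm-zero : ∀ {f} → f ≋ [] → norm f ≡ []
    norm-zero p = ≋⇒≈₂ p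

    consN-length : ∀ c f {k} → length f ≡ suc k → length (consN c f) ≡ suc (suc k)
    consN-length c (d ∷ f) e = cong suc e

    length-norm : ∀ {d f} → Mon d f → length (norm f) ≡ suc d
    length-norm {d} {[]} (mkMon () _)
    length-norm {zero} {c ∷ f} m rewrite norm-∷ c f | norm-zero (Lt0⇒≋ (Lt-tail (bnd m))) | top m = ≡.refl
    length-norm {suc d} {c ∷ f} m rewrite norm-∷ c f = consN-length c (norm f) (length-norm (Mon-tail m))

  Mon-deg : ∀ {d f} → Mon d f → deg f ≡ d
  Mon-deg m = cong (ℕ._∸ 1) (length-norm m)

  zero-or-Mon : ∀ f → f ≋ [] ⊎ ∃ λ d → Mon d f
  zero-or-Mon [] = inj₁ refl
  zero-or-Mon (c ∷ f) with zero-or-Mon f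
  ... | inj₂ (d , m) = inj₂ (suc d , Mon-∷ m)
  zero-or-Mon (false ∷ f) | inj₁ z = inj₁ (0∷≋ z)
  zero-or-Mon (true  ∷ f) | inj₁ z = inj₂ (0 , Mon-resp (∷-cong ≡.refl (sym z)) Mon-one)

  Monic⇒Mon : ∀ {f} → Monic f → Mon (deg f) f
  Monic⇒Mon {f} nz with zero-or-Mon f
  ... | inj₁ z = ⊥-elim (nz (norm-zero z))
  ... | inj₂ (d , m) = subst (λ k → Mon k f) (≡.sym (Mon-deg m)) m

  Mon⇒Monic : ∀ {d f} → Mon d f → Monic f
  Mon⇒Monic m e with ≡.trans (≡.sym (length-norm m)) (cong length e)
  ... | ()

  Mon-unique : ∀ {d e f} → Mon d f → Mon e f → d ≡ e
  Mon-unique p q = ≡.trans (≡.sym (Mon-deg p)) (Mon-deg q)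

  Mon≉0 : ∀ {d f} → Mon d f → ¬ (f ≋ [])
  Mon≉0 m z = Mon⇒Monic m (norm-zero z)

  Lt-Mon : ∀ {d e f} → Lt d f → Mon e f → e ℕ.< d
  Lt-Mon {d} {e} l m with ℕP.<-≤-connex e d
  ... | inj₁ p = p
  ... | inj₂ p with ≡.trans (≡.sym (above l e p)) (top m)
  ... | ()

  *-nonzero : ∀ {f g} → (f * g) ≋ [] → f ≋ [] ⊎ g ≋ []
  *-nonzero {f} {g} p with zero-or-Mon f | zero-or-Mon g
  ... | inj₁ z | _      = inj₁ z
  ... | inj₂ _ | inj₁ z = inj₂ z
  ... | inj₂ (d , m) | inj₂ (e , m') = ⊥-elim (Mon≉0 (Mon-* m m') p)

  *-cancel : ∀ {d p f g} → Mon d p → (p * f) ≋ (p * g) → f ≋ g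
  *-cancel {d} {p} {f} {g} m e with *-nonzero {p} {f + g} (trans (distribˡ p f g) (≈⇒+≈0 e))
  ... | inj₁ z = ⊥-elim (Mon≉0 m z)
  ... | inj₂ z = +≈0⇒≈ z

  ∣⇒Mon : ∀ {f g d} → f ∣ g → Mon d g → ∃ λ e → Mon e f × e ℕ.≤ d
  ∣⇒Mon {f} {g} {d} (q , e) m with zero-or-Mon f | zero-or-Mon q
  ... | inj₁ z | _ = ⊥-elim (Mon≉0 m (trans (sym e) (trans (*-congˡ {q} z) (zeroʳ q))))
  ... | inj₂ _ | inj₁ z = ⊥-elim (Mon≉0 m (trans (sym e) (*-congʳ {f} z)))
  ... | inj₂ (k , mf) | inj₂ (j , mq) = k , mf , subst (k ℕ.≤_) (Mon-unique (Mon-resp e (Mon-* mq mf)) m) (ℕP.m≤n+m k j)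

  ∣1⇒≋1 : ∀ {f} → f ∣ one₂ → f ≋ one₂
  ∣1⇒≋1 p with ∣⇒Mon p Mon-one
  ... | .0 , m , z≤n = Mon0⇒1 m

  -- Mutual divisibility makes the degrees equal, so the cofactor has degree 0; over F₂ it is then
  -- 1.
  ∣-antisym : ∀ {f g d} → Mon d g → f ∣ g → g ∣ f → f ≋ g
  ∣-antisym {f} {g} {d} mg p q with ∣⇒Mon p mg
  ... | e , mf , e≤d with ∣⇒Mon q mf
  ... | d' , mg' , d'≤e with Mon-unique mg mg'
  ... | ≡.refl with ℕP.≤-antisym e≤d d'≤e
  ... | ≡.refl with p
  ... | w , eq with zero-or-Mon w
  ... | inj₁ z = ⊥-elim (Mon≉0 mg (trans (sym eq) (*-congʳ {f} z)))
  ... | inj₂ (j , mw) with ℕP.+-cancelʳ-≡ e j 0 (Mon-unique (Mon-resp eq (Mon-* mw mf)) mg)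
  ... | ≡.refl = trans (sym (*-identityˡ f)) (trans (*-congʳ {f} (sym (Mon0⇒1 mw))) eq)

  X : Poly₂
  X = false ∷ true ∷ []

  X^ : ℕ → Poly₂
  X^ zero    = one₂
  X^ (suc k) = false ∷ X^ k

  Mon-X^ : ∀ k → Mon k (X^ k)
  Mon-X^ zero    = Mon-one
  Mon-X^ (suc k) = Mon-∷ (Mon-X^ k)

  X*≋ : ∀ f → X * f ≋ false ∷ f
  X*≋ f = trans (+-congʳ {_} (scale-false f)) (∷-cong ≡.refl (*-identityˡ f))

  X^suc : ∀ k → X^ (suc k) ≋ X * X^ k
  X^suc k = sym (X*≋ (X^ k))

  ∷≋ : ∀ c f → (c ∷ f) ≋ (c ∷ []) + X * f
  ∷≋ c f = trans (∷-cong (≡.sym (xor-identityʳ c)) refl) (+-congˡ {c ∷ []} (sym (X*≋ f)))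

  -- Euclid's algorithm one leading term at a time. The recursion is on the bounds `a` and `b`, not
  -- on true degrees: a vanishing top coefficient, or the cancellation of two leading terms by a
  -- shifted addition, lowers one bound by one, so termination is structural.
  gcd-step : ∀ a b f g → Lt a f → Lt b g → ∃ λ k → IsGcd k f g
  gcd-step zero b f g lf lg = g , gcd✓ ([] , sym (Lt0⇒≋ lf)) (one₂ , *-identityˡ g)
    ([] , one₂ , trans (+-congˡ {[] * f} (*-identityˡ g)) (+-identityˡ g))
  gcd-step (suc a) zero f g lf lg = f , gcd✓ (one₂ , *-identityˡ f) ([] , sym (Lt0⇒≋ lg))
    (one₂ , [] , trans (+-congʳ {[] * g} (*-identityˡ f)) (+-identityʳ f))
  gcd-step (suc a) (suc b) f g lf lg with co f a in ef | co g b in eg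
  ... | false | _ = gcd-step a (suc b) f g (Lt-pred lf ef) lg
  ... | true | false = gcd-step (suc a) b f g lf (Lt-pred lg eg)
  ... | true | true with ℕP.≤-total b a
  ...   | inj₁ b≤a = _ , gcd-resp (solve 3 (λ f g x → (f :+ x :* g) :+ x :* g := f) refl f g x) refl
                           (gcd-addmul x (proj₂ (gcd-step a (suc b) (f + x * g) g
                              (Mon+Mon (mkMon ef lf) (subst (λ k → Mon k (x * g)) (ℕP.m∸n+n≡m b≤a) (Mon-* (Mon-X^ (a ℕ.∸ b)) (mkMon eg lg)))) lg)))
    where x = X^ (a ℕ.∸ b)
  ...   | inj₂ a≤b = _ , gcd-sym (gcd-resp (solve 3 (λ f g x → (g :+ x :* f) :+ x :* f := g) refl f g x) refl
                           (gcd-addmul x (gcd-sym (proj₂ (gcd-step (suc a) b f (g + x * f) lf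
                              (Mon+Mon (mkMon eg lg) (subst (λ k → Mon k (x * f)) (ℕP.m∸n+n≡m a≤b) (Mon-* (Mon-X^ (b ℕ.∸ a)) (mkMon ef lf)))))))))
    where
    x = X^ (b ℕ.∸ a)

  Lt-length : ∀ f → Lt (length f) f
  Lt-length []      = Lt-[]
  Lt-length (c ∷ f) = Lt-∷ (Lt-length f)

  gcd : ∀ f g → ∃ λ k → IsGcd k f g
  gcd f g = gcd-step (length f) (length g) f g (Lt-length f) (Lt-length g)

  gdeg : Poly₂ → Poly₂ → ℕ
  gdeg f g = deg (proj₁ (gcd f g))

  -- The computed gcd is used as a black box: any exhibited gcd divides it and is divided by it,
  -- hence equals it. All later gcd degrees are found this way.
  gdeg-unique : ∀ {f g k d e} → Mon e g → IsGcd k f g → Mon d k → gdeg f g ≡ d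
  gdeg-unique {f} {g} mg G mk =
    Mon-deg (Mon-resp (∣-antisym (proj₁ (proj₂ (∣⇒Mon (g∣b G') mg))) (gcd-∣ G G') (gcd-∣ G' G)) mk)
    where G' = proj₂ (gcd f g)

  gcd-Mon : ∀ f {g e} → Mon e g → Mon (gdeg f g) (proj₁ (gcd f g)) × gdeg f g ℕ.≤ e
  gcd-Mon f {g} {e} mg with ∣⇒Mon (g∣b (proj₂ (gcd f g))) mg
  ... | d , m , le rewrite Mon-deg m = m , le

  -- Horner division: if f leaves a remainder R of degree below d, then c + x R has degree at most
  -- d, and at most one further copy of p has to be added.
  divMod : ∀ {d p} → Mon d p → ∀ f → ∃ λ q → Lt d (f + q * p)
  divMod m [] = [] , Lt-[]
  divMod {zero} {p} m (c ∷ f) = c ∷ f , Lt-resp (sym (≈⇒+≈0 (trans (sym (*-identityʳ (c ∷ f))) (*-congˡ {c ∷ f} (sym (Mon0⇒1 m)))))) Lt-[]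
  divMod {suc d} {p} m (c ∷ f) with divMod m f
  ... | q , l with co (f + q * p) d in e
  ... | false = X * q , Lt-resp eq (Lt-∷ {c = c} (Lt-pred l e))
    where
    eq : (c ∷ (f + q * p)) ≋ (c ∷ f) + X * q * p
    eq = trans (∷≋ c _) (trans (solve 5 (λ c x f q p → c :+ x :* (f :+ q :* p) := (c :+ x :* f) :+ x :* q :* p) refl (c ∷ []) X f q p)
           (+-congʳ {X * q * p} (sym (∷≋ c f))))
  ... | true = X * q + one₂ , Lt-resp eq (Mon+Mon (Mon-∷ {c = c} (mkMon e l)) m)
    where
    eq : (c ∷ (f + q * p)) + p ≋ (c ∷ f) + (X * q + one₂) * p
    eq = trans (+-congʳ {p} (∷≋ c _)) (trans (solve 5 (λ c x f q p → (c :+ x :* (f :+ q :* p)) :+ p := (c :+ x :* f) :+ (x :* q :+ con true) :* p) refl (c ∷ []) X f q p)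
           (+-congʳ {(X * q + one₂) * p} (sym (∷≋ c f))))

  irr-gcd : ∀ {p d f g} → Irreducible p → Mon d p → IsGcd g f p → Coprime f p ⊎ p ∣ f
  irr-gcd {p} {d} {f} {g} (_ , irr) mp (gcd✓ g∣f (w , e) (u , v , b)) with ∣⇒Mon {g} (w , e) mp | ∣⇒Mon {w} (g , trans (*-comm g w) e) mp
  ... | k , mg , _ | j , mw , _ with irr w g (≋⇒≈₂ e)
  ... | inj₂ z = inj₁ (u , v , trans b (Mon0⇒1 (subst (λ i → Mon i g) (≡.trans (≡.sym (Mon-deg mg)) z) mg)))
  ... | inj₁ z = inj₂ (∣-respˡ (trans (sym (*-identityˡ g))
      (trans (*-congʳ {g} (sym (Mon0⇒1 (subst (λ i → Mon i w) (≡.trans (≡.sym (Mon-deg mw)) z) mw)))) e)) g∣f)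

  irr-coprime : ∀ {p d} → Irreducible p → Mon d p → ∀ f → Coprime f p ⊎ p ∣ f
  irr-coprime irr m f = irr-gcd irr m (proj₂ (gcd f _))

  irr-prime : ∀ {p d} → Irreducible p → Mon d p → ∀ f g → p ∣ (f * g) → p ∣ f ⊎ p ∣ g
  irr-prime {p} irr m f g (q , e) with irr-coprime irr m f
  ... | inj₂ y = inj₁ y
  ... | inj₁ (u , v , b) = inj₂ (u * q + v * g ,
     trans (solve 5 (λ u q v g p → (u :* q :+ v :* g) :* p := u :* (q :* p) :+ v :* p :* g) refl u q v g p)
     (trans (+-congʳ {v * p * g} (*-congˡ {u} e))
     (trans (solve 5 (λ u f v g p → u :* (f :* g) :+ v :* p :* g := (u :* f :+ v :* p) :* g) refl u f v g p)
     (trans (*-congʳ {g} b) (*-identityˡ g)))))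

-- Powers and derivatives over F₂, reversal, and the substitution y = x + 1/x.

module ReciprocalPolynomials where

  open BinaryPolynomials
  open import Data.Bool using (Bool; true; false; _xor_; _∧_)
  open import Data.Bool.Properties using (xor-identityʳ; ∧-zeroʳ; ∧-identityʳ; xor-same)
  open import Data.Nat as ℕ using (ℕ; zero; suc; s≤s)
  import Data.Nat.Properties as ℕP
  import Data.Nat.Divisibility as Div
  open import Data.List using (List; []; _∷_; length; map; reverse; _++_)
  open import Data.List.Properties using (unfold-reverse; length-reverse)
  open import Data.Product using (∃; _×_; _,_; proj₁)
  open import Data.Sum using (inj₁; inj₂)
  open import Data.Empty using (⊥-elim)
  open import Relation.Nullary using (¬_)
  open import Relation.Binary.PropositionalEquality as ≡ using (_≡_; cong; cong₂; subst)
  import Relation.Binary.Reasoning.Setoid setoid as ≋-R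

  ^-cong : ∀ {f g} n → f ≋ g → f ^₂ n ≋ g ^₂ n
  ^-cong zero    p = refl
  ^-cong (suc n) p = *-cong p (^-cong n p)

  ^-+ : ∀ f m n → f ^₂ (m ℕ.+ n) ≋ (f ^₂ m) * (f ^₂ n)
  ^-+ f zero    n = sym (*-identityˡ _)
  ^-+ f (suc m) n = trans (*-congˡ {f} (^-+ f m n)) (sym (*-assoc f _ _))

  ^-* : ∀ f g n → (f * g) ^₂ n ≋ (f ^₂ n) * (g ^₂ n)
  ^-* f g zero    = sym (*-identityˡ _)
  ^-* f g (suc n) = trans (*-congˡ {f * g} (^-* f g n))
    (solve 4 (λ f g a b → (f :* g) :* (a :* b) := (f :* a) :* (g :* b)) refl f g (f ^₂ n) (g ^₂ n))

  ^-ℕ* : ∀ f a b → f ^₂ (a ℕ.* b) ≋ (f ^₂ b) ^₂ a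
  ^-ℕ* f zero    b = refl
  ^-ℕ* f (suc a) b = trans (^-+ f b (a ℕ.* b)) (*-congˡ {f ^₂ b} (^-ℕ* f a b))

  X^≋ : ∀ n → X ^₂ n ≋ X^ n
  X^≋ zero    = refl
  X^≋ (suc n) = trans (*-congˡ {X} (X^≋ n)) (X*≋ (X^ n))

  one^ : ∀ n → one₂ ^₂ n ≋ one₂
  one^ zero    = refl
  one^ (suc n) = trans (*-identityˡ _) (one^ n)

  prod-^ : ∀ n fs → prod₂ (map (_^₂ n) fs) ≋ prod₂ fs ^₂ n
  prod-^ n []       = sym (one^ n)
  prod-^ n (f ∷ fs) = trans (*-congˡ {f ^₂ n} (prod-^ n fs)) (sym (^-* f (prod₂ fs) n))

  Mon-^ : ∀ {d f} n → Mon d f → Mon (n ℕ.* d) (f ^₂ n)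
  Mon-^ zero    m = Mon-one
  Mon-^ (suc n) m = Mon-* m (Mon-^ n m)

  coprime-^ : ∀ {f g} n → Coprime f g → Coprime f (g ^₂ n)
  coprime-^ zero    c = coprime-1
  coprime-^ (suc n) c = coprime-* c (coprime-^ n c)

  ^-2^ : ∀ f v → f ^₂ (2 ℕ.^ suc v) ≋ (f ^₂ (2 ℕ.^ v)) * (f ^₂ (2 ℕ.^ v))
  ^-2^ f v = trans (^-+ f (2 ℕ.^ v) (2 ℕ.^ v ℕ.+ 0))
    (*-congˡ {f ^₂ (2 ℕ.^ v)} (reflexive (cong (f ^₂_) (ℕP.+-identityʳ (2 ℕ.^ v)))))

  frobenius : ∀ f g v → (f + g) ^₂ (2 ℕ.^ v) ≋ (f ^₂ (2 ℕ.^ v)) + (g ^₂ (2 ℕ.^ v))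
  frobenius f g zero    = solve 2 (λ f g → (f :+ g) :* con true := f :* con true :+ g :* con true) refl f g
  frobenius f g (suc v) = trans (^-2^ (f + g) v) (trans (*-cong (frobenius f g v) (frobenius f g v))
    (trans (solve 2 (λ f g → (f :+ g) :* (f :+ g) := f :* f :+ g :* g) refl (f ^₂ (2 ℕ.^ v)) (g ^₂ (2 ℕ.^ v)))
      (+-cong (sym (^-2^ f v)) (sym (^-2^ g v)))))

  square-injective : ∀ {f g} → f * f ≋ g * g → f ≋ g
  square-injective {f} {g} p with *-nonzero {f + g} {f + g}
    (trans (solve 2 (λ f g → (f :+ g) :* (f :+ g) := f :* f :+ g :* g) refl f g) (≈⇒+≈0 p))
  ... | inj₁ z = +≈0⇒≈ z
  ... | inj₂ z = +≈0⇒≈ z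

  2^-injective : ∀ v {f g} → f ^₂ (2 ℕ.^ v) ≋ g ^₂ (2 ℕ.^ v) → f ≋ g
  2^-injective zero    {f} {g} p = trans (sym (*-identityʳ f)) (trans p (*-identityʳ g))
  2^-injective (suc v) {f} {g} p = 2^-injective v (square-injective (trans (sym (^-2^ f v)) (trans p (^-2^ g v))))

  xⁿ+1-2^ : ∀ v m → xⁿ+1 (2 ℕ.^ v ℕ.* m) ≋ xⁿ+1 m ^₂ (2 ℕ.^ v)
  xⁿ+1-2^ v m = trans (+-cong (sym (one^ (2 ℕ.^ v))) (^-ℕ* X (2 ℕ.^ v) m)) (sym (frobenius one₂ (X ^₂ m) v))

  -- The formal derivative, by (c + x f)' = f + x f'.
  δ : Poly₂ → Poly₂
  δ []      = []
  δ (c ∷ f) = f + (false ∷ δ f)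

  δ-+ : ∀ f g → δ (f + g) ≋ δ f + δ g
  δ-+ []      g       = refl
  δ-+ (c ∷ f) []      = sym (+-identityʳ _)
  δ-+ (c ∷ f) (d ∷ g) = trans (+-congˡ {f + g} (∷-cong ≡.refl (δ-+ f g)))
    (solve 4 (λ f g a b → (f :+ g) :+ (a :+ b) := (f :+ a) :+ (g :+ b)) refl f g (false ∷ δ f) (false ∷ δ g))

  δ-zero : ∀ {f} → f ≋ [] → δ f ≋ []
  δ-zero {[]}    p = refl
  δ-zero {c ∷ f} p = +-cong f≋0 (0∷≋ (δ-zero f≋0))
    where f≋0 = mk≋ λ k → at p (suc k)

  δ-cong : ∀ {f g} → f ≋ g → δ f ≋ δ g
  δ-cong {f} {g} p = +≈0⇒≈ (trans (sym (δ-+ f g)) (δ-zero (≈⇒+≈0 p)))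

  δ-scale : ∀ c f → δ (scale₂ c f) ≋ scale₂ c (δ f)
  δ-scale true  f = trans (δ-cong (scale-true f)) (sym (scale-true (δ f)))
  δ-scale false f = trans (δ-zero (scale-false f)) (sym (scale-false (δ f)))

  δ-* : ∀ f g → δ (f * g) ≋ δ f * g + f * δ g
  δ-* []      g = refl
  δ-* (c ∷ f) g = begin
    δ (scale₂ c g + (false ∷ f * g)) ≈⟨ δ-+ (scale₂ c g) _ ⟩
    δ (scale₂ c g) + (f * g + (false ∷ δ (f * g))) ≈⟨ +-cong (δ-scale c g) (+-congˡ {f * g} (trans (∷-cong ≡.refl (δ-* f g)) (sym (X*≋ _)))) ⟩
    scale₂ c (δ g) + (f * g + X * (δ f * g + f * δ g)) ≈⟨ solve 6 (λ s f g x a b → s :+ (f :* g :+ x :* (a :* g :+ f :* b)) := (f :+ x :* a) :* g :+ (s :+ x :* (f :* b))) refl (scale₂ c (δ g)) f g X (δ f) (δ g) ⟩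
    (f + X * δ f) * g + (scale₂ c (δ g) + X * (f * δ g)) ≈⟨ +-cong (*-congʳ {g} (+-congˡ {f} (X*≋ (δ f)))) (+-congˡ {scale₂ c (δ g)} (X*≋ _)) ⟩
    δ (c ∷ f) * g + (c ∷ f) * δ g ∎
    where open ≋-R

  -- Euler's relation x (x^m)' = m x^m with m = 1 in F₂. The induction goes in steps of two because
  -- (x² g)' = x² g'.
  Xδ-X^odd : ∀ m → ¬ (2 Div.∣ m) → X * δ (X ^₂ m) ≋ X ^₂ m
  Xδ-X^odd zero          odd = ⊥-elim (odd (2 Div.∣0))
  Xδ-X^odd (suc zero)    odd = ≈₂⇒≋ ≡.refl
  Xδ-X^odd (suc (suc m)) odd = begin
    X * δ (X * (X * X^m)) ≈⟨ *-congˡ {X} (trans (δ-* X (X * X^m)) (+-cong (*-congʳ {X * X^m} δX) (*-congˡ {X} (trans (δ-* X X^m) (+-congʳ (*-congʳ {X^m} δX)))))) ⟩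
    X * (one₂ * (X * X^m) + X * (one₂ * X^m + X * δ X^m)) ≈⟨ solve 3 (λ x p d → x :* (con true :* (x :* p) :+ x :* (con true :* p :+ x :* d)) := x :* (x :* (x :* d))) refl X X^m (δ X^m) ⟩
    X * (X * (X * δ X^m)) ≈⟨ *-congˡ {X} (*-congˡ {X} (Xδ-X^odd m λ d → odd (Div.∣m∣n⇒∣m+n Div.∣-refl d))) ⟩
    X * (X * X^m) ∎
    where
    open ≋-R
    X^m = X ^₂ m
    δX : δ X ≋ one₂
    δX = ≈₂⇒≋ ≡.refl

  -- For odd m the polynomial f = x^m + 1 satisfies f + x f' = 1, which is a Bézout identity for any
  -- factorisation f = a b.
  xᵐ+1-coprime : ∀ m → ¬ (2 Div.∣ m) → ∀ {a b} → a * b ≋ xⁿ+1 m → Coprime a b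
  xᵐ+1-coprime m odd {a} {b} e = b + X * δ b , X * δ a , (begin
    (b + X * δ b) * a + X * δ a * b ≈⟨ solve 5 (λ a b x p q → (b :+ x :* q) :* a :+ x :* p :* b := a :* b :+ x :* (p :* b :+ a :* q)) refl a b X (δ a) (δ b) ⟩
    a * b + X * (δ a * b + a * δ b) ≈⟨ +-cong e (*-congˡ {X} (trans (sym (δ-* a b)) (trans (δ-cong e) (δ-+ one₂ (X ^₂ m))))) ⟩
    xⁿ+1 m + X * (δ one₂ + δ (X ^₂ m)) ≈⟨ +-congˡ {xⁿ+1 m} (trans (*-congˡ {X} (+-congʳ {δ (X ^₂ m)} (0∷≋ refl))) (Xδ-X^odd m odd)) ⟩
    (one₂ + X ^₂ m) + X ^₂ m ≈⟨ solve 1 (λ p → (con true :+ p) :+ p := con true) refl (X ^₂ m) ⟩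
    one₂ ∎)
    where open ≋-R

  c*≋scale : ∀ c f → (c ∷ []) * f ≋ scale₂ c f
  c*≋scale c f = trans (+-congˡ {scale₂ c f} (0∷≋ refl)) (+-identityʳ (scale₂ c f))

  -- Hom p n f = Σ fᵢ pⁱ x^(n-i) if deg f ≤ n; coefficients of index above n are ignored.

  Hom : Poly₂ → ℕ → Poly₂ → Poly₂
  Hom p n       []      = []
  Hom p zero    (c ∷ f) = c ∷ []
  Hom p (suc n) (c ∷ f) = (c ∷ []) * X^ (suc n) + p * Hom p n f

  module _ (p : Poly₂) where
    private H = Hom p

    c-xor : ∀ c d → (c ∷ []) + (d ∷ []) ≋ (c xor d) ∷ []
    c-xor c d = refl

    H-+ : ∀ n f g → H n (f + g) ≋ H n f + H n g
    H-+ n       []      g       = refl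
    H-+ n       (c ∷ f) []      = sym (+-identityʳ _)
    H-+ zero    (c ∷ f) (d ∷ g) = refl
    H-+ (suc n) (c ∷ f) (d ∷ g) = trans (+-cong (*-congʳ {X^ (suc n)} (sym (c-xor c d))) (*-congˡ {p} (H-+ n f g)))
      (solve 6 (λ c d x p a b → (c :+ d) :* x :+ p :* (a :+ b) := (c :* x :+ p :* a) :+ (d :* x :+ p :* b)) refl
         (c ∷ []) (d ∷ []) (X^ (suc n)) p (H n f) (H n g))

    H-zero : ∀ n {f} → f ≋ [] → H n f ≋ []
    H-zero n       {[]}    e = refl
    H-zero zero    {c ∷ f} e = mk≋ λ { zero → at e 0 ; (suc k) → ≡.refl }
    H-zero (suc n) {c ∷ f} e = +-cong (*-congʳ {X^ (suc n)} {c ∷ []} {[]} (mk≋ λ { zero → at e 0 ; (suc k) → ≡.refl }))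
      (trans (*-congˡ {p} (H-zero n {f} (mk≋ λ k → at e (suc k)))) (zeroʳ p))

    H-cong : ∀ n {f g} → f ≋ g → H n f ≋ H n g
    H-cong n {f} {g} e = +≈0⇒≈ (trans (sym (H-+ n f g)) (H-zero n (≈⇒+≈0 e)))

    H-scale : ∀ n c f → H n (scale₂ c f) ≋ (c ∷ []) * H n f
    H-scale n true  f = trans (H-cong n (scale-true f)) (sym (*-identityˡ _))
    H-scale n false f = trans (H-zero n (scale-false f)) (sym (trans (*-congʳ {H n f} {false ∷ []} {[]} (0∷≋ refl)) refl))

    H-const : ∀ n c {f} → f ≋ [] → H n (c ∷ f) ≋ (c ∷ []) * X^ n
    H-const zero    c z = sym (*-identityʳ _)
    H-const (suc n) c {f} z = trans (+-congˡ {(c ∷ []) * X^ (suc n)} (trans (*-congˡ {p} (H-zero n z)) (zeroʳ p))) (+-identityʳ _)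

    H-shift : ∀ n m {f} → Lt (suc n) f → H (n ℕ.+ m) f ≋ X^ m * H n f
    H-shift n       m {[]}    l = sym (zeroʳ (X^ m))
    H-shift zero    m {c ∷ f} l = trans (H-const m c (Lt0⇒≋ (Lt-tail l))) (*-comm (c ∷ []) (X^ m))
    H-shift (suc n) m {c ∷ f} l = trans (+-cong (*-congˡ {c ∷ []} (X^-+ (suc n) m)) (*-congˡ {p} (H-shift n m (Lt-tail l))))
      (solve 5 (λ c a x p h → c :* (a :* x) :+ p :* (x :* h) := x :* (c :* a :+ p :* h)) refl (c ∷ []) (X^ (suc n)) (X^ m) p (H n f))
      where
      X^-+ : ∀ a b → X^ (a ℕ.+ b) ≋ X^ a * X^ b
      X^-+ zero    b = sym (*-identityˡ _)
      X^-+ (suc a) b = trans (X^suc (a ℕ.+ b)) (trans (*-congˡ {X} (X^-+ a b)) (trans (sym (*-assoc X (X^ a) (X^ b))) (*-congʳ {X^ b} (sym (X^suc a)))))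

    -- Homogenisation is multiplicative as long as nothing is truncated, hence the two degree
    -- bounds. Proved for general `p`, it serves both reversal and the substitution for y.
    H-* : ∀ m n {f g} → Lt (suc m) f → Lt (suc n) g → H (m ℕ.+ n) (f * g) ≋ H m f * H n g
    H-* m       n {[]}         lf lg = refl
    H-* zero    n {c ∷ f} {g} lf lg = trans (H-cong n (trans (+-congˡ {scale₂ c g} (0∷≋ (*-congʳ {g} (Lt0⇒≋ (Lt-tail lf))))) (+-identityʳ _))) (H-scale n c g)
    H-* (suc m) n {c ∷ f} {g} lf lg = begin
      H (suc m ℕ.+ n) (scale₂ c g + (false ∷ f * g)) ≈⟨ H-+ (suc m ℕ.+ n) (scale₂ c g) _ ⟩
      H (suc m ℕ.+ n) (scale₂ c g) + H (suc (m ℕ.+ n)) (false ∷ f * g) ≈⟨ +-cong (trans (H-scale (suc m ℕ.+ n) c g) (*-congˡ {c ∷ []} shift))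
                                                                                    (+-cong (*-congʳ {X^ (suc (m ℕ.+ n))} {false ∷ []} {[]} (0∷≋ refl)) (*-congˡ {p} (H-* m n (Lt-tail lf) lg))) ⟩
      (c ∷ []) * (X^ (suc m) * H n g) + ([] + p * (H m f * H n g)) ≈⟨ solve 5 (λ c x b p a → c :* (x :* b) :+ (con false :+ p :* (a :* b)) := (c :* x :+ p :* a) :* b) refl (c ∷ []) (X^ (suc m)) (H n g) p (H m f) ⟩
      H (suc m) (c ∷ f) * H n g ∎
      where
      open ≋-R
      shift : H (suc m ℕ.+ n) g ≋ X^ (suc m) * H n g
      shift = trans (reflexive (cong (λ k → H k g) (ℕP.+-comm (suc m) n))) (H-shift n (suc m) lg)

  -- rev n f = xⁿ f(1/x) and Φ n f = xⁿ f(x + 1/x)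

  rev : ℕ → Poly₂ → Poly₂
  rev = Hom one₂

  x²+1 : Poly₂
  x²+1 = true ∷ false ∷ true ∷ []

  Φ : ℕ → Poly₂ → Poly₂
  Φ = Hom x²+1

  Mon-x²+1 : Mon 2 x²+1
  Mon-x²+1 = mkMon ≡.refl (mkLt λ { (suc (suc (suc k))) _ → ≡.refl ; (suc (suc zero)) (s≤s (s≤s ())) ; (suc zero) (s≤s ()) })

  Lt-c : ∀ c → Lt 1 (c ∷ [])
  Lt-c c = mkLt λ { (suc k) _ → ≡.refl }

  Lt-c*X^ : ∀ c n → Lt (suc n) ((c ∷ []) * X^ n)
  Lt-c*X^ c n = Lt-* (Lt-c c) (bnd (Mon-X^ n))

  rev-Lt : ∀ n f → Lt (suc n) (rev n f)
  rev-Lt n       []      = Lt-[]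
  rev-Lt zero    (c ∷ f) = Lt-c c
  rev-Lt (suc n) (c ∷ f) = Lt-+ (Lt-c*X^ c (suc n)) (Lt-resp (sym (*-identityˡ _)) (Lt-mono (ℕP.n≤1+n _) (rev-Lt n f)))

  rev-X^ : ∀ n → rev n (X^ n) ≋ one₂
  rev-X^ zero    = refl
  rev-X^ (suc n) = trans (+-cong (*-congʳ {X^ (suc n)} {false ∷ []} {[]} (0∷≋ refl)) (*-identityˡ _)) (rev-X^ n)

  rev-c* : ∀ n c f → rev n ((c ∷ []) * f) ≋ (c ∷ []) * rev n f
  rev-c* n c f = trans (H-cong one₂ n (c*≋scale c f)) (H-scale one₂ n c f)

  rev-rev : ∀ n {f} → Lt (suc n) f → rev n (rev n f) ≋ f
  rev-rev n       {[]}    l = refl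
  rev-rev zero    {c ∷ f} l = ∷-cong ≡.refl (sym (Lt0⇒≋ (Lt-tail l)))
  rev-rev (suc n) {c ∷ f} l = begin
    rev (suc n) ((c ∷ []) * X^ (suc n) + one₂ * rev n f) ≈⟨ H-+ one₂ (suc n) ((c ∷ []) * X^ (suc n)) (one₂ * rev n f) ⟩
    rev (suc n) ((c ∷ []) * X^ (suc n)) + rev (suc n) (one₂ * rev n f) ≈⟨ +-cong (trans (rev-c* (suc n) c (X^ (suc n))) (*-congˡ {c ∷ []} (rev-X^ (suc n))))
                                                                             (trans (H-cong one₂ (suc n) (*-identityˡ (rev n f))) shift) ⟩
    (c ∷ []) * one₂ + X * rev n (rev n f) ≈⟨ +-cong (*-identityʳ (c ∷ [])) (*-congˡ {X} (rev-rev n (Lt-tail l))) ⟩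
    (c ∷ []) + X * f ≈⟨ sym (∷≋ c f) ⟩
    c ∷ f ∎
    where
    open ≋-R
    shift : rev (suc n) (rev n f) ≋ X * rev n (rev n f)
    shift = trans (reflexive (cong (λ k → rev k (rev n f)) (ℕP.+-comm 1 n))) (H-shift one₂ n 1 (rev-Lt n f))

  co-rev : ∀ n f i j → i ℕ.+ j ≡ n → co (rev n f) i ≡ co f j
  co-rev n       []      i       j       e = ≡.refl
  co-rev zero    (c ∷ f) zero    zero    e = ≡.refl
  co-rev (suc n) (c ∷ f) i       j       e = ≡.trans (co-+ ((c ∷ []) * X^ (suc n)) (one₂ * rev n f) i)
    (≡.trans (cong₂ _xor_ (≡.trans (at (c*≋scale c (X^ (suc n))) i) (co-scale c (X^ (suc n)) i)) (at (*-identityˡ (rev n f)) i)) (go j e))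
    where
    co-X^ : ∀ n i → i ℕ.< n → co (X^ n) i ≡ false
    co-X^ (suc n) zero    lt       = ≡.refl
    co-X^ (suc n) (suc i) (s≤s lt) = co-X^ n i lt
    go : ∀ j → i ℕ.+ j ≡ suc n → (c ∧ co (X^ (suc n)) i) xor co (rev n f) i ≡ co (c ∷ f) j
    go zero e with ≡.trans (≡.sym (ℕP.+-identityʳ i)) e
    ... | ≡.refl rewrite top (Mon-X^ n) | above (rev-Lt n f) (suc n) ℕP.≤-refl = ≡.trans (xor-identityʳ _) (∧-identityʳ c)
    go (suc j) e with ℕP.suc-injective (≡.trans (≡.sym (ℕP.+-suc i j)) e)
    ... | e' rewrite co-X^ (suc n) i (s≤s (subst (i ℕ.≤_) e' (ℕP.m≤m+n i j))) | ∧-zeroʳ c = co-rev n f i j e'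

  reverse-rev : ∀ c f → reverse (c ∷ f) ≋ rev (length f) (c ∷ f)
  reverse-rev c [] = refl
  reverse-rev c (d ∷ f) = trans (reflexive (unfold-reverse c (d ∷ f))) (trans (snoc (reverse (d ∷ f)) c)
    (trans (+-comm (reverse (d ∷ f)) _) (+-cong (*-congˡ {c ∷ []} (reflexive (cong X^ (length-reverse (d ∷ f)))))
      (trans (reverse-rev d f) (sym (*-identityˡ _))))))
    where
    snoc : ∀ g c → g ++ c ∷ [] ≋ g + (c ∷ []) * X^ (length g)
    snoc []      c = sym (*-identityʳ (c ∷ []))
    snoc (d ∷ g) c = trans (∷≋ d (g ++ c ∷ [])) (trans (+-congˡ {d ∷ []} (*-congˡ {X} (snoc g c)))
      (trans (solve 5 (λ d x g c y → d :+ x :* (g :+ c :* y) := (d :+ x :* g) :+ c :* (x :* y)) refl (d ∷ []) X g (c ∷ []) (X^ (length g)))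
        (+-cong (sym (∷≋ d g)) (*-congˡ {c ∷ []} (sym (X^suc (length g)))))))

  recip-rev : ∀ {d f} → Mon d f → recip f ≋ rev d f
  recip-rev {d} {f} m with norm f in eq | Mon-deg m
  ... | []    | _      = ⊥-elim (Mon⇒Monic m eq)
  ... | c ∷ g | ≡.refl = trans (reverse-rev c g) (H-cong one₂ (length g) (trans (reflexive (≡.sym eq)) (norm-≋ f)))

  Mon-rev : ∀ {d f} → co f 0 ≡ true → Mon d (rev d f)
  Mon-rev {d} {f} e = mkMon (≡.trans (co-rev d f d 0 (ℕP.+-identityʳ d)) e) (rev-Lt d f)

  Mon-Φ : ∀ {n f} → Mon n f → Mon (n ℕ.+ n) (Φ n f)
  Mon-Φ {n}     {[]}    (mkMon () _)
  Mon-Φ {zero}  {c ∷ f} m rewrite top m = Mon-one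
  Mon-Φ {suc n} {c ∷ f} m = Lt+-Mon (Lt-mono (s≤s (ℕP.m≤n+m (suc n) n)) (Lt-c*X^ c (suc n)))
    (subst (λ k → Mon k (x²+1 * Φ n f)) (cong suc (≡.sym (ℕP.+-suc n n))) (Mon-* Mon-x²+1 (Mon-Φ (Mon-tail m))))

  Lt-Φ : ∀ n f → Lt (suc (n ℕ.+ n)) (Φ n f)
  Lt-Φ n       []      = Lt-[]
  Lt-Φ zero    (c ∷ f) = Lt-c c
  Lt-Φ (suc n) (c ∷ f) = Lt-+ (Lt-mono (s≤s (s≤s (ℕP.m≤n+m (suc n) n)) ) (Lt-mono (ℕP.n≤1+n _) (Lt-c*X^ c (suc n))))
    (subst (λ k → Lt k (x²+1 * Φ n f)) (cong (λ k → suc (suc k)) (≡.sym (ℕP.+-suc n n))) (Lt-* (bnd Mon-x²+1) (Lt-Φ n f)))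

  -- The polynomial version of the invariance of x + 1/x under x ↦ 1/x.
  rev-Φ : ∀ n f → rev (n ℕ.+ n) (Φ n f) ≋ Φ n f
  rev-Φ n       []      = refl
  rev-Φ zero    (c ∷ f) = refl
  rev-Φ (suc n) (c ∷ f) = begin
    rev N (C * X^ (suc n) + x²+1 * Φ n f) ≈⟨ H-+ one₂ N (C * X^ (suc n)) (x²+1 * Φ n f) ⟩
    rev N (C * X^ (suc n)) + rev N (x²+1 * Φ n f) ≈⟨ +-cong first second ⟩
    C * X^ (suc n) + x²+1 * Φ n f ∎
    where
    open ≋-R
    N = suc n ℕ.+ suc n
    C = c ∷ []
    first : rev N (C * X^ (suc n)) ≋ C * X^ (suc n)
    first = trans (rev-c* N c (X^ (suc n))) (*-congˡ {C} (trans (H-shift one₂ (suc n) (suc n) (bnd (Mon-X^ (suc n))))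
      (trans (*-congˡ {X^ (suc n)} (rev-X^ (suc n))) (*-identityʳ _))))
    rev-x²+1 : rev 2 x²+1 ≋ x²+1
    rev-x²+1 = ≈₂⇒≋ ≡.refl
    second : rev N (x²+1 * Φ n f) ≋ x²+1 * Φ n f
    second rewrite ℕP.+-suc n n = trans (H-* one₂ 2 (n ℕ.+ n) (bnd Mon-x²+1) (Lt-Φ n f)) (*-cong rev-x²+1 (rev-Φ n f))

  -- Dickson polynomials in characteristic 2: y Eᵢ(y) = xⁱ + x⁻ⁱ for y = x + 1/x.

  E : ℕ → Poly₂
  E zero          = []
  E (suc zero)    = one₂
  E (suc (suc k)) = X * E (suc k) + E k

  Mon-E : ∀ k → Mon k (E (suc k)) × Lt k (E k)
  Mon-E zero    = Mon-one , Lt-[]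
  Mon-E (suc k) with Mon-E k
  ... | m , l = Mon-+Lt (Mon-* (Mon-X^ 1) m) (Lt-mono (ℕP.n≤1+n k) l) , bnd m

  D : ℕ → Poly₂
  D k = X * E k

  Mon-D : ∀ k → Mon (suc k) (D (suc k))
  Mon-D k = Mon-* (Mon-X^ 1) (proj₁ (Mon-E k))

  Lt-D : ∀ k → Lt (suc k) (D k)
  Lt-D zero    = Lt-resp (sym (zeroʳ X)) Lt-[]
  Lt-D (suc k) = bnd (Mon-D k)

  D-rec : ∀ k → D (suc (suc k)) ≋ X * D (suc k) + D k
  D-rec k = solve 3 (λ x a b → x :* (x :* a :+ b) := x :* (x :* a) :+ x :* b) refl X (E (suc k)) (E k)

  Φ-X : Φ 1 X ≋ x²+1
  Φ-X = ≈₂⇒≋ ≡.refl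

  Φ-shift : ∀ n {f} → Lt (suc n) f → Φ (suc n) f ≋ X * Φ n f
  Φ-shift n {f} l = trans (reflexive (cong (λ k → Φ k f) (ℕP.+-comm 1 n))) (H-shift x²+1 n 1 l)

  Φ-D : ∀ k → Φ k (D k) ≋ one₂ + X^ (k ℕ.+ k)
  Φ-D zero    = ≈₂⇒≋ ≡.refl
  Φ-D (suc zero) = trans (H-cong x²+1 1 (*-identityʳ X)) Φ-X
  Φ-D (suc (suc k)) = begin
    Φ (2 ℕ.+ k) (D (2 ℕ.+ k)) ≈⟨ trans (H-cong x²+1 (2 ℕ.+ k) (D-rec k)) (H-+ x²+1 (2 ℕ.+ k) (X * D (suc k)) (D k)) ⟩
    Φ (2 ℕ.+ k) (X * D (suc k)) + Φ (2 ℕ.+ k) (D k) ≈⟨ +-cong (H-* x²+1 1 (suc k) (bnd (Mon-X^ 1)) (Lt-D (suc k)))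
                                                               (trans (Φ-shift (suc k) (Lt-mono (ℕP.n≤1+n _) (Lt-D k))) (*-congˡ {X} (Φ-shift k (Lt-D k)))) ⟩
    Φ 1 X * Φ (suc k) (D (suc k)) + X * (X * Φ k (D k)) ≈⟨ +-cong (*-cong (trans Φ-X x²+1≋) (Φ-D (suc k))) (*-congˡ {X} (*-congˡ {X} (Φ-D k))) ⟩
    (one₂ + X * X) * (one₂ + X^ (suc k ℕ.+ suc k)) + X * (X * (one₂ + X^ (k ℕ.+ k))) ≈⟨ +-congʳ {X * (X * (one₂ + X^ (k ℕ.+ k)))} (*-congˡ {one₂ + X * X} (+-congˡ {one₂} (double k))) ⟩
    (one₂ + X * X) * (one₂ + X * (X * X^ (k ℕ.+ k))) + X * (X * (one₂ + X^ (k ℕ.+ k))) ≈⟨ solve 2 (λ x p → (con true :+ x :* x) :* (con true :+ x :* (x :* p)) :+ x :* (x :* (con true :+ p)) := con true :+ x :* (x :* (x :* (x :* p)))) refl X (X^ (k ℕ.+ k)) ⟩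
    one₂ + X * (X * (X * (X * X^ (k ℕ.+ k)))) ≈⟨ +-congˡ {one₂} (sym (trans (double (suc k)) (*-congˡ {X} (*-congˡ {X} (double k))))) ⟩
    one₂ + X^ (2 ℕ.+ k ℕ.+ (2 ℕ.+ k)) ∎
    where
    open ≋-R
    x²+1≋ : x²+1 ≋ one₂ + X * X
    x²+1≋ = ≈₂⇒≋ ≡.refl
    double : ∀ k → X^ (suc k ℕ.+ suc k) ≋ X * (X * X^ (k ℕ.+ k))
    double k rewrite ℕP.+-suc k k = trans (X^suc (suc (k ℕ.+ k))) (*-congˡ {X} (X^suc (k ℕ.+ k)))

  -- By symmetry the last coefficient of c + x r is again c. Removing it from r leaves `r'`, a
  -- palindrome of formal degree 2k, with c + x r = c (1 + x^(2k+2)) + x r'.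
  module PeelPalindrome (k : ℕ) (c : Bool) (r : Poly₂) (l : Lt (suc (suc k ℕ.+ suc k)) (c ∷ r))
      (sy : ∀ i j → i ℕ.+ j ≡ suc k ℕ.+ suc k → co (c ∷ r) i ≡ co (c ∷ r) j) where
    C = c ∷ []
    2k = k ℕ.+ k
    Y = (c ∷ []) * X^ (suc 2k)
    r' = r + Y
    2k+2 : suc k ℕ.+ suc k ≡ suc (suc 2k)
    2k+2 = cong suc (ℕP.+-suc k k)
    top-c : co r (suc 2k) ≡ c
    top-c = ≡.sym (sy 0 (suc (suc 2k)) (≡.sym 2k+2))
    co-Y : ∀ i → co Y i ≡ c ∧ co (X^ (suc 2k)) i
    co-Y i = ≡.trans (at (c*≋scale c (X^ (suc 2k))) i) (co-scale c (X^ (suc 2k)) i)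
    l' : Lt (suc 2k) r'
    l' = Lt-pred (Lt-+ (Lt-tail (subst (λ n → Lt (suc n) (c ∷ r)) 2k+2 l)) (Lt-c*X^ c (suc 2k)))
      (≡.trans (co-+ r Y (suc 2k)) (≡.trans (cong₂ _xor_ top-c (≡.trans (co-Y (suc 2k)) (≡.trans (cong (c ∧_) (top (Mon-X^ 2k))) (∧-identityʳ c)))) (xor-same c)))
    co-X^ : ∀ n i → i ℕ.< n → co (X^ n) i ≡ false
    co-X^ (suc n) zero    lt       = ≡.refl
    co-X^ (suc n) (suc i) (s≤s lt) = co-X^ n i lt
    co-r' : ∀ i → i ℕ.≤ 2k → co r' i ≡ co r i
    co-r' i le = ≡.trans (co-+ r Y i) (≡.trans (cong (co r i xor_) (≡.trans (co-Y i) (≡.trans (cong (c ∧_) (co-X^ (suc 2k) i (s≤s le))) (∧-zeroʳ c)))) (xor-identityʳ _))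
    sy' : ∀ i j → i ℕ.+ j ≡ 2k → co r' i ≡ co r' j
    sy' i j e = ≡.trans (co-r' i (subst (i ℕ.≤_) e (ℕP.m≤m+n i j))) (≡.trans
      (sy (suc i) (suc j) (≡.trans (cong suc (≡.trans (ℕP.+-suc i j) (cong suc e))) (≡.sym 2k+2)))
      (≡.sym (co-r' j (subst (j ℕ.≤_) e (ℕP.m≤n+m j i)))))

  -- Peeling off the outer coefficients of a palindrome: c (1 + x^(2k)) = Φ k (c D k).
  palindrome : ∀ k r → Lt (suc (k ℕ.+ k)) r → (∀ i j → i ℕ.+ j ≡ k ℕ.+ k → co r i ≡ co r j) →
               ∃ λ s → Lt (suc k) s × Φ k s ≋ r
  palindrome k       []      l sy = [] , Lt-[] , refl
  palindrome zero    (c ∷ r) l sy = c ∷ [] , Lt-c c , ∷-cong ≡.refl (sym (Lt0⇒≋ (Lt-tail l)))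
  palindrome (suc k) (c ∷ r) l sy with palindrome k (PeelPalindrome.r' k c r l sy) (PeelPalindrome.l' k c r l sy) (PeelPalindrome.sy' k c r l sy)
  ... | s , ls , eq = s + (c ∷ []) * D (suc k) , Lt-+ (Lt-mono (ℕP.n≤1+n _) ls) (Lt-* (Lt-c c) (Lt-D (suc k))) , (begin
    Φ (suc k) (s + C * D (suc k)) ≈⟨ H-+ x²+1 (suc k) s _ ⟩
    Φ (suc k) s + Φ (suc k) (C * D (suc k)) ≈⟨ +-cong (trans (Φ-shift k ls) (*-congˡ {X} eq)) (trans (H-* x²+1 0 (suc k) (Lt-c c) (Lt-D (suc k)))
                                                            (*-congˡ {C} (trans (Φ-D (suc k)) (+-congˡ {one₂} (trans (reflexive (cong X^ 2k+2)) (X^suc (suc 2k))))))) ⟩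
    X * (r + C * X^ (suc 2k)) + C * (one₂ + X * X^ (suc 2k)) ≈⟨ solve 4 (λ x r c p → x :* (r :+ c :* p) :+ c :* (con true :+ x :* p) := c :+ x :* r) refl X r C (X^ (suc 2k)) ⟩
    C + X * r ≈⟨ sym (∷≋ c r) ⟩
    c ∷ r ∎)
    where
    open PeelPalindrome k c r l sy
    open ≋-R

-- The factorisation of x^n + 1 expressed in the variable y.

module Factors where

  open BinaryPolynomials
  open ReciprocalPolynomials
  open import Data.Nat as ℕ using (ℕ; zero; suc; z≤n; s≤s)
  import Data.Nat.Properties as ℕP
  import Data.Nat.Divisibility as Div
  open import Data.List using (List; []; _∷_; map)
  open import Data.List.Relation.Unary.All using (All; []; _∷_)
  open import Data.Product using (∃; ∃₂; _×_; _,_; proj₁; proj₂)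
  open import Data.Sum using (_⊎_; inj₁; inj₂)
  open import Data.Empty using (⊥-elim)
  open import Relation.Nullary using (¬_)
  open import Relation.Binary.PropositionalEquality as ≡ using (_≡_; cong; subst; subst₂)

  n+n≡0 : ∀ {n} → n ℕ.+ n ≡ 0 → n ≡ 0
  n+n≡0 {zero} e = ≡.refl

  n+n-injective : ∀ {m n} → m ℕ.+ m ≡ n ℕ.+ n → m ≡ n
  n+n-injective {zero}  {zero}  e = ≡.refl
  n+n-injective {suc m} {suc n} e =
    cong suc (n+n-injective (ℕP.suc-injective (≡.trans (≡.sym (ℕP.+-suc m m)) (≡.trans (ℕP.suc-injective e) (ℕP.+-suc n n)))))

  -- r(x) = xᵏ s(x + 1/x)
  record Rel (k : ℕ) (s r : Poly₂) : Set where
    constructor mkRel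
    field
      mon : Mon k s
      rel : Φ k s ≋ r
  open Rel public

  Rel-one : Rel 0 one₂ one₂
  Rel-one = mkRel Mon-one refl

  Rel-* : ∀ {k s r l t q} → Rel k s r → Rel l t q → Rel (k ℕ.+ l) (s * t) (r * q)
  Rel-* {k} {l = l} (mkRel m e) (mkRel m' e') = mkRel (Mon-* m m') (trans (H-* x²+1 k l (bnd m) (bnd m')) (*-cong e e'))

  Rel-^ : ∀ {k s r} n → Rel k s r → Rel (n ℕ.* k) (s ^₂ n) (r ^₂ n)
  Rel-^ zero    R = Rel-one
  Rel-^ (suc n) R = Rel-* R (Rel-^ n R)

  Rel-resp : ∀ {k s t r q} → s ≋ t → r ≋ q → Rel k s r → Rel k t q
  Rel-resp {k} p p' (mkRel m e) = mkRel (Mon-resp p m) (trans (H-cong x²+1 k (sym p)) (trans e p'))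

  Rel-Mon : ∀ {k s r} → Rel k s r → Mon (k ℕ.+ k) r
  Rel-Mon (mkRel m e) = Mon-resp e (Mon-Φ m)

  factor-Mon : ∀ {a b s k} → a * b ≋ s → Mon k s → ∃₂ λ i j → Mon i a × Mon j b × i ℕ.+ j ≡ k
  factor-Mon {a} {b} e m with ∣⇒Mon {a} (b , trans (*-comm b a) e) m | ∣⇒Mon {b} (a , e) m
  ... | i , ma , _ | j , mb , _ = i , j , ma , mb , Mon-unique (Mon-resp e (Mon-* ma mb)) m

  Rel-∣ : ∀ {k s r g} → Rel k s r → g ∣ s → ∃ λ i → Mon i g × Φ i g ∣ r
  Rel-∣ {g = g} (mkRel m e) (w , eq) with factor-Mon {w} {g} eq m
  ... | j , i , mw , mg , ≡.refl = i , mg , Φ j w , trans (sym (H-* x²+1 j i (bnd mw) (bnd mg))) (trans (H-cong x²+1 (j ℕ.+ i) eq) e)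

  -- A common divisor g of s and t yields the common divisor `Φ i g` of r and q, whose degree is
  -- twice that of g; coprimality of r and q makes this degree 0.
  Rel-coprime : ∀ {k s r l t q} → Rel k s r → Rel l t q → Coprime r q → Coprime s t
  Rel-coprime {s = s} {r} {t = t} {q} R R' c = go (gcd s t)
    where
    one : ∀ {i i' g} → Mon i g → Φ i g ∣ r → Mon i' g → Φ i' g ∣ q → g ≋ one₂
    one {i} {i'} {g} mg d mg' d' = Mon0⇒1 (subst (λ k → Mon k g) (n+n≡0 (Mon-unique {f = one₂} (Mon-resp Φ≋1 (Mon-Φ mg)) Mon-one)) mg)
      where
      Φ≋1 : Φ i g ≋ one₂
      Φ≋1 = ∣1⇒≋1 (coprime-∣ c d (subst (λ k → Φ k g ∣ q) (Mon-unique mg' mg) d'))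
    go : (∃ λ g → IsGcd g s t) → Coprime s t
    go (g , G) = proj₁ (bézout G) , proj₁ (proj₂ (bézout G)) , trans (proj₂ (proj₂ (bézout G))) (one mg d mg' d')
      where
      mg  = proj₁ (proj₂ (Rel-∣ R (g∣a G)))
      d   = proj₂ (proj₂ (Rel-∣ R (g∣a G)))
      mg' = proj₁ (proj₂ (Rel-∣ R' (g∣b G)))
      d'  = proj₂ (proj₂ (Rel-∣ R' (g∣b G)))

  selfReciprocal⇒Rel : ∀ k {r} → Mon (k ℕ.+ k) r → rev (k ℕ.+ k) r ≋ r → ∃ λ s → Rel k s r
  selfReciprocal⇒Rel k {r} m sr with palindrome k r (bnd m) (λ i j e → ≡.trans (≡.sym (at sr i)) (co-rev (k ℕ.+ k) r i j e))
  ... | s , ls , eq with zero-or-Mon s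
  ... | inj₁ z = ⊥-elim (Mon≉0 m (trans (sym eq) (H-zero x²+1 k z)))
  ... | inj₂ (e , ms) = s , mkRel (subst (λ i → Mon i s) e≡k ms) eq
    where
    e≤k : e ℕ.≤ k
    e≤k = ℕP.≤-pred (Lt-Mon ls ms)
    split : e ℕ.+ (k ℕ.∸ e) ≡ k
    split = ℕP.m+[n∸m]≡n e≤k
    -- `palindrome` gives only e ≤ k. Since Φ k s = x^(k-e) Φ e s has degree k + e, comparison with
    -- deg r = 2k forces e = k.
    deg-eq : (k ℕ.∸ e) ℕ.+ (e ℕ.+ e) ≡ k ℕ.+ k
    deg-eq = Mon-unique (Mon-resp (trans (sym (H-shift x²+1 e (k ℕ.∸ e) (bnd ms))) (trans (reflexive (cong (λ i → Φ i s) split)) eq))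
                           (Mon-* (Mon-X^ (k ℕ.∸ e)) (Mon-Φ ms))) m
    e≡k : e ≡ k
    e≡k = ℕP.+-cancelˡ-≡ k e k (≡.trans (≡.trans (cong (ℕ._+ e) (≡.trans (≡.sym split) (ℕP.+-comm e _))) (ℕP.+-assoc (k ℕ.∸ e) e e)) deg-eq)

  private
    const-co : ∀ f → const₂ f ≡ co f 0
    const-co []      = ≡.refl
    const-co (c ∷ f) = ≡.refl

    -- If g divides A then A B = g g* gives g* = w B with g w = A; reversing, g = w* B.
    half : ∀ {g k A B j} → Irreducible g → Mon k g → ¬ (recip g ≈₂ g) → Mon (j ℕ.+ j) B → rev (j ℕ.+ j) B ≋ B →
           A * B ≋ g * rev k g → Mon k (rev k g) → g ∣ A → j ≡ 0
    half {g} {k} {A} {B} {j} (_ , irr) mg ¬sr mB sB eq mg* (w , wg) = go₁ (factor-Mon {w} {B} wB mg*)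
      where
      wB : w * B ≋ rev k g
      wB = *-cancel mg (trans (solve 3 (λ g w b → g :* (w :* b) := (w :* g) :* b) refl g w B) (trans (*-congʳ {B} wg) eq))
      reversed : ∀ {e} → Mon e w → e ℕ.+ (j ℕ.+ j) ≡ k → rev e w * B ≋ g
      reversed {e} mw e+j≡k = trans (*-congˡ {rev e w} (sym sB)) (trans (sym (H-* one₂ e (j ℕ.+ j) (bnd mw) (bnd mB)))
        (trans (reflexive (cong (λ i → rev i (w * B)) e+j≡k)) (trans (H-cong one₂ k wB) (rev-rev k (bnd mg)))))
      go₂ : ∀ u → u * B ≋ g → deg u ≡ 0 ⊎ deg B ≡ 0 → j ≡ 0
      go₂ u uB (inj₂ z) = n+n≡0 (≡.trans (≡.sym (Mon-deg mB)) z)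
      go₂ u uB (inj₁ z) with factor-Mon {u} {B} uB mg
      ... | i , _ , mu , mB' , i+j≡k with ≡.trans (≡.sym (Mon-deg mu)) z | Mon-unique mB mB'
      ... | ≡.refl | ≡.refl = ⊥-elim (¬sr (≋⇒≈₂ (trans (recip-rev mg) (trans (H-cong one₂ k (sym B≋g))
          (trans (reflexive (cong (λ i → rev i B) (≡.sym i+j≡k))) (trans sB B≋g))))))
        where
        B≋g : B ≋ g
        B≋g = trans (sym (*-identityˡ B)) (trans (*-congʳ {B} (sym (Mon0⇒1 mu))) uB)
      go₁ : (∃₂ λ i i' → Mon i w × Mon i' B × i ℕ.+ i' ≡ k) → j ≡ 0
      go₁ (e , _ , mw , mB' , e+j≡k) with Mon-unique mB mB'
      ... | ≡.refl = go₂ (rev e w) (reversed mw e+j≡k) (irr (rev e w) B (≋⇒≈₂ (reversed mw e+j≡k)))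

  -- A factorisation s = a b lifts to r = Φ a Φ b with two self-reciprocal factors. If r is
  -- irreducible, one of them is constant. If r = g g*, the prime g divides one of them, and `half`
  -- makes the other constant: otherwise that factor would be g itself, which is not
  -- self-reciprocal.
  prime⇒Rel : ∀ {r} → Monic r → PrimeSelfReciprocal r → 2 Div.∣ deg r →
              ∃₂ λ k s → Rel k s r × Irreducible s × deg r ≡ k ℕ.+ k
  prime⇒Rel {r} mr psr (Div.divides k dr) = go psr
    where
    deg-r : deg r ≡ k ℕ.+ k
    deg-r = ≡.trans dr (≡.trans (ℕP.*-comm k 2) (cong (k ℕ.+_) (ℕP.+-identityʳ k)))
    Mr : Mon (k ℕ.+ k) r
    Mr = subst (λ d → Mon d r) deg-r (Monic⇒Mon mr)
    pos : ∀ {s} → Rel k s r → 1 ℕ.≤ k → 1 ℕ.≤ deg s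
    pos R le = subst (1 ℕ.≤_) (≡.sym (Mon-deg (mon R))) le
    go : PrimeSelfReciprocal r → ∃₂ λ k s → Rel k s r × Irreducible s × deg r ≡ k ℕ.+ k
    go (inj₁ (_ , (1≤ , irr) , _ , sr)) with selfReciprocal⇒Rel k Mr (trans (sym (recip-rev Mr)) (≈₂⇒≋ sr))
    ... | s , R = k , s , R , (pos R (1≤k k (subst (1 ℕ.≤_) deg-r 1≤)) , irr-s) , deg-r
      where
      1≤k : ∀ k → 1 ℕ.≤ k ℕ.+ k → 1 ℕ.≤ k
      1≤k (suc k) _ = s≤s z≤n
      irr-s : ∀ a b → (a * b) ≈₂ s → deg a ≡ 0 ⊎ deg b ≡ 0
      irr-s a b ab with factor-Mon {a} {b} (≈₂⇒≋ ab) (mon R)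
      ... | i , j , ma , mb , ≡.refl with irr (Φ i a) (Φ j b) (≋⇒≈₂ (trans (sym (H-* x²+1 i j (bnd ma) (bnd mb))) (trans (H-cong x²+1 (i ℕ.+ j) (≈₂⇒≋ {a * b} {s} ab)) (rel R))))
      ... | inj₁ z = inj₁ (≡.trans (Mon-deg ma) (n+n≡0 (≡.trans (≡.sym (Mon-deg (Mon-Φ ma))) z)))
      ... | inj₂ z = inj₂ (≡.trans (Mon-deg mb) (n+n≡0 (≡.trans (≡.sym (Mon-deg (Mon-Φ mb))) z)))
    go (inj₂ (g , mon-g , irr-g , c , ¬sr , eq)) with Monic⇒Mon mon-g
    ... | mg = finish (n+n-injective (Mon-unique (Mon-resp (sym eq') (Mon-* mg mg*)) Mr)) mg eq' mg*
      where
      eq' : r ≋ g * rev (deg g) g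
      eq' = trans (≈₂⇒≋ eq) (*-congˡ {g} (recip-rev mg))
      mg* : Mon (deg g) (rev (deg g) g)
      mg* = Mon-rev {f = g} (≡.trans (≡.sym (const-co g)) c)
      finish : ∀ {d} → d ≡ k → Mon d g → r ≋ g * rev d g → Mon d (rev d g) → ∃₂ λ k s → Rel k s r × Irreducible s × deg r ≡ k ℕ.+ k
      finish ≡.refl mg eq' mg* with selfReciprocal⇒Rel k Mr (trans (H-cong one₂ (k ℕ.+ k) eq')
          (trans (H-* one₂ k k (bnd mg) (rev-Lt k g)) (trans (*-congˡ {rev k g} (rev-rev k (bnd mg))) (trans (*-comm (rev k g) g) (sym eq')))))
      ... | s , R = k , s , R , (pos R (subst (1 ℕ.≤_) (Mon-deg mg) (proj₁ irr-g)) , irr-s) , deg-r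
        where
        irr-s : ∀ a b → (a * b) ≈₂ s → deg a ≡ 0 ⊎ deg b ≡ 0
        irr-s a b ab with factor-Mon {a} {b} (≈₂⇒≋ ab) (mon R)
        ... | i , j , ma , mb , ≡.refl with trans (sym (H-* x²+1 i j (bnd ma) (bnd mb))) (trans (H-cong x²+1 (i ℕ.+ j) (≈₂⇒≋ {a * b} {s} ab)) (trans (rel R) eq'))
        ... | AB with irr-prime irr-g mg (Φ i a) (Φ j b) (rev (i ℕ.+ j) g , trans (*-comm (rev (i ℕ.+ j) g) g) (sym AB))
        ... | inj₁ d = inj₂ (≡.trans (Mon-deg mb) (half irr-g mg ¬sr (Mon-Φ mb) (rev-Φ j b) AB mg* d))
        ... | inj₂ d = inj₁ (≡.trans (Mon-deg ma) (half irr-g mg ¬sr (Mon-Φ ma) (rev-Φ i a) (trans (*-comm (Φ j b) (Φ i a)) AB) mg* d))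

  -- The product S of the powers sᵢ^N, of degree K, stored with the coprimality of each power to the
  -- product of the following ones, which is what peeling off one factor of a multiplicative count
  -- requires.
  data Tower (N : ℕ) : List Poly₂ → ℕ → Poly₂ → Set where
    []   : Tower N [] 0 one₂
    cons : ∀ {r rs K S} k s → Irreducible s → Mon k s → deg r ≡ k ℕ.+ k → Coprime (s ^₂ N) S →
           Tower N rs K S → Tower N (r ∷ rs) (N ℕ.* k ℕ.+ K) (s ^₂ N * S)

  Tower-Mon : ∀ {N rs K S} → Tower N rs K S → Mon K S
  Tower-Mon []                       = Mon-one
  Tower-Mon {N} (cons k s _ m _ _ T) = Mon-* (Mon-^ N m) (Tower-Mon T)

  module _ (N m : ℕ) (odd : ¬ (2 Div.∣ m)) where

    -- The factor `c` collects what has already been split off, so each tail still sits inside a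
    -- factorisation of x^m + 1. Separability of x^m + 1 makes r coprime to the rest; this passes to
    -- N-th powers and then, by `Rel-coprime`, to the polynomials in y.
    tower : ∀ rs → All (λ r → Monic r × PrimeSelfReciprocal r × 2 Div.∣ deg r) rs →
            ∀ c → c * prod₂ rs ≋ xⁿ+1 m → ∃₂ λ K S → Tower N rs K S × Rel K S (prod₂ (map (_^₂ N) rs))
    tower []       []                       c e = 0 , one₂ , [] , Rel-one
    tower (r ∷ rs) ((mr , pr , er) ∷ all) c e with prime⇒Rel mr pr er | tower rs all (c * r) (trans (*-assoc c r (prod₂ rs)) e)
    ... | k , s , R , irr , dr | K , S , T , RS = _ , _ , cons k s irr (mon R) dr cop T , Rel-* RN RS
      where
      RN = Rel-^ N R
      cop : Coprime (s ^₂ N) S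
      cop = Rel-coprime RN RS (coprime-resp refl (sym (prod-^ N rs))
        (coprime-sym (coprime-^ N (coprime-sym (coprime-^ N (coprime-sym (coprime-*ʳ {b = c}
          (coprime-sym (xᵐ+1-coprime m odd {c * r} (trans (*-assoc c r (prod₂ rs)) e))))))))))

  module Factorisation (v e N m : ℕ) (N≡ : N ≡ 2 ℕ.^ suc v) (e≡ : e ≡ 2 ℕ.^ v) (odd : ¬ (2 Div.∣ m)) (rs : List Poly₂)
      (all : All (λ r → Monic r × PrimeSelfReciprocal r × 2 Div.∣ deg r) rs)
      (hyp : xⁿ+1 (N ℕ.* m) ≋ (x+1 ^₂ N) * prod₂ (map (_^₂ N) rs)) where

    -- Both sides of the hypothesis are N-th powers with N a power of 2, and such powers are
    -- injective in a domain of characteristic 2.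
    root : x+1 * prod₂ rs ≋ xⁿ+1 m
    root = 2^-injective (suc v) (subst (λ N → (x+1 * prod₂ rs) ^₂ N ≋ xⁿ+1 m ^₂ N) N≡
      (trans (^-* x+1 (prod₂ rs) N) (trans (*-congˡ {x+1 ^₂ N} (sym (prod-^ N rs))) (trans (sym hyp) power))))
      where
      power : xⁿ+1 (N ℕ.* m) ≋ xⁿ+1 m ^₂ N
      power = subst (λ N → xⁿ+1 (N ℕ.* m) ≋ xⁿ+1 m ^₂ N) (≡.sym N≡) (xⁿ+1-2^ (suc v) m)

    x²+1≋ : x²+1 ≋ x+1 * x+1
    x²+1≋ = ≈₂⇒≋ ≡.refl

    RX : Rel 1 X x²+1
    RX = mkRel (Mon-X^ 1) Φ-X

    square : ∀ f → (f * f) ^₂ e ≋ f ^₂ N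
    square f = trans (^-* f f e) (subst₂ (λ e N → f ^₂ e * f ^₂ e ≋ f ^₂ N) (≡.sym e≡) (≡.sym N≡) (sym (^-2^ f v)))

    -- Origin of the exponent e = N/2: (x + 1)² = x² + 1 = x y, so (x + 1)^N = x^e y^e.
    RXe : Rel e (X^ e) (x+1 ^₂ N)
    RXe = subst (λ i → Rel i (X^ e) (x+1 ^₂ N)) (ℕP.*-identityʳ e)
      (Rel-resp (X^≋ e) (trans (^-cong e x²+1≋) (square x+1)) (Rel-^ e RX))

    coprime-X : ∀ {K S} → Rel K S (prod₂ (map (_^₂ N) rs)) → Coprime X S
    coprime-X RS = Rel-coprime RX RS (coprime-resp (sym x²+1≋) (sym (prod-^ N rs))
        (coprime-^ N (coprime-sym (coprime-* (coprime-sym c) (coprime-sym c)))))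
      where
      c : Coprime x+1 (prod₂ rs)
      c = xᵐ+1-coprime m odd root

    factorisation : ∃₂ λ K S → Tower N rs K S × Coprime X S × Rel (e ℕ.+ K) (X^ e * S) (xⁿ+1 (N ℕ.* m))
    factorisation = go (tower N m odd rs all x+1 root)
      where
      go : (∃₂ λ K S → Tower N rs K S × Rel K S (prod₂ (map (_^₂ N) rs))) →
           ∃₂ λ K S → Tower N rs K S × Coprime X S × Rel (e ℕ.+ K) (X^ e * S) (xⁿ+1 (N ℕ.* m))
      go (K , S , T , RS) = K , S , T , coprime-X RS , Rel-resp refl (sym hyp) (Rel-* RXe RS)

-- Weight enumerators as polynomials over ℕ.

module GeneratingFunctions where

  open import Level using (0ℓ)
  open FiniteSums
  open import Algebra.Bundles using (CommutativeMonoid)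
  open import Data.Bool using (Bool; true; false)
  open import Data.Nat using (ℕ; zero; suc; _+_; _*_; _^_; _∸_)
  open import Data.Nat.Properties
  open import Data.List using (List; []; _∷_; length; map; cartesianProduct)
  open import Data.List.Properties using (length-++; length-map)
  open import Data.List.Membership.Propositional using (_∈_)
  open import Data.List.Membership.Propositional.Properties using (∈-map⁺; ∈-map⁻; ∈-++⁺ˡ; ∈-++⁺ʳ)
  open import Data.List.Relation.Unary.Any using (here)
  open import Data.List.Relation.Unary.All using ([])
  open import Data.List.Relation.Unary.AllPairs using ([]; _∷_)
  open import Data.List.Relation.Unary.Unique.Propositional using (Unique)
  import Data.List.Relation.Unary.Unique.Propositional.Properties as Unique
  open import Data.Vec using (Vec; []; _∷_; replicate)
  open import Data.Product using (_×_; _,_)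
  open import Relation.Nullary using (¬_)
  open import Relation.Binary.PropositionalEquality using (_≡_; cong; cong₂; refl; sym; trans)

  infix 4 _≈ᴺ_
  record _≈ᴺ_ (f g : PolyN) : Set where
    constructor mk≈
    field coeff≡ : ∀ t → coeff f t ≡ coeff g t
  open _≈ᴺ_ public

  ≈-refl : ∀ {f} → f ≈ᴺ f
  ≈-refl = mk≈ λ _ → refl
  ≈-sym : ∀ {f g} → f ≈ᴺ g → g ≈ᴺ f
  ≈-sym p = mk≈ λ t → sym (coeff≡ p t)
  ≈-trans : ∀ {f g h} → f ≈ᴺ g → g ≈ᴺ h → f ≈ᴺ h
  ≈-trans p q = mk≈ λ t → trans (coeff≡ p t) (coeff≡ q t)
  ≡⇒≈ : ∀ {f g} → f ≡ g → f ≈ᴺ g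
  ≡⇒≈ refl = ≈-refl

  coeff-+ : ∀ f g t → coeff (f +ᴺ g) t ≡ coeff f t + coeff g t
  coeff-+ []      g       t       = refl
  coeff-+ (c ∷ f) []      t       = sym (+-identityʳ _)
  coeff-+ (c ∷ f) (d ∷ g) zero    = refl
  coeff-+ (c ∷ f) (d ∷ g) (suc t) = coeff-+ f g t

  coeff-scale : ∀ c f t → coeff (map (c *_) f) t ≡ c * coeff f t
  coeff-scale c []      t       = sym (*-zeroʳ c)
  coeff-scale c (d ∷ f) zero    = refl
  coeff-scale c (d ∷ f) (suc t) = coeff-scale c f t

  +ᴺ-cong : ∀ {f f' g g'} → f ≈ᴺ f' → g ≈ᴺ g' → f +ᴺ g ≈ᴺ f' +ᴺ g'
  +ᴺ-cong {f} {f'} {g} {g'} p q = mk≈ λ t → trans (coeff-+ f g t) (trans (cong₂ _+_ (coeff≡ p t) (coeff≡ q t)) (sym (coeff-+ f' g' t)))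

  +ᴺ-assoc : ∀ f g h → (f +ᴺ g) +ᴺ h ≈ᴺ f +ᴺ (g +ᴺ h)
  +ᴺ-assoc f g h = mk≈ λ t → trans (trans (coeff-+ (f +ᴺ g) h t) (cong (_+ coeff h t) (coeff-+ f g t)))
    (trans (+-assoc (coeff f t) _ _) (sym (trans (coeff-+ f (g +ᴺ h) t) (cong (coeff f t +_) (coeff-+ g h t)))))

  +ᴺ-comm : ∀ f g → f +ᴺ g ≈ᴺ g +ᴺ f
  +ᴺ-comm f g = mk≈ λ t → trans (coeff-+ f g t) (trans (+-comm (coeff f t) _) (sym (coeff-+ g f t)))

  +ᴺ-identityʳ : ∀ f → f +ᴺ [] ≈ᴺ f
  +ᴺ-identityʳ f = mk≈ λ t → trans (coeff-+ f [] t) (+-identityʳ _)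

  +ᴺ-monoid : CommutativeMonoid 0ℓ 0ℓ
  +ᴺ-monoid = record
    { Carrier = PolyN ; _≈_ = _≈ᴺ_ ; _∙_ = _+ᴺ_ ; ε = []
    ; isCommutativeMonoid = record
      { isMonoid = record
        { isSemigroup = record
          { isMagma = record { isEquivalence = record { refl = ≈-refl ; sym = ≈-sym ; trans = ≈-trans } ; ∙-cong = +ᴺ-cong }
          ; assoc = +ᴺ-assoc }
        ; identity = (λ _ → ≈-refl) , +ᴺ-identityʳ }
      ; comm = +ᴺ-comm } }

  open Sum +ᴺ-monoid public
  open import Algebra.Properties.CommutativeSemigroup (CommutativeMonoid.commutativeSemigroup +ᴺ-monoid) using (interchange)

  0∷≈ : ∀ {f} → f ≈ᴺ [] → (0 ∷ f) ≈ᴺ []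
  0∷≈ p = mk≈ λ { zero → refl ; (suc t) → coeff≡ p t }

  ∷-≈ : ∀ {c d f g} → c ≡ d → f ≈ᴺ g → (c ∷ f) ≈ᴺ (d ∷ g)
  ∷-≈ p q = mk≈ λ { zero → p ; (suc t) → coeff≡ q t }

  scaleᴺ-+ : ∀ c f g → map (c *_) (f +ᴺ g) ≈ᴺ map (c *_) f +ᴺ map (c *_) g
  scaleᴺ-+ c f g = mk≈ λ t → trans (coeff-scale c (f +ᴺ g) t) (trans (cong (c *_) (coeff-+ f g t)) (trans (*-distribˡ-+ c _ _)
    (sym (trans (coeff-+ (map (c *_) f) _ t) (cong₂ _+_ (coeff-scale c f t) (coeff-scale c g t))))))

  scaleᴺ-+ˡ : ∀ c d f → map ((c + d) *_) f ≈ᴺ map (c *_) f +ᴺ map (d *_) f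
  scaleᴺ-+ˡ c d f = mk≈ λ t → trans (coeff-scale (c + d) f t) (trans (*-distribʳ-+ _ c d)
    (sym (trans (coeff-+ (map (c *_) f) _ t) (cong₂ _+_ (coeff-scale c f t) (coeff-scale d f t)))))

  scaleᴺ-cong : ∀ {c d f g} → c ≡ d → f ≈ᴺ g → map (c *_) f ≈ᴺ map (d *_) g
  scaleᴺ-cong {c} {f = f} {g} refl p = mk≈ λ t → trans (coeff-scale c f t) (trans (cong (c *_) (coeff≡ p t)) (sym (coeff-scale c g t)))

  scaleᴺ-0 : ∀ f → map (0 *_) f ≈ᴺ []
  scaleᴺ-0 f = mk≈ λ t → coeff-scale 0 f t

  *ᴺ-zeroʳ : ∀ f → f *ᴺ [] ≈ᴺ []
  *ᴺ-zeroʳ []      = ≈-refl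
  *ᴺ-zeroʳ (c ∷ f) = 0∷≈ (*ᴺ-zeroʳ f)

  *ᴺ-congʳ : ∀ f {g h} → g ≈ᴺ h → f *ᴺ g ≈ᴺ f *ᴺ h
  *ᴺ-congʳ []      p = ≈-refl
  *ᴺ-congʳ (c ∷ f) p = +ᴺ-cong (scaleᴺ-cong {c} refl p) (∷-≈ refl (*ᴺ-congʳ f p))

  *ᴺ-congˡ : ∀ {f g} h → f ≈ᴺ g → f *ᴺ h ≈ᴺ g *ᴺ h
  *ᴺ-congˡ {[]}    {[]}    h p = ≈-refl
  *ᴺ-congˡ {[]}    {d ∷ g} h p = ≈-sym (+ᴺ-cong (≈-trans (scaleᴺ-cong {f = h} (sym (coeff≡ p 0)) ≈-refl) (scaleᴺ-0 h)) (0∷≈ (≈-sym (*ᴺ-congˡ {[]} {g} h (mk≈ λ t → coeff≡ p (suc t))))))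
  *ᴺ-congˡ {c ∷ f} {[]}    h p = +ᴺ-cong (≈-trans (scaleᴺ-cong {f = h} (coeff≡ p 0) ≈-refl) (scaleᴺ-0 h)) (0∷≈ (*ᴺ-congˡ {f} {[]} h (mk≈ λ t → coeff≡ p (suc t))))
  *ᴺ-congˡ {c ∷ f} {d ∷ g} h p = +ᴺ-cong (scaleᴺ-cong {f = h} (coeff≡ p 0) ≈-refl) (∷-≈ refl (*ᴺ-congˡ {f} {g} h (mk≈ λ t → coeff≡ p (suc t))))

  *ᴺ-cong : ∀ {f f' g g'} → f ≈ᴺ f' → g ≈ᴺ g' → f *ᴺ g ≈ᴺ f' *ᴺ g'
  *ᴺ-cong {f} {f'} {g} {g'} p q = ≈-trans (*ᴺ-congʳ f q) (*ᴺ-congˡ g' p)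

  *ᴺ-distribˡ : ∀ f g h → f *ᴺ (g +ᴺ h) ≈ᴺ (f *ᴺ g) +ᴺ (f *ᴺ h)
  *ᴺ-distribˡ []      g h = ≈-refl
  *ᴺ-distribˡ (c ∷ f) g h = ≈-trans (+ᴺ-cong (scaleᴺ-+ c g h) (∷-≈ refl (*ᴺ-distribˡ f g h))) (interchange (map (c *_) g) (map (c *_) h) (0 ∷ (f *ᴺ g)) (0 ∷ (f *ᴺ h)))

  *ᴺ-distribʳ : ∀ h f g → (f +ᴺ g) *ᴺ h ≈ᴺ (f *ᴺ h) +ᴺ (g *ᴺ h)
  *ᴺ-distribʳ h []      g       = ≈-refl
  *ᴺ-distribʳ h (c ∷ f) []      = ≈-sym (+ᴺ-identityʳ _)
  *ᴺ-distribʳ h (c ∷ f) (d ∷ g) = ≈-trans (+ᴺ-cong (scaleᴺ-+ˡ c d h) (∷-≈ refl (*ᴺ-distribʳ h f g))) (interchange (map (c *_) h) (map (d *_) h) (0 ∷ (f *ᴺ h)) (0 ∷ (g *ᴺ h)))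

  mono-* : ∀ a i b j → monoᴺ a i *ᴺ monoᴺ b j ≈ᴺ monoᴺ (a * b) (i + j)
  mono-* a zero    b j = ≈-trans (+ᴺ-cong {g' = []} (≡⇒≈ (scale-mono j)) (0∷≈ ≈-refl)) (+ᴺ-identityʳ _)
    where
    scale-mono : ∀ j → map (a *_) (monoᴺ b j) ≡ monoᴺ (a * b) j
    scale-mono zero    = refl
    scale-mono (suc j) = cong₂ _∷_ (*-zeroʳ a) (scale-mono j)
  mono-* a (suc i) b j = ≈-trans (+ᴺ-cong (scaleᴺ-0 (monoᴺ b j)) ≈-refl) (∷-≈ refl (mono-* a i b j))

  mono-+ : ∀ a b i → monoᴺ a i +ᴺ monoᴺ b i ≡ monoᴺ (a + b) i
  mono-+ a b zero    = refl
  mono-+ a b (suc i) = cong (0 ∷_) (mono-+ a b i)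

  mono-0 : ∀ i → monoᴺ 0 i ≈ᴺ []
  mono-0 zero    = 0∷≈ ≈-refl
  mono-0 (suc i) = 0∷≈ (mono-0 i)

  coeff-mono-≡ : ∀ a i → coeff (monoᴺ a i) i ≡ a
  coeff-mono-≡ a zero    = refl
  coeff-mono-≡ a (suc i) = coeff-mono-≡ a i

  coeff-mono-≢ : ∀ a i t → ¬ (i ≡ t) → coeff (monoᴺ a i) t ≡ 0
  coeff-mono-≢ a zero    zero    ne with () ← ne refl
  coeff-mono-≢ a zero    (suc t) ne = refl
  coeff-mono-≢ a (suc i) zero    ne = refl
  coeff-mono-≢ a (suc i) (suc t) ne = coeff-mono-≢ a i t (λ e → ne (cong suc e))

  module _ {A : Set} where
    ∑-mono : ∀ (xs : List A) a i → ∑ xs (λ _ → monoᴺ a i) ≈ᴺ monoᴺ (length xs * a) i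
    ∑-mono []       a i = ≈-sym (mono-0 i)
    ∑-mono (x ∷ xs) a i = ≈-trans (+ᴺ-cong (≈-refl {monoᴺ a i}) (∑-mono xs a i)) (≡⇒≈ (mono-+ a (length xs * a) i))

    ∑-*ʳ : ∀ (xs : List A) f h → ∑ xs f *ᴺ h ≈ᴺ ∑ xs (λ x → f x *ᴺ h)
    ∑-*ʳ []       f h = ≈-refl
    ∑-*ʳ (x ∷ xs) f h = ≈-trans (*ᴺ-distribʳ h (f x) (∑ xs f)) (+ᴺ-cong ≈-refl (∑-*ʳ xs f h))

    ∑-*ˡ : ∀ (xs : List A) f h → h *ᴺ ∑ xs f ≈ᴺ ∑ xs (λ x → h *ᴺ f x)
    ∑-*ˡ []       f h = *ᴺ-zeroʳ h
    ∑-*ˡ (x ∷ xs) f h = ≈-trans (*ᴺ-distribˡ h (f x) (∑ xs f)) (+ᴺ-cong ≈-refl (∑-*ˡ xs f h))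

    -- The weight enumerator Σ z^(κ x). Counts are compared only in this form, where independent
    -- choices become products by `gen-*`.
    gen : List A → (A → ℕ) → PolyN
    gen xs κ = ∑ xs (λ x → monoᴺ 1 (κ x))

    gen-cong : ∀ (xs : List A) {κ μ : A → ℕ} → (∀ x → κ x ≡ μ x) → gen xs κ ≈ᴺ gen xs μ
    gen-cong xs e = ∑-cong xs (λ x → ≡⇒≈ (cong (monoᴺ 1) (e x)))

  gen-* : ∀ {A B : Set} (xs : List A) (ys : List B) (κ : A → ℕ) (μ : B → ℕ) →
          gen xs κ *ᴺ gen ys μ ≈ᴺ gen (cartesianProduct xs ys) (λ (x , y) → κ x + μ y)
  gen-* xs ys κ μ = ≈-trans (∑-*ʳ xs _ (gen ys μ)) (≈-trans
    (∑-cong xs (λ x → ≈-trans (∑-*ˡ ys _ (monoᴺ 1 (κ x))) (∑-cong ys (λ y → mono-* 1 (κ x) 1 (μ y)))))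
    (≈-sym (∑-× xs ys (λ (x , y) → monoᴺ 1 (κ x + μ y)))))

  sumᴺ-cong : ∀ J {f g} → (∀ j → f (suc j) ≈ᴺ g (suc j)) → sumᴺ J f ≈ᴺ sumᴺ J g
  sumᴺ-cong zero    e = ≈-refl
  sumᴺ-cong (suc J) e = +ᴺ-cong (sumᴺ-cong J e) (e J)

  allVecs-complete : ∀ {n} (v : Vec Bool n) → v ∈ allVecs n
  allVecs-complete []          = here refl
  allVecs-complete (true  ∷ v) = ∈-++⁺ˡ (∈-map⁺ (true ∷_) (allVecs-complete v))
  allVecs-complete (false ∷ v) = ∈-++⁺ʳ (map (true ∷_) (allVecs _)) (∈-map⁺ (false ∷_) (allVecs-complete v))

  private
    ∷-inj : ∀ {b n} {u v : Vec Bool n} → _≡_ {A = Vec Bool (suc n)} (b ∷ u) (b ∷ v) → u ≡ v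
    ∷-inj refl = refl

  allVecs-unique : ∀ n → Unique (allVecs n)
  allVecs-unique zero    = [] ∷ []
  allVecs-unique (suc n) = Unique.++⁺ (Unique.map⁺ ∷-inj (allVecs-unique n)) (Unique.map⁺ ∷-inj (allVecs-unique n)) disjoint
    where
    disjoint : ∀ {v} → ¬ (v ∈ map (true ∷_) (allVecs n) × v ∈ map (false ∷_) (allVecs n))
    disjoint (p , q) with ∈-map⁻ (true ∷_) p | ∈-map⁻ (false ∷_) q
    ... | _ , _ , refl | _ , _ , ()

  length-allVecs : ∀ n → length (allVecs n) ≡ 2 ^ n
  length-allVecs zero    = refl
  length-allVecs (suc n) = trans (length-++ (map (true ∷_) (allVecs n)))
    (cong₂ _+_ (trans (length-map _ (allVecs n)) (length-allVecs n))
               (trans (trans (length-map _ (allVecs n)) (length-allVecs n)) (sym (+-identityʳ _))))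

  length-cartesianProduct : ∀ {A B : Set} (xs : List A) (ys : List B) → length (cartesianProduct xs ys) ≡ length xs * length ys
  length-cartesianProduct []       ys = refl
  length-cartesianProduct (x ∷ xs) ys = trans (length-++ (map (x ,_) ys)) (cong₂ _+_ (length-map _ ys) (length-cartesianProduct xs ys))

  pairs : ∀ d e → List (Vec Bool d × Vec Bool e)
  pairs d e = cartesianProduct (allVecs d) (allVecs e)

  ∑-pairs : ∀ d e n → d + e ≡ n → (ψ : Vec Bool d × Vec Bool e → Vec Bool n) → (∀ {x y} → ψ x ≡ ψ y → x ≡ y) →
            ∀ f → ∑ (allVecs n) f ≈ᴺ ∑ (pairs d e) (λ x → f (ψ x))
  ∑-pairs d e n eq ψ inj f = ≈-sym (∑-inj ψ inj (Unique.cartesianProduct⁺ (allVecs-unique d) (allVecs-unique e)) allVecs-complete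
    (≤-reflexive (trans (length-allVecs n) (trans (cong (2 ^_) (sym eq)) (trans (^-distribˡ-+-* 2 d e)
       (sym (trans (length-cartesianProduct (allVecs d) (allVecs e)) (cong₂ _*_ (length-allVecs d) (length-allVecs e)))))))) f)

  zeroVec : ∀ k → Vec Bool k
  zeroVec k = replicate k false

  -- All vectors with first bit `true` are nonzero; the remaining half is a vector space of one
  -- dimension less. The counts add up as 2^k + (2^k - 1) = 2^(k+1) - 1.
  ∑-zero-or-not : ∀ k (f : Vec Bool k → PolyN) c t → (∀ v → ¬ (v ≡ zeroVec k) → f v ≈ᴺ monoᴺ c t) →
                  ∑ (allVecs k) f ≈ᴺ f (zeroVec k) +ᴺ monoᴺ ((2 ^ k ∸ 1) * c) t
  ∑-zero-or-not zero    f c t h = +ᴺ-cong (≈-refl {f []}) (≈-sym (mono-0 t))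
  ∑-zero-or-not (suc k) f c t h = ≈-trans (∑-++ (map (true ∷_) (allVecs k)) _ f) (≈-trans (+ᴺ-cong trues falses)
    (≈-trans (≈-trans (≈-sym (+ᴺ-assoc M (f (zeroVec (suc k))) M')) (≈-trans (+ᴺ-cong (+ᴺ-comm M (f (zeroVec (suc k)))) (≈-refl {M'})) (+ᴺ-assoc (f (zeroVec (suc k))) M M')))
    (+ᴺ-cong (≈-refl {f (zeroVec (suc k))}) (≡⇒≈ (trans (mono-+ (2 ^ k * c) ((2 ^ k ∸ 1) * c) t) (cong (λ a → monoᴺ a t) count))))))
    where
    M  = monoᴺ (2 ^ k * c) t
    M' = monoᴺ ((2 ^ k ∸ 1) * c) t
    trues : ∑ (map (true ∷_) (allVecs k)) f ≈ᴺ M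
    trues = ≈-trans (∑-map (true ∷_) (allVecs k) f) (≈-trans (∑-cong (allVecs k) (λ v → h (true ∷ v) λ ()))
      (≈-trans (∑-mono (allVecs k) c t) (≡⇒≈ (cong (λ a → monoᴺ (a * c) t) (length-allVecs k)))))
    falses : ∑ (map (false ∷_) (allVecs k)) f ≈ᴺ f (zeroVec (suc k)) +ᴺ M'
    falses = ≈-trans (∑-map (false ∷_) (allVecs k) f) (∑-zero-or-not k (λ v → f (false ∷ v)) c t (λ v ne → h (false ∷ v) (λ e → ne (∷-inj e))))
    count : 2 ^ k * c + (2 ^ k ∸ 1) * c ≡ (2 ^ suc k ∸ 1) * c
    count = trans (sym (*-distribʳ-+ c (2 ^ k) (2 ^ k ∸ 1)))
      (cong (_* c) (trans (sym (+-∸-assoc (2 ^ k) {2 ^ k} {1} (m^n>0 2 k))) (cong (λ a → 2 ^ k + a ∸ 1) (sym (+-identityʳ (2 ^ k))))))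

-- Enumerating residues modulo a polynomial by the degree of their gcd with it.

module GcdCounting where

  open BinaryPolynomials
  open ReciprocalPolynomials using (Mon-^; coprime-^; X^≋)
  open Factors using (Tower; []; cons; Tower-Mon; factor-Mon)
  open GeneratingFunctions
  open import Data.Bool using (Bool; true; false)
  open import Data.Nat as ℕ using (ℕ; zero; suc; _∸_; _≤_; s≤s; z≤n)
  import Data.Nat.Properties as ℕP
  import Data.Nat.DivMod as ℕD
  open import Data.Nat.Tactic.RingSolver using (solve-∀)
  open import Data.List using ([]; _∷_; map)
  open import Data.Vec using (Vec; []; _∷_)
  open import Data.Product using (_×_; _,_; proj₁; proj₂)
  open import Data.Sum using (_⊎_; inj₁; inj₂)
  open import Data.Empty using (⊥-elim)
  open import Relation.Nullary using (¬_)
  open import Relation.Binary.PropositionalEquality as ≡ using (_≡_; cong; cong₂; subst)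

  toPoly : ∀ {n} → Vec Bool n → Poly₂
  toPoly []      = []
  toPoly (b ∷ v) = b ∷ toPoly v

  toVec : ∀ n → Poly₂ → Vec Bool n
  toVec zero    f       = []
  toVec (suc n) []      = false ∷ toVec n []
  toVec (suc n) (c ∷ f) = c ∷ toVec n f

  Lt-toPoly : ∀ {n} (v : Vec Bool n) → Lt n (toPoly v)
  Lt-toPoly []      = Lt-[]
  Lt-toPoly (b ∷ v) = Lt-∷ (Lt-toPoly v)

  toPoly-toVec : ∀ {n f} → Lt n f → toPoly (toVec n f) ≋ f
  toPoly-toVec {zero}          l = sym (Lt0⇒≋ l)
  toPoly-toVec {suc n} {[]}    l = 0∷≋ (toPoly-toVec {n} Lt-[])
  toPoly-toVec {suc n} {c ∷ f} l = ∷-cong ≡.refl (toPoly-toVec (Lt-tail l))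

  toPoly-injective : ∀ {n} {u v : Vec Bool n} → toPoly u ≋ toPoly v → u ≡ v
  toPoly-injective {u = []}    {[]}    e = ≡.refl
  toPoly-injective {u = b ∷ u} {c ∷ v} e = cong₂ _∷_ (at e 0) (toPoly-injective (tail-≋ e))

  toVec-injective : ∀ {n f g} → Lt n f → Lt n g → toVec n f ≡ toVec n g → f ≋ g
  toVec-injective l l' e = trans (sym (toPoly-toVec l)) (trans (reflexive (cong toPoly e)) (toPoly-toVec l'))

  toPoly-zero : ∀ n → toPoly (zeroVec n) ≋ []
  toPoly-zero zero    = refl
  toPoly-zero (suc n) = 0∷≋ (toPoly-zero n)

  ∣-small : ∀ {d p f} → Mon d p → Lt d f → p ∣ f → f ≋ []
  ∣-small {d} {p} {f} m l dv with zero-or-Mon f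
  ... | inj₁ z = z
  ... | inj₂ (e , mf) with ∣⇒Mon dv mf
  ... | d' , m' , d'≤e with Mon-unique m m'
  ... | ≡.refl = ⊥-elim (ℕP.<-irrefl ≡.refl (ℕP.<-≤-trans (Lt-Mon l mf) d'≤e))

  -- The codimension of the radical, hence the exponent t of z: the kernel has dimension twice the
  -- degree of a gcd.
  weight : ℕ → Poly₂ → Poly₂ → ℕ
  weight d P A = 2 ℕ.* (d ∸ gdeg A P)

  -- For P of degree d this is the sum over g | P of φ(P/g) z^(2 deg(P/g)), with φ the Euler
  -- function of F₂[y]; it is multiplicative like φ.
  Γ : ℕ → Poly₂ → PolyN
  Γ d P = gen (allVecs d) (λ A → weight d P (toPoly A))

  gdeg-resp : ∀ {A B P Q d} → A ≋ B → P ≋ Q → Mon d P → gdeg A P ≡ gdeg B Q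
  gdeg-resp {A} {B} {P} {Q} p q m = ≡.sym (gdeg-unique {B} {Q} (Mon-resp q m) (gcd-resp p q (proj₂ (gcd A P))) (proj₁ (gcd-Mon A m)))

  Γ-resp : ∀ {d P Q} → Mon d P → P ≋ Q → Γ d P ≈ᴺ Γ d Q
  Γ-resp {d} {P} {Q} m e = gen-cong (allVecs d) (λ A → cong (λ g → 2 ℕ.* (d ∸ g)) (gdeg-resp {toPoly A} {toPoly A} {P} {Q} refl e m))

  Γ-one : Γ 0 one₂ ≈ᴺ 1 ∷ []
  Γ-one = +ᴺ-identityʳ (1 ∷ [])

  -- The pair of residues (U, V) modulo (P, Q) is encoded as U Q + V P; this needs no division.
  module _ {d e : ℕ} {P Q : Poly₂} (mP : Mon d P) (mQ : Mon e Q) (cop : Coprime P Q) where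
    private
      comb : Vec Bool d × Vec Bool e → Poly₂
      comb (u , v) = toPoly u * Q + toPoly v * P

      Lt-comb : ∀ x → Lt (d ℕ.+ e) (comb x)
      Lt-comb (u , v) = Lt-+ (Lt-resp refl (Lt-* (Lt-toPoly u) (bnd mQ))) (subst (λ k → Lt k (toPoly v * P)) (ℕP.+-comm e d) (Lt-* (Lt-toPoly v) (bnd mP)))

      half : ∀ {d P Q u u' v v'} → Mon d P → Coprime Q P → Lt d u → Lt d u' → u * Q + v * P ≋ u' * Q + v' * P → u ≋ u'
      half {d} {P} {Q} {u} {u'} {v} {v'} m (a , b , k) l l' e = +≈0⇒≈ (∣-small m (Lt-+ l l')
        (a * (v + v') + b * (u + u') ,
         trans (solve 8 (λ P Q u u' v v' a b → (a :* (v :+ v') :+ b :* (u :+ u')) :* P := (u :+ u') :* (a :* Q :+ b :* P) :+ a :* ((u :* Q :+ v :* P) :+ (u' :* Q :+ v' :* P))) refl P Q u u' v v' a b)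
         (trans (+-cong (trans (*-congˡ {u + u'} k) (*-identityʳ (u + u'))) (trans (*-congˡ {a} (≈⇒+≈0 e)) (zeroʳ a))) (+-identityʳ (u + u')))))

      ψ : Vec Bool d × Vec Bool e → Vec Bool (d ℕ.+ e)
      ψ x = toVec (d ℕ.+ e) (comb x)

      ψ-injective : ∀ {x y} → ψ x ≡ ψ y → x ≡ y
      ψ-injective {u , v} {u' , v'} eq = cong₂ _,_
        (toPoly-injective (half {v = toPoly v} {toPoly v'} mP (coprime-sym cop) (Lt-toPoly u) (Lt-toPoly u') E))
        (toPoly-injective (half {v = toPoly u} {toPoly u'} mQ cop (Lt-toPoly v) (Lt-toPoly v')
           (trans (+-comm (toPoly v * P) (toPoly u * Q)) (trans E (+-comm (toPoly u' * Q) (toPoly v' * P))))))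
        where
        E : comb (u , v) ≋ comb (u' , v')
        E = toVec-injective (Lt-comb (u , v)) (Lt-comb (u' , v')) eq

      weight-ψ : ∀ x → weight (d ℕ.+ e) (P * Q) (toPoly (ψ x)) ≡ weight d P (toPoly (proj₁ x)) ℕ.+ weight e Q (toPoly (proj₂ x))
      weight-ψ (u , v) = ≡.trans (cong (λ g → 2 ℕ.* (d ℕ.+ e ∸ g)) gd) (split (proj₂ gU) (proj₂ gV))
        where
        gU = gcd-Mon (toPoly u) mP
        gV = gcd-Mon (toPoly v) mQ
        gd : gdeg (toPoly (ψ (u , v))) (P * Q) ≡ gdeg (toPoly u) P ℕ.+ gdeg (toPoly v) Q
        gd = gdeg-unique (Mon-* mP mQ)
          (gcd-resp (sym (toPoly-toVec (Lt-comb (u , v)))) refl (gcd-CRT cop (proj₂ (gcd (toPoly u) P)) (proj₂ (gcd (toPoly v) Q))))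
          (Mon-* (proj₁ gU) (proj₁ gV))
        split : ∀ {a b} → a ≤ d → b ≤ e → 2 ℕ.* (d ℕ.+ e ∸ (a ℕ.+ b)) ≡ 2 ℕ.* (d ∸ a) ℕ.+ 2 ℕ.* (e ∸ b)
        split {a} {b} a≤d b≤e = ≡.trans (cong (2 ℕ.*_) sub) (ℕP.*-distribˡ-+ 2 (d ∸ a) (e ∸ b))
          where
          sub : d ℕ.+ e ∸ (a ℕ.+ b) ≡ (d ∸ a) ℕ.+ (e ∸ b)
          sub = ≡.trans (≡.sym (ℕP.∸-+-assoc (d ℕ.+ e) a b)) (≡.trans (cong (_∸ b) (ℕP.+-∸-comm e a≤d)) (ℕP.+-∸-assoc (d ∸ a) b≤e))

    Γ-coprime : Γ (d ℕ.+ e) (P * Q) ≈ᴺ Γ d P *ᴺ Γ e Q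
    Γ-coprime = ≈-trans (∑-pairs d e (d ℕ.+ e) ≡.refl ψ ψ-injective _)
      (≈-trans (gen-cong (pairs d e) weight-ψ) (≈-sym (gen-* (allVecs d) (allVecs e) _ _)))

  module _ {k d : ℕ} {s : Poly₂} (ms : Mon k s) where
    -- Division by s read backwards: `u` is the residue and `v` the quotient.
    digits : Vec Bool k × Vec Bool d → Poly₂
    digits (u , v) = toPoly u + toPoly v * s

    Lt-digits : ∀ x → Lt (k ℕ.+ d) (digits x)
    Lt-digits (u , v) = Lt-+ (Lt-mono (ℕP.m≤m+n k d) (Lt-toPoly u)) (subst (λ n → Lt n (toPoly v * s)) (ℕP.+-comm d k) (Lt-* (Lt-toPoly v) (bnd ms)))

    digits-injective : ∀ {x y} → digits x ≋ digits y → x ≡ y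
    digits-injective {u , v} {u' , v'} e = cong₂ _,_ (toPoly-injective u≋) (toPoly-injective v≋)
      where
      U = toPoly u ; U' = toPoly u' ; V = toPoly v ; V' = toPoly v'
      u≋ : U ≋ U'
      u≋ = +≈0⇒≈ (∣-small ms (Lt-+ (Lt-toPoly u) (Lt-toPoly u')) (V + V' , 
        trans (solve 5 (λ u u' v v' s → (v :+ v') :* s := ((u :+ v :* s) :+ (u' :+ v' :* s)) :+ (u :+ u')) refl U U' V V' s)
              (trans (+-congʳ {U + U'} (≈⇒+≈0 e)) (+-identityˡ (U + U')))))
      v≋ : V ≋ V'
      v≋ = *-cancel ms (trans (*-comm s V) (trans (solve 3 (λ u v s → v :* s := u :+ (u :+ v :* s)) refl U V s)
        (trans (+-cong u≋ e) (trans (sym (solve 3 (λ u v s → v :* s := u :+ (u :+ v :* s)) refl U' V' s)) (*-comm V' s)))))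

  module _ {k : ℕ} {s : Poly₂} (irr : Irreducible s) (ms : Mon k s) where
    private
      powers : ℕ → ℕ → PolyN
      powers J j = monoᴺ (2 ℕ.^ (j ℕ.* k) ∸ 2 ℕ.^ ((j ∸ 1) ℕ.* k)) (2 ℕ.* (j ℕ.* k))

      -- Write A = u + v s. If u = 0, the gcd with s^(J+1) is s times gcd(v, s^J), and the weight is
      -- that of v modulo s^J. If u ≠ 0, A is coprime to the irreducible s and has full weight;
      -- there are (2^k - 1) 2^(Jk) such A.
      step : ∀ J → Γ (suc J ℕ.* k) (s ^₂ suc J) ≈ᴺ Γ (J ℕ.* k) (s ^₂ J) +ᴺ powers J (suc J)
      step J = ≈-trans (∑-pairs k d (k ℕ.+ d) ≡.refl ψ ψ-injective _)
        (≈-trans (∑-× (allVecs k) (allVecs d) _)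
        (≈-trans (∑-zero-or-not k _ (2 ℕ.^ d) (2 ℕ.* (k ℕ.+ d)) nonzero)
          (+ᴺ-cong zeroes (≡⇒≈ (cong (λ a → monoᴺ a (2 ℕ.* (k ℕ.+ d))) count)))))
        where
        d = J ℕ.* k
        Q = s ^₂ J
        mQ : Mon d Q
        mQ = Mon-^ J ms
        ψ : Vec Bool k × Vec Bool d → Vec Bool (k ℕ.+ d)
        ψ x = toVec (k ℕ.+ d) (digits ms x)
        ψ-injective : ∀ {x y} → ψ x ≡ ψ y → x ≡ y
        ψ-injective {x} {y} e = digits-injective ms (toVec-injective (Lt-digits ms x) (Lt-digits ms y) e)
        W : Vec Bool k × Vec Bool d → ℕ
        W x = weight (k ℕ.+ d) (s * Q) (toPoly (ψ x))
        count : (2 ℕ.^ k ∸ 1) ℕ.* 2 ℕ.^ d ≡ 2 ℕ.^ (k ℕ.+ d) ∸ 2 ℕ.^ d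
        count = ≡.trans (ℕP.*-distribʳ-∸ (2 ℕ.^ d) (2 ℕ.^ k) 1) (cong₂ _∸_ (≡.sym (ℕP.^-distribˡ-+-* 2 k d)) (ℕP.*-identityˡ (2 ℕ.^ d)))
        zeroes : ∑ (allVecs d) (λ v → monoᴺ 1 (W (zeroVec k , v))) ≈ᴺ Γ d Q
        zeroes = gen-cong (allVecs d) λ v → cong (2 ℕ.*_) (≡.trans (cong (k ℕ.+ d ∸_) (gd v)) (ℕP.[m+n]∸[m+o]≡n∸o k d (gdeg (toPoly v) Q)))
          where
          gd : ∀ v → gdeg (toPoly (ψ (zeroVec k , v))) (s * Q) ≡ k ℕ.+ gdeg (toPoly v) Q
          gd v = gdeg-unique (Mon-* ms mQ)
            (gcd-resp (sym (trans (toPoly-toVec (Lt-digits ms (zeroVec k , v))) (trans (+-congʳ {toPoly v * s} (toPoly-zero k)) (*-comm (toPoly v) s)))) refl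
               (gcd-scale s (proj₂ (gcd (toPoly v) Q))))
            (Mon-* ms (proj₁ (gcd-Mon (toPoly v) mQ)))
        nonzero : ∀ u → ¬ (u ≡ zeroVec k) → ∑ (allVecs d) (λ v → monoᴺ 1 (W (u , v))) ≈ᴺ monoᴺ (2 ℕ.^ d) (2 ℕ.* (k ℕ.+ d))
        nonzero u ne = ≈-trans (gen-cong (allVecs d) λ v → cong (λ g → 2 ℕ.* (k ℕ.+ d ∸ g)) (gd v (irr-coprime irr ms (toPoly (ψ (u , v))))))
          (≈-trans (∑-mono (allVecs d) 1 _) (≡⇒≈ (cong (λ a → monoᴺ a (2 ℕ.* (k ℕ.+ d))) (≡.trans (ℕP.*-identityʳ _) (length-allVecs d)))))
          where
          gd : ∀ v → Coprime (toPoly (ψ (u , v))) s ⊎ s ∣ toPoly (ψ (u , v)) → gdeg (toPoly (ψ (u , v))) (s * Q) ≡ 0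
          gd v (inj₁ c) = gdeg-unique (Mon-* ms mQ) (coprime⇒gcd (coprime-^ (suc J) c)) Mon-one
          gd v (inj₂ (q , e)) = ⊥-elim (ne (toPoly-injective (trans (∣-small ms (Lt-toPoly u) (q + toPoly v ,
             trans (distribʳ s q (toPoly v)) (trans (+-congʳ {toPoly v * s} (trans e (toPoly-toVec (Lt-digits ms (u , v)))))
               (solve 2 (λ u w → (u :+ w) :+ w := u) refl (toPoly u) (toPoly v * s))))) (sym (toPoly-zero k)))))

    Γ-power : ∀ J → Γ (J ℕ.* k) (s ^₂ J) ≈ᴺ (1 ∷ []) +ᴺ sumᴺ J (λ j → monoᴺ (2 ℕ.^ (j ℕ.* k) ∸ 2 ℕ.^ ((j ∸ 1) ℕ.* k)) (2 ℕ.* (j ℕ.* k)))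
    Γ-power zero    = Γ-one
    Γ-power (suc J) = ≈-trans (step J) (≈-trans (+ᴺ-cong (Γ-power J) ≈-refl) (+ᴺ-assoc (1 ∷ []) (sumᴺ J (powers J)) (powers J (suc J))))

  Γ-tower : ∀ v {rs K S} → Tower (2 ℕ.^ v) rs K S → Γ K S ≈ᴺ prodᴺ (map (Gpoly v) rs)
  Γ-tower v []                          = Γ-one
  Γ-tower v (cons {r} k s irr m dr c T) = ≈-trans (Γ-coprime (Mon-^ N m) (Tower-Mon T) c)
    (*ᴺ-cong (≈-trans (Γ-power irr m N) (+ᴺ-cong (≈-refl {1 ∷ []}) (sumᴺ-cong N (λ j → ≡⇒≈ (term (suc j)))))) (Γ-tower v T))
    where
    N = 2 ℕ.^ v
    double : ∀ j → j ℕ.* (k ℕ.+ k) ≡ (j ℕ.* k) ℕ.* 2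
    double j = lem j k
      where
      lem : ∀ j k → j ℕ.* (k ℕ.+ k) ≡ (j ℕ.* k) ℕ.* 2
      lem = solve-∀
    halve : ∀ j → j ℕ.* deg r ℕD./ 2 ≡ j ℕ.* k
    halve j = ≡.trans (cong (λ d → j ℕ.* d ℕD./ 2) dr) (≡.trans (cong (ℕD._/ 2) (double j)) (ℕD.m*n/n≡m (j ℕ.* k) 2))
    term : ∀ j → monoᴺ (2 ℕ.^ (j ℕ.* k) ∸ 2 ℕ.^ ((j ∸ 1) ℕ.* k)) (2 ℕ.* (j ℕ.* k)) ≡
                 monoᴺ (2 ℕ.^ (j ℕ.* deg r ℕD./ 2) ∸ 2 ℕ.^ ((j ∸ 1) ℕ.* deg r ℕD./ 2)) (j ℕ.* deg r)
    term j = cong₂ monoᴺ (≡.sym (cong₂ (λ a b → 2 ℕ.^ a ∸ 2 ℕ.^ b) (halve j) (halve (j ∸ 1))))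
      (≡.sym (≡.trans (cong (j ℕ.*_) dr) (≡.trans (double j) (ℕP.*-comm (j ℕ.* k) 2))))

  irreducible-X : Irreducible X
  irreducible-X = s≤s z≤n , λ g h e → go g h (≈₂⇒≋ e)
    where
    go : ∀ g h → g * h ≋ X → deg g ≡ 0 ⊎ deg h ≡ 0
    go g h e with factor-Mon {g} {h} e (Mon-X^ 1)
    ... | zero  , j , mg , mh , _ = inj₁ (Mon-deg mg)
    ... | suc zero , zero , mg , mh , _ = inj₂ (Mon-deg mh)

  -- The case s = y, k = 1 of `Γ-power`, where 2^j - 2^(j-1) collapses to 2^(j-1).
  Γ-X^ : ∀ J → Γ J (X^ J) ≈ᴺ Apoly J
  Γ-X^ J = ≈-trans (Γ-resp (Mon-X^ J) (sym (X^≋ J))) (≈-trans (≈-trans (≡⇒≈ (cong (λ i → Γ i (X ^₂ J)) (≡.sym (ℕP.*-identityʳ J)))) (Γ-power irreducible-X (Mon-X^ 1) J))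
    (+ᴺ-cong (≈-refl {1 ∷ []}) (sumᴺ-cong J (λ j → ≡⇒≈ (term j)))))
    where
    pow : ∀ j → 2 ℕ.^ suc j ∸ 2 ℕ.^ j ≡ 2 ℕ.^ j
    pow j = ≡.trans (cong (λ a → 2 ℕ.^ j ℕ.+ a ∸ 2 ℕ.^ j) (ℕP.+-identityʳ (2 ℕ.^ j))) (ℕP.m+n∸m≡n (2 ℕ.^ j) (2 ℕ.^ j))
    term : ∀ j → monoᴺ (2 ℕ.^ (suc j ℕ.* 1) ∸ 2 ℕ.^ (j ℕ.* 1)) (2 ℕ.* (suc j ℕ.* 1)) ≡ monoᴺ (2 ℕ.^ j) (2 ℕ.* suc j)
    term j rewrite ℕP.*-identityʳ j = cong (λ a → monoᴺ a (2 ℕ.* suc j)) (pow j)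

  module _ {K : ℕ} {S : Poly₂} (mS : Mon K S) (cop : Coprime X S) where

    Γ-X^* : ∀ e → Γ (e ℕ.+ K) (X^ e * S) ≈ᴺ Apoly e *ᴺ Γ K S
    Γ-X^* e = ≈-trans (Γ-coprime (Mon-X^ e) mS (coprime-resp (X^≋ e) refl (coprime-sym (coprime-^ e (coprime-sym cop))))) (*ᴺ-congˡ (Γ K S) (Γ-X^ e))

    -- X is a unit modulo S, so B ↦ c + X B permutes the residues modulo S.
    gen-shifted : ∀ e e' c → gen (allVecs (e' ℕ.+ K)) (λ B → 2 ℕ.* (e ℕ.+ K ∸ gdeg (c + X * toPoly B) S)) ≈ᴺ
                             monoᴺ (2 ℕ.^ e') (2 ℕ.* e) *ᴺ Γ K S
    gen-shifted e e' c = ≈-trans (∑-pairs K e' (e' ℕ.+ K) (ℕP.+-comm K e') ψ ψ-injective _)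
      (≈-trans (gen-cong (pairs K e') weights) (≈-trans (∑-× (allVecs K) (allVecs e') _)
      -- The quotient digits `v` do not change the gcd with S, so each residue `u` is counted 2^e'
      -- times.
      (≈-trans (∑-cong (allVecs K) (λ u → ≈-trans (∑-mono (allVecs e') 1 _)
         (≈-trans (≡⇒≈ (cong (λ a → monoᴺ a (2 ℕ.* e ℕ.+ weight K S (toPoly u))) (cong (ℕ._* 1) (length-allVecs e'))))
            (≈-sym (mono-* (2 ℕ.^ e') (2 ℕ.* e) 1 _)))))
        (≈-sym (∑-*ˡ (allVecs K) _ (monoᴺ (2 ℕ.^ e') (2 ℕ.* e)))))))
      where
      x' = proj₁ cop
      s' = proj₁ (proj₂ cop)
      q = proj₁ (divMod mS (x' * c))
      -- The residue of c/X modulo S. Adding it makes c + X B congruent to X u, and its degree below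
      -- K keeps the shifted polynomial within the available coefficients.
      c' : Poly₂
      c' = x' * c + q * S
      shifted : Vec Bool K × Vec Bool e' → Poly₂
      shifted x = digits mS x + c'
      Lt-shifted : ∀ x → Lt (e' ℕ.+ K) (shifted x)
      Lt-shifted x = Lt-+ (subst (λ n → Lt n (digits mS x)) (ℕP.+-comm K e') (Lt-digits mS x)) (Lt-mono (ℕP.m≤n+m K e') (proj₂ (divMod mS (x' * c))))
      ψ : Vec Bool K × Vec Bool e' → Vec Bool (e' ℕ.+ K)
      ψ x = toVec (e' ℕ.+ K) (shifted x)
      ψ-injective : ∀ {x y} → ψ x ≡ ψ y → x ≡ y
      ψ-injective {x} {y} eq = digits-injective mS (trans (cancel (digits mS x)) (trans
        (+-congʳ {c'} (toVec-injective (Lt-shifted x) (Lt-shifted y) eq)) (sym (cancel (digits mS y)))))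
        where
        cancel : ∀ a → a ≋ (a + c') + c'
        cancel a = solve 2 (λ a c → a := (a :+ c) :+ c) refl a c'
      weights : ∀ x → 2 ℕ.* (e ℕ.+ K ∸ gdeg (c + X * toPoly (ψ x)) S) ≡ 2 ℕ.* e ℕ.+ weight K S (toPoly (proj₁ x))
      weights (u , v) = ≡.trans (cong (λ g → 2 ℕ.* (e ℕ.+ K ∸ g)) gd)
        (≡.trans (cong (2 ℕ.*_) (ℕP.+-∸-assoc e (proj₂ (gcd-Mon U mS)))) (ℕP.*-distribˡ-+ 2 e _))
        where
        U = toPoly u
        V = toPoly v
        G = gcd (X * U) S
        g : Poly₂
        g = proj₁ G
        GU : IsGcd g U S
        GU = gcd-unit cop (proj₂ G)
        congr : X * U + (s' * c + X * q + X * V) * S ≋ c + X * toPoly (ψ (u , v))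
        congr = sym (trans (+-congˡ {c} (*-congˡ {X} (toPoly-toVec (Lt-shifted (u , v)))))
          (trans (solve 8 (λ c x u v s x' q s' → c :+ x :* ((u :+ v :* s) :+ (x' :* c :+ q :* s)) :=
                   (x :* u :+ (s' :* c :+ x :* q :+ x :* v) :* s) :+ c :* ((x' :* x :+ s' :* s) :+ con true)) refl c X U V S x' q s')
            (trans (+-congˡ {Z} (trans (*-congˡ {c} (≈⇒+≈0 (proj₂ (proj₂ cop)))) (zeroʳ c))) (+-identityʳ Z))))
          where
          Z = X * U + (s' * c + X * q + X * V) * S
        Mg : Mon (gdeg U S) g
        Mg = subst (λ d → Mon d g) (≡.sym (gdeg-unique mS GU mg)) mg
          where mg = proj₁ (gcd-Mon (X * U) mS)
        gd : gdeg (c + X * toPoly (ψ (u , v))) S ≡ gdeg U S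
        gd = gdeg-unique mS (gcd-resp congr refl (gcd-addmul (s' * c + X * q + X * V) (proj₂ G))) Mg

-- Finite fields of characteristic 2, additive operators and the sizes of their kernels.

module FieldActions where

  open import Level using (0ℓ)
  open FiniteSums
  open CharacteristicTwo
  private module P = BinaryPolynomials
  open P using (_≋_; Mon; X; X^)
  open import Algebra.Bundles using (CommutativeRing; CommutativeMonoid)
  open import Data.Bool using (true; false; _xor_)
  open import Data.Nat as ℕ using (ℕ; zero; suc; z≤n)
  import Data.Nat.Properties as ℕP
  open import Data.List using (List; []; _∷_; length)
  open import Data.List.Membership.Propositional using (find; lose)
  open import Data.List.Relation.Unary.Any using (any?)
  open import Data.Product using (∃; ∃₂; _×_; _,_)
  open import Data.Sum using (_⊎_; inj₁; inj₂)
  open import Data.Empty using (⊥-elim)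
  open import Relation.Nullary using (¬_; Dec; yes; no)
  open import Relation.Nullary.Decidable using (_×-dec_; ¬?)
  open import Relation.Binary.PropositionalEquality using (_≡_; refl; sym; trans; cong; cong₂; module ≡-Reasoning)

  ℕ+ : CommutativeMonoid 0ℓ 0ℓ
  ℕ+ = ℕP.+-0-commutativeMonoid

  open Sum ℕ+ using () renaming (∑ to ∑ℕ; ∑-cong to ∑ℕ-cong; ∑-δ to ∑ℕ-δ; ∑-swap to ∑ℕ-swap; ∑-inj to ∑ℕ-inj; ∑-∙ to ∑ℕ-+) public

  module _ {A : Set} where
    ∑ℕ-≤ : (xs : List A) {f g : A → ℕ} → (∀ x → f x ℕ.≤ g x) → ∑ℕ xs f ℕ.≤ ∑ℕ xs g
    ∑ℕ-≤ []       h = z≤n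
    ∑ℕ-≤ (x ∷ xs) h = ℕP.+-mono-≤ (h x) (∑ℕ-≤ xs h)

    ∑ℕ-*ˡ : (xs : List A) (c : ℕ) (f : A → ℕ) → ∑ℕ xs (λ x → c ℕ.* f x) ≡ c ℕ.* ∑ℕ xs f
    ∑ℕ-*ˡ []       c f = sym (ℕP.*-zeroʳ c)
    ∑ℕ-*ˡ (x ∷ xs) c f = trans (cong (c ℕ.* f x ℕ.+_) (∑ℕ-*ˡ xs c f)) (sym (ℕP.*-distribˡ-+ c (f x) _))

    ∑ℕ-1 : (xs : List A) → ∑ℕ xs (λ _ → 1) ≡ length xs
    ∑ℕ-1 []       = refl
    ∑ℕ-1 (x ∷ xs) = cong suc (∑ℕ-1 xs)

  module FieldTheory {n : ℕ} (F : FiniteField n) where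

    open FiniteField F using (_≟_; isCommutativeRing; 0≢1; inverse; elements; complete; unique; size)
    open FieldOps F public using (pow; sumF; emb; Tr; Trsub)

    fieldRing : CommutativeRing 0ℓ 0ℓ
    fieldRing = record { isCommutativeRing = isCommutativeRing }

    open CommutativeRing fieldRing public using
      (Carrier; _+_; _*_; 0#; 1#; +-comm; +-assoc; *-comm; *-assoc; +-identityˡ; +-identityʳ;
       *-identityˡ; *-identityʳ; zeroˡ; zeroʳ; distribˡ; distribʳ)
    open CommutativeRing fieldRing using (+-commutativeMonoid; *-commutativeMonoid; -_; -‿inverseʳ; semiring)

    no-zero-divisors : ∀ {x y} → x * y ≡ 0# → x ≡ 0# ⊎ y ≡ 0#
    no-zero-divisors {x} {y} e with x ≟ 0#
    ... | yes p = inj₁ p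
    ... | no ¬p with inverse x ¬p
    ... | x' , xx' = inj₂ (trans (sym (*-identityˡ y)) (trans (cong (_* y) (trans (sym xx') (*-comm x x')))
            (trans (*-assoc x' x y) (trans (cong (x' *_) e) (zeroʳ x')))))

    private
      open Sum +-commutativeMonoid using () renaming (∑ to ∑F; ∑-inj to ∑F-inj; ∑-∙ to ∑F-+)
      open Sum *-commutativeMonoid using () renaming (∑ to ∏; ∑-inj to ∏-inj; ∑-∙ to ∏-*; ∑-cong to ∏-cong; ∑-δ to ∏-δ)
      open import Algebra.Properties.Semiring.Mult semiring using (×1-homo-*) renaming (_×_ to _·_)

      +-cancelʳ : ∀ {x y z} → x + z ≡ y + z → x ≡ y
      +-cancelʳ {x} {y} {z} e = trans (lem x) (trans (cong (_+ (- z)) e) (sym (lem y)))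
        where
        lem : ∀ x → x ≡ (x + z) + (- z)
        lem x = sym (trans (+-assoc x z (- z)) (trans (cong (x +_) (-‿inverseʳ z)) (+-identityʳ x)))

      ∑F-1 : (xs : List Carrier) → ∑F xs (λ _ → 1#) ≡ length xs · 1#
      ∑F-1 []       = refl
      ∑F-1 (x ∷ xs) = cong (1# +_) (∑F-1 xs)

      -- Translating by 1 permutes F, so Σ x = Σ (x + 1) and therefore |F| · 1 = 0.
      size·1 : (2 ℕ.^ n) · 1# ≡ 0#
      size·1 = trans (cong (_· 1#) (sym size)) (trans (sym (∑F-1 elements)) (+-cancelʳ (trans (+-comm _ S) (trans (sym (∑F-+ elements (λ x → x) (λ _ → 1#)))
        (trans (∑F-inj (_+ 1#) +-cancelʳ unique complete ℕP.≤-refl (λ x → x)) (sym (+-identityˡ S)))))))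
        where S = ∑F elements (λ x → x)

    -- A field has no zero divisors, so the relation 2^n · 1 = 0 can be reduced factor by factor;
    -- exponent 0 would give 1 = 0.
    char2 : 1# + 1# ≡ 0#
    char2 = go n size·1
      where
      go : ∀ k → (2 ℕ.^ k) · 1# ≡ 0# → 1# + 1# ≡ 0#
      go zero    e = ⊥-elim (0≢1 (sym (trans (sym (+-identityʳ 1#)) e)))
      go (suc k) e with no-zero-divisors (trans (sym (×1-homo-* 2 (2 ℕ.^ k))) e)
      ... | inj₁ z = trans (cong (1# +_) (sym (+-identityʳ 1#))) z
      ... | inj₂ z = go k z

    open Char2Ring fieldRing char2 public using (solve; _:=_; con; _:+_; _:*_; x+x; +≈0⇒≈; ≈⇒+≈0)

    *-cancelˡ : ∀ {a x y} → ¬ (a ≡ 0#) → a * x ≡ a * y → x ≡ y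
    *-cancelˡ {a} {x} {y} a≢0 e with no-zero-divisors {a} {x + y} (trans (distribˡ a x y) (≈⇒+≈0 e))
    ... | inj₁ z = ⊥-elim (a≢0 z)
    ... | inj₂ z = +≈0⇒≈ z

    +-cancelˡ : ∀ {a x y} → a + x ≡ a + y → x ≡ y
    +-cancelˡ {a} {x} {y} e = trans (solve 2 (λ a x → x := a :+ (a :+ x)) refl a x) (trans (cong (a +_) e) (solve 2 (λ a x → a :+ (a :+ x) := x) refl a y))

    private
      ∏-const : ∀ x (ys : List Carrier) → ∏ ys (λ _ → x) ≡ pow x (length ys)
      ∏-const x []       = refl
      ∏-const x (y ∷ ys) = cong (x *_) (∏-const x ys)

      ∏-nonzero : (ys : List Carrier) (f : Carrier → Carrier) → (∀ y → ¬ (f y ≡ 0#)) → ¬ (∏ ys f ≡ 0#)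
      ∏-nonzero []       f nz e = 0≢1 (sym e)
      ∏-nonzero (y ∷ ys) f nz e with no-zero-divisors e
      ... | inj₁ z = nz y z
      ... | inj₂ z = ∏-nonzero ys f nz z

      -- Products run over all of F, including 0. Splitting the constant x into its part off 0 and
      -- its part at 0 separates x^(2^n) into x^(2^n - 1), which equals 1, and one more x.
      unless0 : Carrier → Carrier → Carrier → Carrier
      unless0 y a b with y ≟ 0#
      ... | yes _ = b
      ... | no  _ = a

    -- Multiplication by x ≠ 0 permutes F; compare the products of the nonzero elements.
    pow-size : ∀ x → pow x (2 ℕ.^ n) ≡ x
    pow-size x with x ≟ 0#
    ... | yes refl = zero-pow (2 ℕ.^ n) (ℕP.m^n>0 2 n)
      where
      zero-pow : ∀ k → 0 ℕ.< k → pow 0# k ≡ 0#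
      zero-pow (suc k) _ = zeroˡ _
    ... | no x≢0 = begin
      pow x (2 ℕ.^ n) ≡⟨ cong (pow x) (sym size) ⟩
      pow x (length elements) ≡⟨ sym (∏-const x elements) ⟩
      ∏ elements (λ _ → x) ≡⟨ ∏-cong elements split ⟩
      ∏ elements (λ y → unless0 y x 1# * unless0 y 1# x) ≡⟨ ∏-* elements (λ y → unless0 y x 1#) (λ y → unless0 y 1# x) ⟩
      ∏ elements (λ y → unless0 y x 1#) * ∏ elements (λ y → unless0 y 1# x) ≡⟨ cong₂ _*_ h≡1 k≡x ⟩
      1# * x ≡⟨ *-identityˡ x ⟩
      x ∎
      where
      open ≡-Reasoning
      g : Carrier → Carrier
      g y = unless0 y y 1#
      split : ∀ y → x ≡ unless0 y x 1# * unless0 y 1# x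
      split y with y ≟ 0#
      ... | yes _ = sym (*-identityˡ x)
      ... | no  _ = sym (*-identityʳ x)
      g≢0 : ∀ y → ¬ (g y ≡ 0#)
      g≢0 y e with y ≟ 0#
      ... | yes _ = 0≢1 (sym e)
      ... | no ¬p = ¬p e
      g-* : ∀ y → g (x * y) ≡ unless0 y x 1# * g y
      g-* y with y ≟ 0# | (x * y) ≟ 0#
      ... | yes _    | yes _ = sym (*-identityˡ 1#)
      ... | yes refl | no ¬q = ⊥-elim (¬q (zeroʳ x))
      ... | no ¬p    | yes q with no-zero-divisors q
      ...   | inj₁ z = ⊥-elim (x≢0 z)
      ...   | inj₂ z = ⊥-elim (¬p z)
      g-* y | no _   | no _ = refl
      h≡1 : ∏ elements (λ y → unless0 y x 1#) ≡ 1#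
      h≡1 = *-cancelˡ (∏-nonzero elements g g≢0) (trans (*-comm (∏ elements g) _) (trans (sym (∏-* elements _ g)) (trans
        (∏-cong elements (λ y → sym (g-* y))) (trans (∏-inj (x *_) (*-cancelˡ x≢0) unique complete ℕP.≤-refl g) (sym (*-identityʳ _))))))
      k≡x : ∏ elements (λ y → unless0 y 1# x) ≡ x
      k≡x = trans (∏-δ (λ y → unless0 y 1# x) unique (complete 0#) at-nonzero) at-zero
        where
        at-nonzero : ∀ y → ¬ (y ≡ 0#) → unless0 y 1# x ≡ 1#
        at-nonzero y ne with y ≟ 0#
        ... | yes p = ⊥-elim (ne p)
        ... | no  _ = refl
        at-zero : unless0 0# 1# x ≡ x
        at-zero with 0# ≟ 0#
        ... | yes _ = refl
        ... | no ¬p = ⊥-elim (¬p refl)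

    σ : Carrier → Carrier
    σ z = z * z

    σ^ : ℕ → Carrier → Carrier
    σ^ zero    z = z
    σ^ (suc k) z = σ (σ^ k z)

    Additive : (Carrier → Carrier) → Set
    Additive T = ∀ x y → T (x + y) ≡ T x + T y

    additive-0 : ∀ {T} → Additive T → T 0# ≡ 0#
    additive-0 {T} add = +-cancelˡ {T 0#} (trans (sym (add 0# 0#)) (trans (cong T (+-identityʳ 0#)) (sym (+-identityʳ _))))

    σ-add : Additive σ
    σ-add = solve 2 (λ x y → (x :+ y) :* (x :+ y) := x :* x :+ y :* y) refl

    σ-* : ∀ x y → σ (x * y) ≡ σ x * σ y
    σ-* = solve 2 (λ x y → (x :* y) :* (x :* y) := (x :* x) :* (y :* y)) refl

    σ-injective : ∀ {x y} → σ x ≡ σ y → x ≡ y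
    σ-injective {x} {y} e with no-zero-divisors {x + y} {x + y} (trans (σ-add x y) (≈⇒+≈0 e))
    ... | inj₁ z = +≈0⇒≈ z
    ... | inj₂ z = +≈0⇒≈ z

    σ^-add : ∀ k → Additive (σ^ k)
    σ^-add zero    x y = refl
    σ^-add (suc k) x y = trans (cong σ (σ^-add k x y)) (σ-add _ _)

    σ^-* : ∀ k x y → σ^ k (x * y) ≡ σ^ k x * σ^ k y
    σ^-* zero    x y = refl
    σ^-* (suc k) x y = trans (cong σ (σ^-* k x y)) (σ-* _ _)

    σ^-0 : ∀ k → σ^ k 0# ≡ 0#
    σ^-0 k = additive-0 (σ^-add k)

    σ^-injective : ∀ k {x y} → σ^ k x ≡ σ^ k y → x ≡ y
    σ^-injective zero    e = e
    σ^-injective (suc k) e = σ^-injective k (σ-injective e)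

    σ^-+ : ∀ j k z → σ^ (j ℕ.+ k) z ≡ σ^ j (σ^ k z)
    σ^-+ zero    k z = refl
    σ^-+ (suc j) k z = cong σ (σ^-+ j k z)

    σ^-suc : ∀ k z → σ^ k (σ z) ≡ σ (σ^ k z)
    σ^-suc k z = trans (sym (σ^-+ k 1 z)) (cong (λ i → σ^ i z) (ℕP.+-comm k 1))

    pow-+ : ∀ x a b → pow x (a ℕ.+ b) ≡ pow x a * pow x b
    pow-+ x zero    b = sym (*-identityˡ _)
    pow-+ x (suc a) b = trans (cong (x *_) (pow-+ x a b)) (sym (*-assoc x _ _))

    pow-2^ : ∀ x k → pow x (2 ℕ.^ k) ≡ σ^ k x
    pow-2^ x zero    = *-identityʳ x
    pow-2^ x (suc k) = trans (pow-+ x (2 ℕ.^ k) (2 ℕ.^ k ℕ.+ 0)) (cong₂ _*_ (pow-2^ x k) (trans (cong (pow x) (ℕP.+-identityʳ (2 ℕ.^ k))) (pow-2^ x k)))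

    pow-2^+1 : ∀ x k → pow x (2 ℕ.^ k ℕ.+ 1) ≡ σ^ k x * x
    pow-2^+1 x k = trans (pow-+ x (2 ℕ.^ k) 1) (cong₂ _*_ (pow-2^ x k) (*-identityʳ x))

    σ^n : ∀ z → σ^ n z ≡ z
    σ^n z = trans (sym (pow-2^ z n)) (pow-size z)

    emb-xor : ∀ c d → emb (c xor d) ≡ emb c + emb d
    emb-xor true  true  = sym char2
    emb-xor true  false = sym (+-identityʳ _)
    emb-xor false d     = sym (+-identityˡ _)

    -- ev T f z = f(T) z for an additive operator T

    ev : (Carrier → Carrier) → Poly₂ → Carrier → Carrier
    ev T []      z = 0#
    ev T (c ∷ f) z = emb c * z + T (ev T f z)

    -- Any additive T makes F a module over F₂[x]. The construction is used twice, for σ and for Y =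
    -- σ + σ⁻¹.
    module Action {T : Carrier → Carrier} (T-add : Additive T) where
      T-0 : T 0# ≡ 0#
      T-0 = additive-0 T-add

      T-emb : ∀ {S} → Additive S → ∀ c z → S (emb c * z) ≡ emb c * S z
      T-emb {S} add true  z = trans (cong S (*-identityˡ z)) (sym (*-identityˡ _))
      T-emb {S} add false z = trans (cong S (zeroˡ z)) (trans (additive-0 add) (sym (zeroˡ _)))

      ev-+ : ∀ f g z → ev T (f +₂ g) z ≡ ev T f z + ev T g z
      ev-+ []      g       z = sym (+-identityˡ _)
      ev-+ (c ∷ f) []      z = sym (+-identityʳ _)
      ev-+ (c ∷ f) (d ∷ g) z = trans (cong₂ _+_ (cong (_* z) (emb-xor c d)) (trans (cong T (ev-+ f g z)) (T-add _ _)))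
        (solve 5 (λ c d z a b → (c :+ d) :* z :+ (a :+ b) := (c :* z :+ a) :+ (d :* z :+ b)) refl (emb c) (emb d) z (T (ev T f z)) (T (ev T g z)))

      ev-zero : ∀ {f} → f ≋ [] → ∀ z → ev T f z ≡ 0#
      ev-zero {[]}    e z = refl
      ev-zero {c ∷ f} e z rewrite P.at e 0 = trans (cong₂ _+_ (zeroˡ z) (trans (cong T (ev-zero {f} (P.mk≋ λ k → P.at e (suc k)) z)) T-0)) (+-identityʳ 0#)

      ev-cong : ∀ {f g} → f ≋ g → ∀ z → ev T f z ≡ ev T g z
      ev-cong {f} {g} e z = +≈0⇒≈ (trans (sym (ev-+ f g z)) (ev-zero (P.≈⇒+≈0 e) z))

      ev-scale : ∀ c f z → ev T (scale₂ c f) z ≡ emb c * ev T f z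
      ev-scale true  f z = trans (ev-cong (P.scale-true f) z) (sym (*-identityˡ _))
      ev-scale false f z = trans (ev-zero (P.scale-false f) z) (sym (zeroˡ _))

      ev-add : ∀ f → Additive (ev T f)
      ev-add []      x y = sym (+-identityʳ 0#)
      ev-add (c ∷ f) x y = trans (cong (emb c * (x + y) +_) (trans (cong T (ev-add f x y)) (T-add _ _)))
        (solve 5 (λ c x y a b → c :* (x :+ y) :+ (a :+ b) := (c :* x :+ a) :+ (c :* y :+ b)) refl (emb c) x y (T (ev T f x)) (T (ev T f y)))

      ev-* : ∀ f g z → ev T (f *₂ g) z ≡ ev T f (ev T g z)
      ev-* []      g z = refl
      ev-* (c ∷ f) g z = trans (ev-+ (scale₂ c g) _ z) (cong₂ _+_ (ev-scale c g z)
        (trans (cong (_+ T (ev T (f *₂ g) z)) (zeroˡ z)) (trans (+-identityˡ _) (cong T (ev-* f g z)))))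

      ev-0 : ∀ f → ev T f 0# ≡ 0#
      ev-0 f = additive-0 (ev-add f)

      ev-commute : ∀ {S} → Additive S → (∀ z → S (T z) ≡ T (S z)) → ∀ f z → S (ev T f z) ≡ ev T f (S z)
      ev-commute add com []      z = additive-0 add
      ev-commute add com (c ∷ f) z = trans (add _ _) (cong₂ _+_ (T-emb add c z) (trans (com _) (cong T (ev-commute add com f z))))

      ev-const : ∀ c z → ev T (c ∷ []) z ≡ emb c * z
      ev-const c z = trans (cong (emb c * z +_) T-0) (+-identityʳ _)

      ev-one : ∀ z → ev T one₂ z ≡ z
      ev-one z = trans (ev-const true z) (*-identityˡ z)

      ev-X : ∀ z → ev T X z ≡ T z
      ev-X z = trans (cong₂ _+_ (zeroˡ z) (cong T (ev-one z))) (+-identityˡ _)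

      ev-X* : ∀ f z → ev T (X *₂ f) z ≡ T (ev T f z)
      ev-X* f z = trans (ev-* X f z) (ev-X _)

    -- A numerical indicator lets kernel sizes be manipulated as double sums, without listing
    -- kernels.
    isz : Carrier → ℕ
    isz x with x ≟ 0#
    ... | yes _ = 1
    ... | no  _ = 0

    isz-0 : ∀ {x} → x ≡ 0# → isz x ≡ 1
    isz-0 {x} e with x ≟ 0#
    ... | yes _ = refl
    ... | no ¬p = ⊥-elim (¬p e)

    isz-≢ : ∀ {x} → ¬ (x ≡ 0#) → isz x ≡ 0
    isz-≢ {x} e with x ≟ 0#
    ... | yes p = ⊥-elim (e p)
    ... | no  _ = refl

    isz-≤ : ∀ {x y} → (x ≡ 0# → y ≡ 0#) → isz x ℕ.≤ isz y
    isz-≤ {x} h with x ≟ 0#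
    ... | yes p = ℕP.≤-reflexive (sym (isz-0 (h p)))
    ... | no  _ = z≤n

    isz-cong : ∀ {x y} → (x ≡ 0# → y ≡ 0#) → (y ≡ 0# → x ≡ 0#) → isz x ≡ isz y
    isz-cong h k = ℕP.≤-antisym (isz-≤ h) (isz-≤ k)

    ∣ker_∣ : (Carrier → Carrier) → ℕ
    ∣ker T ∣ = ∑ℕ elements (λ z → isz (T z))

    ker-cong : ∀ {S T} → (∀ z → S z ≡ 0# → T z ≡ 0#) → (∀ z → T z ≡ 0# → S z ≡ 0#) → ∣ker S ∣ ≡ ∣ker T ∣
    ker-cong h k = ∑ℕ-cong elements (λ z → isz-cong (h z) (k z))

    shift : ∀ a (f : Carrier → ℕ) → ∑ℕ elements (λ z → f (a + z)) ≡ ∑ℕ elements f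
    shift a = ∑ℕ-inj (a +_) +-cancelˡ unique complete ℕP.≤-refl

    search : {Q : Carrier → Set} → (∀ z → Dec (Q z)) → Dec (∃ Q)
    search dec with any? dec elements
    ... | yes a = yes (let z , _ , q = find a in z , q)
    ... | no ¬a = no λ (z , q) → ¬a (lose (complete z) q)

    ∑-isz : ∀ a → ∑ℕ elements (λ z → isz (a + z)) ≡ 1
    ∑-isz a = trans (∑ℕ-δ (λ z → isz (a + z)) unique (complete a) (λ z ne → isz-≢ (λ e → ne (sym (+≈0⇒≈ e))))) (isz-0 (x+x a))

    -- A fibre is either empty or a translate of the kernel; in characteristic 2 the condition T z =
    -- w reads w + T z = 0.
    fibre : ∀ {T} → Additive T → ∀ w → ∑ℕ elements (λ z → isz (w + T z)) ℕ.≤ ∣ker T ∣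
    fibre {T} add w with search (λ z → (w + T z) ≟ 0#)
    ... | yes (z₀ , e) = ℕP.≤-reflexive (trans (∑ℕ-cong elements (λ z → cong isz (trans (cong (_+ T z) (+≈0⇒≈ e)) (sym (add z₀ z)))))
            (shift z₀ (λ z → isz (T z))))
    ... | no ¬e = ℕP.≤-trans (∑ℕ-≤ elements (λ z → ℕP.≤-reflexive (isz-≢ (λ e → ¬e (z , e)))))
            (ℕP.≤-trans (ℕP.≤-reflexive (Sum.∑-ε ℕ+ elements)) z≤n)

    -- Group the z by the value w = T z and bound each fibre. With f the indicator of ker M this
    -- gives |ker (M ∘ T)| ≤ |ker T| |ker M|.
    pushforward : ∀ {T} → Additive T → (f : Carrier → ℕ) → ∑ℕ elements (λ z → f (T z)) ℕ.≤ ∣ker T ∣ ℕ.* ∑ℕ elements f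
    pushforward {T} add f = begin
      ∑ℕ elements (λ z → f (T z)) ≡⟨ ∑ℕ-cong elements (λ z → sym (delta z)) ⟩
      ∑ℕ elements (λ z → ∑ℕ elements (λ w → f w ℕ.* isz (w + T z))) ≡⟨ ∑ℕ-swap elements elements _ ⟩
      ∑ℕ elements (λ w → ∑ℕ elements (λ z → f w ℕ.* isz (w + T z))) ≡⟨ ∑ℕ-cong elements (λ w → ∑ℕ-*ˡ elements (f w) _) ⟩
      ∑ℕ elements (λ w → f w ℕ.* ∑ℕ elements (λ z → isz (w + T z))) ≤⟨ ∑ℕ-≤ elements (λ w → ℕP.*-monoʳ-≤ (f w) (fibre add w)) ⟩
      ∑ℕ elements (λ w → f w ℕ.* ∣ker T ∣) ≡⟨ ∑ℕ-cong elements (λ w → ℕP.*-comm (f w) _) ⟩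
      ∑ℕ elements (λ w → ∣ker T ∣ ℕ.* f w) ≡⟨ ∑ℕ-*ˡ elements ∣ker T ∣ f ⟩
      ∣ker T ∣ ℕ.* ∑ℕ elements f ∎
      where
      open ℕP.≤-Reasoning
      delta : ∀ z → ∑ℕ elements (λ w → f w ℕ.* isz (w + T z)) ≡ f (T z)
      delta z = trans (∑ℕ-δ (λ w → f w ℕ.* isz (w + T z)) unique (complete (T z))
          (λ w ne → trans (cong (f w ℕ.*_) (isz-≢ (λ e → ne (+≈0⇒≈ e)))) (ℕP.*-zeroʳ (f w))))
        (trans (cong (f (T z) ℕ.*_) (isz-0 (x+x (T z)))) (ℕP.*-identityʳ _))

    -- Monic linearised polynomials: LinM D L says L(z) = z^(2^D) + lower terms c z^(2^i).

    LinM : ℕ → (Carrier → Carrier) → Set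
    LinM zero    L = ∀ z → L z ≡ z
    LinM (suc D) L = ∃₂ λ L' c → LinM D L' × (∀ z → L z ≡ σ (L' z) + c * z)

    LinM-0 : ∀ D {L} → LinM D L → L 0# ≡ 0#
    LinM-0 zero    l = l 0#
    LinM-0 (suc D) (L' , c , l , eq) = trans (eq 0#) (trans (cong₂ _+_ (trans (cong σ (LinM-0 D l)) (zeroʳ 0#)) (zeroʳ c)) (+-identityʳ 0#))

    -- Right division by the operator z ↦ z² + b z.
    LinM-divide : ∀ D {L} b → LinM (suc D) L → ∃₂ λ M r → LinM D M × (∀ z → L z ≡ M (σ z + b * z) + r * z)
    LinM-divide zero b (L' , c , l , eq) = (λ z → z) , b + c , (λ z → refl) , λ z →
      trans (eq z) (trans (cong (λ w → σ w + c * z) (l z)) (solve 3 (λ b c z → z :* z :+ c :* z := (z :* z :+ b :* z) :+ (b :+ c) :* z) refl b c z))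
    LinM-divide (suc D) b (L' , c , l , eq) with LinM-divide D b l
    -- Squaring the old remainder gives (r' z)² = r'² (z² + b z) + r'² b z: the first part joins the
    -- quotient, the second the new remainder.
    ... | M' , r' , lM , eqM = (λ w → σ (M' w) + σ r' * w) , σ r' * b + c , (M' , σ r' , lM , λ z → refl) , λ z →
      trans (eq z) (trans (cong (λ w → σ w + c * z) (eqM z))
        (solve 5 (λ m r b c z → (m :+ r :* z) :* (m :+ r :* z) :+ c :* z :=
                                (m :* m :+ (r :* r) :* (z :* z :+ b :* z)) :+ ((r :* r) :* b :+ c) :* z) refl (M' (σ z + b * z)) r' b c z))

    -- Root bound by splitting off zeros. For a zero b ≠ 0, T z = z² + b z has only the zeros 0 and
    -- b; dividing L by T on the right leaves a remainder r z that vanishes at b, so r = 0, L = M ∘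
    -- T, and `pushforward` costs a factor 2.
    LinM-kernel : ∀ D {L} → LinM D L → ∣ker L ∣ ℕ.≤ 2 ℕ.^ D
    LinM-kernel zero {L} l = ℕP.≤-reflexive (trans (∑ℕ-cong elements (λ z → cong isz (trans (l z) (sym (+-identityˡ z))))) (∑-isz 0#))
    LinM-kernel (suc D) {L} l with search (λ z → ¬? (z ≟ 0#) ×-dec (L z ≟ 0#))
    ... | no none = ℕP.≤-trans (∑ℕ-≤ elements (λ z → isz-≤ {L z} {0# + z} (only-zero z))) (ℕP.≤-trans (ℕP.≤-reflexive (∑-isz 0#)) (ℕP.m^n>0 2 (suc D)))
      where
      only-zero : ∀ z → L z ≡ 0# → 0# + z ≡ 0#
      only-zero z e with z ≟ 0#
      ... | yes p = trans (+-identityˡ z) p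
      ... | no ¬p = ⊥-elim (none (z , ¬p , e))
    ... | yes (b , b≢0 , Lb) with LinM-divide D b l
    ... | M , r , lM , eq = begin
      ∣ker L ∣ ≡⟨ ∑ℕ-cong elements (λ z → cong isz (trans (eq z) (trans (cong (λ r → M (T z) + r * z) r≡0) (trans (cong (M (T z) +_) (zeroˡ z)) (+-identityʳ _))))) ⟩
      ∑ℕ elements (λ z → isz (M (T z))) ≤⟨ pushforward T-add (λ w → isz (M w)) ⟩
      ∣ker T ∣ ℕ.* ∣ker M ∣ ≤⟨ ℕP.*-mono-≤ ker-T (LinM-kernel D lM) ⟩
      2 ℕ.* 2 ℕ.^ D ∎
      where
      open ℕP.≤-Reasoning
      T : Carrier → Carrier
      T z = σ z + b * z
      T-add : Additive T
      T-add = solve 3 (λ b x y → (x :+ y) :* (x :+ y) :+ b :* (x :+ y) := (x :* x :+ b :* x) :+ (y :* y :+ b :* y)) refl b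
      r≡0 : r ≡ 0#
      r≡0 with no-zero-divisors {r} {b} (trans (sym (+-identityˡ _)) (trans (cong (_+ r * b) (sym (trans (cong M (x+x (b * b))) (LinM-0 D lM)))) (trans (sym (eq b)) Lb)))
      ... | inj₁ z = z
      ... | inj₂ z = ⊥-elim (b≢0 z)
      ker-T : ∣ker T ∣ ℕ.≤ 2
      ker-T = ℕP.≤-trans (∑ℕ-≤ elements (λ z → bound z)) (ℕP.≤-reflexive (trans (∑ℕ-+ elements (λ z → isz (0# + z)) (λ z → isz (b + z))) (cong₂ ℕ._+_ (∑-isz 0#) (∑-isz b))))
        where
        bound : ∀ z → isz (T z) ℕ.≤ isz (0# + z) ℕ.+ isz (b + z)
        bound z with T z ≟ 0#
        ... | no  _ = z≤n
        ... | yes e with no-zero-divisors {z} {b + z} (trans (solve 2 (λ z b → z :* (b :+ z) := z :* z :+ b :* z) refl z b) e)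
        ...   | inj₁ p = ℕP.≤-trans (ℕP.≤-reflexive (sym (isz-0 (trans (+-identityˡ z) p)))) (ℕP.m≤m+n _ _)
        ...   | inj₂ p = ℕP.≤-trans (ℕP.≤-reflexive (sym (isz-0 p))) (ℕP.m≤n+m _ _)

    module Aσ = Action σ-add

    LinM-ev : ∀ {D f} → Mon D f → LinM D (ev σ f)
    LinM-ev {zero}  {f}     m z = trans (Aσ.ev-cong (P.Mon0⇒1 m) z) (Aσ.ev-one z)
    LinM-ev {suc D} {[]}    (P.mkMon () _)
    LinM-ev {suc D} {c ∷ f} m = ev σ f , emb c , LinM-ev (P.Mon-tail m) , λ z → +-comm _ _

    kernel-σ : ∀ {D f} → Mon D f → ∣ker (ev σ f) ∣ ℕ.≤ 2 ℕ.^ D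
    kernel-σ {D} m = LinM-kernel D (LinM-ev m)

    evσ-X^ : ∀ k z → ev σ (X^ k) z ≡ σ^ k z
    evσ-X^ zero    z = Aσ.ev-one z
    evσ-X^ (suc k) z = trans (cong (_+ σ (ev σ (X^ k) z)) (zeroˡ z)) (trans (+-identityˡ _) (cong σ (evσ-X^ k z)))

-- Polynomials in Y = σ + σ⁻¹ and the exact sizes of their kernels.

module FrobeniusOperator where

  open FieldActions
  private module P = BinaryPolynomials
  open P using (_≋_; Mon; Lt; X; X^; _∣_; IsGcd; gcd✓; gdeg; gcd)
  open ReciprocalPolynomials using (Φ; x²+1; D; D-rec)
  open Factors using (Rel; mon; rel; factor-Mon)
  open import Data.Bool using (true; false)
  open import Data.Nat as ℕ using (ℕ; zero; suc)
  import Data.Nat.Properties as ℕP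
  open import Data.List using ([]; _∷_)
  open import Data.Product using (_,_; proj₁; proj₂)
  open import Relation.Binary.PropositionalEquality using (_≡_; refl; sym; trans; cong; cong₂; module ≡-Reasoning)

  module Operators {n : ℕ} (F : FiniteField n) (n>0 : 0 ℕ.< n) where
    open FieldTheory F public
    open FiniteField F using (elements; size)

    ρ : Carrier → Carrier
    ρ = σ^ (n ℕ.∸ 1)

    ρ^ : ℕ → Carrier → Carrier
    ρ^ zero    z = z
    ρ^ (suc k) z = ρ (ρ^ k z)

    ρ-add : Additive ρ
    ρ-add = σ^-add (n ℕ.∸ 1)

    σρ : ∀ z → σ (ρ z) ≡ z
    σρ z = trans (cong (λ k → σ^ k z) (ℕP.m+[n∸m]≡n n>0)) (σ^n z)

    ρσ : ∀ z → ρ (σ z) ≡ z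
    ρσ z = trans (σ^-suc (n ℕ.∸ 1) z) (σρ z)

    ρ^-suc : ∀ k z → ρ^ k (ρ z) ≡ ρ (ρ^ k z)
    ρ^-suc zero    z = refl
    ρ^-suc (suc k) z = cong ρ (ρ^-suc k z)

    ρ^σ^ : ∀ k z → ρ^ k (σ^ k z) ≡ z
    ρ^σ^ zero    z = refl
    ρ^σ^ (suc k) z = trans (sym (ρ^-suc k _)) (trans (cong (ρ^ k) (ρσ (σ^ k z))) (ρ^σ^ k z))

    σ^ρ^ : ∀ k z → σ^ k (ρ^ k z) ≡ z
    σ^ρ^ zero    z = refl
    σ^ρ^ (suc k) z = trans (sym (σ^-suc k _)) (trans (cong (σ^ k) (σρ (ρ^ k z))) (σ^ρ^ k z))

    Y : Carrier → Carrier
    Y z = σ z + ρ z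

    Y-add : Additive Y
    Y-add x y = trans (cong₂ _+_ (σ-add x y) (ρ-add x y))
      (solve 4 (λ a b c d → (a :+ b) :+ (c :+ d) := (a :+ c) :+ (b :+ d)) refl (σ x) (σ y) (ρ x) (ρ y))

    module AY = Action Y-add

    evY : Poly₂ → Carrier → Carrier
    evY = ev Y

    Y-σ^ : ∀ k z → σ^ k (Y z) ≡ Y (σ^ k z)
    Y-σ^ zero    z = refl
    Y-σ^ (suc k) z = trans (cong σ (Y-σ^ k z)) (trans (σ-add _ _) (cong (σ (σ w) +_) (trans (σρ w) (sym (ρσ w)))))
      where w = σ^ k z

    evY-σ^ : ∀ k f z → σ^ k (evY f z) ≡ evY f (σ^ k z)
    evY-σ^ k f z = AY.ev-commute (σ^-add k) (Y-σ^ k) f z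

    evσ-c*X^ : ∀ c k z → ev σ ((c ∷ []) *₂ X^ k) z ≡ emb c * σ^ k z
    evσ-c*X^ c k z = trans (Aσ.ev-* (c ∷ []) (X^ k) z) (trans (Aσ.ev-const c _) (cong (emb c *_) (evσ-X^ k z)))

    evσ-x²+1 : ∀ z → ev σ x²+1 z ≡ σ (Y z)
    evσ-x²+1 z = begin
      1# * z + σ (0# * z + σ (1# * z + σ 0#)) ≡⟨ solve 1 (λ z → con true :* z :+ (con false :* z :+ (con true :* z :+ con false :* con false) :* (con true :* z :+ con false :* con false)) :* (con false :* z :+ (con true :* z :+ con false :* con false) :* (con true :* z :+ con false :* con false))
                                                  := (z :* z) :* (z :* z) :+ z) refl z ⟩
      σ (σ z) + z ≡⟨ cong (σ (σ z) +_) (sym (σρ z)) ⟩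
      σ (σ z) + σ (ρ z) ≡⟨ sym (σ-add _ _) ⟩
      σ (Y z) ∎
      where open ≡-Reasoning

    -- The operator form of Φ d f = x^d f(x + 1/x). As σ^d is injective, f(Y) has the same kernel as
    -- a polynomial in σ of twice the degree.
    evσ-Φ : ∀ d {f} → Lt (suc d) f → ∀ z → ev σ (Φ d f) z ≡ σ^ d (evY f z)
    evσ-Φ d       {[]}    l z = sym (σ^-0 d)
    evσ-Φ zero    {c ∷ f} l z = trans (Aσ.ev-const c z) (trans (sym (+-identityʳ _))
      (cong (emb c * z +_) (sym (trans (cong Y (AY.ev-zero (P.Lt0⇒≋ (P.Lt-tail l)) z)) AY.T-0))))
    evσ-Φ (suc d) {c ∷ f} l z = begin
      ev σ (((c ∷ []) *₂ X^ (suc d)) +₂ (x²+1 *₂ Φ d f)) z ≡⟨ Aσ.ev-+ ((c ∷ []) *₂ X^ (suc d)) (x²+1 *₂ Φ d f) z ⟩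
      ev σ ((c ∷ []) *₂ X^ (suc d)) z + ev σ (x²+1 *₂ Φ d f) z ≡⟨ cong₂ _+_ (evσ-c*X^ c (suc d) z) (Aσ.ev-* x²+1 (Φ d f) z) ⟩
      emb c * σ^ (suc d) z + ev σ x²+1 (ev σ (Φ d f) z) ≡⟨ cong₂ _+_ (sym (Aσ.T-emb (σ^-add (suc d)) c z)) (trans (evσ-x²+1 _) (cong (λ w → σ (Y w)) (evσ-Φ d (P.Lt-tail l) z))) ⟩
      σ^ (suc d) (emb c * z) + σ (Y (σ^ d (evY f z))) ≡⟨ cong (λ w → σ^ (suc d) (emb c * z) + σ w) (sym (Y-σ^ d _)) ⟩
      σ^ (suc d) (emb c * z) + σ^ (suc d) (Y (evY f z)) ≡⟨ sym (σ^-add (suc d) _ _) ⟩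
      σ^ (suc d) (evY (c ∷ f) z) ∎
      where open ≡-Reasoning

    evY-D : ∀ k z → evY (D k) z ≡ σ^ k z + ρ^ k z
    evY-D zero    z = trans (AY.ev-zero (P.zeroʳ X) z) (sym (x+x z))
    evY-D (suc zero) z = trans (AY.ev-X* one₂ z) (cong Y (AY.ev-one z))
    evY-D (suc (suc k)) z = begin
      evY (D (suc (suc k))) z ≡⟨ trans (AY.ev-cong (D-rec k) z) (AY.ev-+ (X *₂ D (suc k)) (D k) z) ⟩
      evY (X *₂ D (suc k)) z + evY (D k) z ≡⟨ cong₂ _+_ (trans (AY.ev-X* (D (suc k)) z) (cong Y (evY-D (suc k) z))) (evY-D k z) ⟩
      Y (σ a + ρ b) + (a + b) ≡⟨ cong (_+ (a + b)) (Y-add (σ a) (ρ b)) ⟩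
      ((σ (σ a) + ρ (σ a)) + (σ (ρ b) + ρ (ρ b))) + (a + b) ≡⟨ cong₂ (λ u v → ((σ (σ a) + u) + (v + ρ (ρ b))) + (a + b)) (ρσ a) (σρ b) ⟩
      ((σ (σ a) + a) + (b + ρ (ρ b))) + (a + b) ≡⟨ solve 4 (λ p a b q → ((p :+ a) :+ (b :+ q)) :+ (a :+ b) := p :+ q) refl (σ (σ a)) a b (ρ (ρ b)) ⟩
      σ (σ a) + ρ (ρ b) ∎
      where
      open ≡-Reasoning
      a = σ^ k z
      b = ρ^ k z

    -- σ^h f(Y) equals σ^n + 1, which is 0 because σ^n is the identity; σ^h is then cancelled.
    Rel-vanishes : ∀ {h f} → Rel h f (xⁿ+1 n) → ∀ z → evY f z ≡ 0#
    Rel-vanishes {h} {f} R z = σ^-injective h (trans (sym (evσ-Φ h (P.bnd (mon R)) z)) (trans (Aσ.ev-cong (rel R) z)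
      (trans vanishes (sym (σ^-0 h)))))
      where
      vanishes : ev σ (xⁿ+1 n) z ≡ 0#
      vanishes = trans (Aσ.ev-+ one₂ (X ^₂ n) z) (trans (cong₂ _+_ (Aσ.ev-one z) (trans (Aσ.ev-cong (ReciprocalPolynomials.X^≋ n) z) (trans (evσ-X^ n z) (σ^n z)))) (x+x z))

    kernel-Y-≤ : ∀ {d g} → Mon d g → ∣ker (evY g) ∣ ℕ.≤ 2 ℕ.^ (d ℕ.+ d)
    kernel-Y-≤ {d} {g} m = ℕP.≤-trans (ℕP.≤-reflexive (ker-cong
        (λ z e → trans (evσ-Φ d (P.bnd m) z) (trans (cong (σ^ d) e) (σ^-0 d)))
        (λ z e → σ^-injective d (trans (sym (evσ-Φ d (P.bnd m) z)) (trans e (sym (σ^-0 d)))))))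
      (kernel-σ (ReciprocalPolynomials.Mon-Φ m))

    module Annihilated {h : ℕ} {f : Poly₂} (R : Rel h f (xⁿ+1 n)) (n≡ : n ≡ h ℕ.+ h) where

      -- |F| ≤ |ker g(Y)| |ker w(Y)| whenever w g annihilates F, so both bounds of kernel-Y-≤ are attained.
      kernel-Y : ∀ {d g} → Mon d g → g ∣ f → ∣ker (evY g) ∣ ≡ 2 ℕ.^ (d ℕ.+ d)
      kernel-Y {d} {g} m (w , e) with factor-Mon {w} {g} e (mon R)
      ... | i , d' , mw , mg , i+d≡h with P.Mon-unique m mg
      ... | refl = ℕP.≤-antisym (kernel-Y-≤ m) (ℕP.*-cancelʳ-≤ (2 ℕ.^ (d ℕ.+ d)) ∣ker (evY g) ∣ (2 ℕ.^ (i ℕ.+ i)) {{ℕ.>-nonZero (ℕP.m^n>0 2 (i ℕ.+ i))}} lower)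
        where
        open ℕP.≤-Reasoning
        arith : (d ℕ.+ d) ℕ.+ (i ℕ.+ i) ≡ n
        arith = trans (interchange d d i i) (trans (cong₂ ℕ._+_ (trans (ℕP.+-comm d i) i+d≡h) (trans (ℕP.+-comm d i) i+d≡h)) (sym n≡))
          where open import Algebra.Properties.CommutativeSemigroup ℕP.+-commutativeSemigroup using (interchange)
        lower : 2 ℕ.^ (d ℕ.+ d) ℕ.* 2 ℕ.^ (i ℕ.+ i) ℕ.≤ ∣ker (evY g) ∣ ℕ.* 2 ℕ.^ (i ℕ.+ i)
        lower = begin
          2 ℕ.^ (d ℕ.+ d) ℕ.* 2 ℕ.^ (i ℕ.+ i) ≡⟨ trans (sym (ℕP.^-distribˡ-+-* 2 (d ℕ.+ d) (i ℕ.+ i))) (cong (2 ℕ.^_) arith) ⟩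
          2 ℕ.^ n ≡⟨ trans (sym size) (sym (∑ℕ-1 elements)) ⟩
          ∑ℕ elements (λ _ → 1) ≡⟨ ∑ℕ-cong elements (λ z → sym (isz-0 (trans (sym (AY.ev-* w g z)) (trans (AY.ev-cong e z) (Rel-vanishes R z))))) ⟩
          ∑ℕ elements (λ z → isz (evY w (evY g z))) ≤⟨ pushforward (AY.ev-add g) (λ z → isz (evY w z)) ⟩
          ∣ker (evY g) ∣ ℕ.* ∣ker (evY w) ∣ ≤⟨ ℕP.*-monoʳ-≤ ∣ker (evY g) ∣ (kernel-Y-≤ mw) ⟩
          ∣ker (evY g) ∣ ℕ.* 2 ℕ.^ (i ℕ.+ i) ∎

      ev-∣ : ∀ {a b} → a ∣ b → ∀ {z} → evY a z ≡ 0# → evY b z ≡ 0#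
      ev-∣ {a} {b} (q , e) {z} az = trans (sym (AY.ev-cong e z)) (trans (AY.ev-* q a z) (trans (cong (evY q) az) (AY.ev-0 q)))

      ev-gcd : ∀ {g a b} → IsGcd g a b → ∀ {z} → evY a z ≡ 0# → evY b z ≡ 0# → evY g z ≡ 0#
      ev-gcd {g} {a} {b} (gcd✓ _ _ (u , v , e)) {z} az bz = trans (sym (AY.ev-cong e z)) (trans (AY.ev-+ (u *₂ a) (v *₂ b) z)
        (trans (cong₂ _+_ (ev-∣ {a} {u *₂ a} (u , P.refl) az) (ev-∣ {b} {v *₂ b} (v , P.refl) bz)) (+-identityʳ 0#)))

      -- Class C₁: L = (X B)(Y), where f = X P.
      module _ {p : Poly₂} {k : ℕ} (fp : X *₂ p ≋ f) (mp : Mon k p) where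
        kernel-XB : ∀ B → ∣ker (evY (X *₂ B)) ∣ ≡ 2 ℕ.^ (suc (gdeg B p) ℕ.+ suc (gdeg B p))
        kernel-XB B = trans (ker-cong
            (λ z e → ev-gcd XG e (trans (AY.ev-cong fp z) (Rel-vanishes R z)))
            (λ z e → ev-∣ (P.g∣a XG) e))
          (kernel-Y (P.Mon-* (P.Mon-X^ 1) (proj₁ (P.gcd-Mon B mp))) (P.∣-resp (P.g∣b XG) fp))
          where
          XG : IsGcd (X *₂ proj₁ (gcd B p)) (X *₂ B) (X *₂ p)
          XG = P.gcd-scale X (proj₂ (gcd B p))

    -- Class C₂ with a_h = 1: L = σ^h + (X B)(Y), where f = X^e S with X a unit modulo S.
    module Twisted {K : ℕ} {S : Poly₂} (e : ℕ) (mS : Mon K S) (cop : P.Coprime X S) (R : Rel (e ℕ.+ K) (X^ e *₂ S) (xⁿ+1 n))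
                   (n≡ : n ≡ (e ℕ.+ K) ℕ.+ (e ℕ.+ K)) where
      open Annihilated R n≡
      h = e ℕ.+ K

      σ^h-σ^h : ∀ z → σ^ h (σ^ h z) ≡ z
      σ^h-σ^h z = trans (sym (σ^-+ h h z)) (trans (cong (λ k → σ^ k z) (sym n≡)) (σ^n z))

      ρ^h : ∀ z → ρ^ h z ≡ σ^ h z
      ρ^h z = trans (cong (ρ^ h) (sym (σ^h-σ^h z))) (ρ^σ^ h (σ^ h z))

      -- The polynomial that acts as σ^h on ker S(Y). The index h + 1 is needed because σ^(-h) = σ^h
      -- makes D_h(Y) vanish, whereas D_(h+1)(Y) = σ^(h+1) + σ^(-(h+1)) = σ^h Y; the factor
      -- `proj₁ cop` inverts y modulo S.
      c₀ : Poly₂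
      c₀ = proj₁ cop *₂ D (suc h)

      c₀-σ^h : ∀ z → evY S z ≡ 0# → evY c₀ z ≡ σ^ h z
      c₀-σ^h z Sz = begin
        evY (x' *₂ D (suc h)) z ≡⟨ AY.ev-* x' (D (suc h)) z ⟩
        evY x' (evY (D (suc h)) z) ≡⟨ cong (evY x') (trans (evY-D (suc h) z) (cong₂ _+_ (sym (σ^-suc h z)) (trans (sym (ρ^-suc h z)) (ρ^h (ρ z))))) ⟩
        evY x' (σ^ h (σ z) + σ^ h (ρ z)) ≡⟨ cong (evY x') (sym (σ^-add h _ _)) ⟩
        evY x' (σ^ h (Y z)) ≡⟨ sym (evY-σ^ h x' (Y z)) ⟩
        σ^ h (evY x' (Y z)) ≡⟨ cong (σ^ h) unit ⟩
        σ^ h z ∎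
        where
        open ≡-Reasoning
        x' = proj₁ cop
        s' = proj₁ (proj₂ cop)
        unit : evY x' (Y z) ≡ z
        unit = begin
          evY x' (Y z) ≡⟨ cong (evY x') (sym (AY.ev-X z)) ⟩
          evY x' (evY X z) ≡⟨ sym (AY.ev-* x' X z) ⟩
          evY (x' *₂ X) z ≡⟨ sym (+-identityʳ _) ⟩
          evY (x' *₂ X) z + 0# ≡⟨ cong (evY (x' *₂ X) z +_) (sym (ev-∣ {S} {s' *₂ S} (s' , P.refl) Sz)) ⟩
          evY (x' *₂ X) z + evY (s' *₂ S) z ≡⟨ sym (AY.ev-+ (x' *₂ X) (s' *₂ S) z) ⟩
          evY ((x' *₂ X) +₂ (s' *₂ S)) z ≡⟨ AY.ev-cong (proj₂ (proj₂ cop)) z ⟩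
          evY one₂ z ≡⟨ AY.ev-one z ⟩
          z ∎

      module _ (B : Poly₂) where
        L : Carrier → Carrier
        L z = evY (X *₂ B) z + σ^ h z

        L-commute : ∀ f z → evY f (L z) ≡ L (evY f z)
        L-commute f z = trans (AY.ev-add f _ _) (cong₂ _+_
          (trans (sym (AY.ev-* f (X *₂ B) z)) (trans (AY.ev-cong (P.*-comm f (X *₂ B)) z) (AY.ev-* (X *₂ B) f z)))
          (sym (evY-σ^ h f z)))

        -- On ker Y the operator L is σ^h, which is injective.
        L-injective : ∀ e w → L w ≡ 0# → evY (X^ e) w ≡ 0# → w ≡ 0#
        L-injective zero    w Lw Yw = trans (sym (AY.ev-one w)) Yw
        L-injective (suc e) w Lw Yw = σ^-injective h (trans (trans (sym (+-identityˡ _)) (trans (cong (_+ σ^ h w) (sym XBw)) Lw)) (sym (σ^-0 h)))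
          where
          XYw : evY (X^ e) (evY X w) ≡ 0#
          XYw = trans (sym (AY.ev-* (X^ e) X w)) (trans (AY.ev-cong (P.trans (P.*-comm (X^ e) X) (P.sym (P.X^suc e))) w) Yw)
          -- Y w is again killed by L, and by one power of Y fewer, so the induction leaves only the
          -- case Y w = 0.
          Xw : evY X w ≡ 0#
          Xw = L-injective e (evY X w) (trans (sym (L-commute X w)) (trans (cong (evY X) Lw) (AY.ev-0 X))) XYw
          XBw : evY (X *₂ B) w ≡ 0#
          XBw = trans (AY.ev-cong (P.*-comm X B) w) (trans (AY.ev-* B X w) (trans (cong (evY B) Xw) (AY.ev-0 B)))

        L-on-S : ∀ z → evY S z ≡ 0# → L z ≡ evY (c₀ +₂ (X *₂ B)) z
        L-on-S z Sz = trans (cong (evY (X *₂ B) z +_) (sym (c₀-σ^h z Sz))) (trans (+-comm _ _) (sym (AY.ev-+ c₀ (X *₂ B) z)))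

        kernel-twisted : ∣ker L ∣ ≡ 2 ℕ.^ (gdeg (c₀ +₂ (X *₂ B)) S ℕ.+ gdeg (c₀ +₂ (X *₂ B)) S)
        kernel-twisted = trans (ker-cong to from) (kernel-Y (proj₁ (P.gcd-Mon (c₀ +₂ (X *₂ B)) mS)) (P.∣-trans (P.g∣b G) (X^ e , P.refl)))
          where
          G = proj₂ (gcd (c₀ +₂ (X *₂ B)) S)
          to : ∀ z → L z ≡ 0# → evY (proj₁ (gcd (c₀ +₂ (X *₂ B)) S)) z ≡ 0#
          to z Lz = ev-gcd G (trans (sym (L-on-S z Sz)) Lz) Sz
            where
            -- S(Y) z lies in ker L because the operators commute, and in ker Y^e because Y^e S(Y) =
            -- 0; there L is injective.
            Sz : evY S z ≡ 0#
            Sz = L-injective e (evY S z) (trans (sym (L-commute S z)) (trans (cong (evY S) Lz) (AY.ev-0 S)))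
                   (trans (sym (AY.ev-* (X^ e) S z)) (Rel-vanishes R z))
          from : ∀ z → evY (proj₁ (gcd (c₀ +₂ (X *₂ B)) S)) z ≡ 0# → L z ≡ 0#
          from z gz = trans (L-on-S z (ev-∣ (P.g∣b G) gz)) (ev-∣ (P.g∣a G) gz)

-- Traces, quadratic forms and their Walsh transforms.

module WalshSpectrum where

  open FiniteSums
  open FieldActions
  open FrobeniusOperator
  open import Data.Bool using (true)
  open import Data.Nat as ℕ using (ℕ; zero; suc; s≤s; z≤n)
  import Data.Nat.Properties as ℕP
  open import Data.Integer as ℤ using (ℤ) renaming (+_ to pos)
  import Data.Integer.Properties as ℤP
  open import Data.List using (List; []; _∷_; map)
  open import Data.Product using (∃; _,_; proj₁; proj₂)
  open import Data.Sum using (_⊎_; inj₁; inj₂)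
  open import Data.Empty using (⊥-elim)
  open import Relation.Nullary using (¬_; yes; no)
  open import Relation.Nullary.Decidable using (_×-dec_; decidable-stable)
  open import Relation.Binary.PropositionalEquality using (_≡_; refl; sym; trans; cong; cong₂; subst; module ≡-Reasoning)

  open Sum ℤP.+-0-commutativeMonoid using () renaming (∑ to ∑ℤ; ∑-cong to ∑ℤ-cong; ∑-δ to ∑ℤ-δ; ∑-swap to ∑ℤ-swap; ∑-inj to ∑ℤ-inj; ∑-ε to ∑ℤ-0) public

  module _ {A : Set} where
    ∑ℤ-*ˡ : (xs : List A) (c : ℤ) (f : A → ℤ) → ∑ℤ xs (λ x → c ℤ.* f x) ≡ c ℤ.* ∑ℤ xs f
    ∑ℤ-*ˡ []       c f = sym (ℤP.*-zeroʳ c)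
    ∑ℤ-*ˡ (x ∷ xs) c f = trans (cong (λ a → c ℤ.* f x ℤ.+ a) (∑ℤ-*ˡ xs c f)) (sym (ℤP.*-distribˡ-+ c (f x) _))

    ∑ℤ-*ʳ : (xs : List A) (c : ℤ) (f : A → ℤ) → ∑ℤ xs (λ x → f x ℤ.* c) ≡ ∑ℤ xs f ℤ.* c
    ∑ℤ-*ʳ xs c f = trans (∑ℤ-cong xs (λ x → ℤP.*-comm (f x) c)) (trans (∑ℤ-*ˡ xs c f) (ℤP.*-comm c _))

    ∑ℤ-neg : (xs : List A) (f : A → ℤ) → ∑ℤ xs (λ x → ℤ.- f x) ≡ ℤ.- ∑ℤ xs f
    ∑ℤ-neg []       f = refl
    ∑ℤ-neg (x ∷ xs) f = trans (cong (λ a → ℤ.- f x ℤ.+ a) (∑ℤ-neg xs f)) (sym (ℤP.neg-distrib-+ (f x) _))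

    ∑ℤ-+ : (xs : List A) (f : A → ℕ) → ∑ℤ xs (λ x → pos (f x)) ≡ pos (∑ℕ xs f)
    ∑ℤ-+ []       f = refl
    ∑ℤ-+ (x ∷ xs) f = cong (λ a → pos (f x) ℤ.+ a) (∑ℤ-+ xs f)

  ≡-neg⇒0 : ∀ i → i ≡ ℤ.- i → i ≡ pos 0
  ≡-neg⇒0 (pos zero)       e = refl
  ≡-neg⇒0 (pos (suc n))      ()
  ≡-neg⇒0 (ℤ.-[1+ n ])   ()

  module WalshTheory {n : ℕ} (F : FiniteField n) (n>0 : 0 ℕ.< n) where
    open Operators F n>0 public
    open FiniteField F using (elements; size; complete; unique; _≟_; 0≢1; inverse)
    open FieldOps F using (sign; walsh; sumℤ; Plateaued)

    -- Membership in the prime field. `sign` sends every nonzero element to -1, so turning sums into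
    -- products of signs requires both arguments to be 0 or 1.
    Bit : Carrier → Set
    Bit c = c ≡ 0# ⊎ c ≡ 1#

    bit-+ : ∀ {c d} → Bit c → Bit d → Bit (c + d)
    bit-+ {d = d} (inj₁ refl) q = subst Bit (sym (+-identityˡ d)) q
    bit-+ (inj₂ refl) (inj₁ refl) = inj₂ (+-identityʳ 1#)
    bit-+ (inj₂ refl) (inj₂ refl) = inj₁ char2

    fixed⇒bit : ∀ {c} → σ c ≡ c → Bit c
    fixed⇒bit {c} e with no-zero-divisors {c} {c + 1#} (trans (solve 1 (λ c → c :* (c :+ con true) := c :* c :+ c) refl c) (≈⇒+≈0 e))
    ... | inj₁ z = inj₁ z
    ... | inj₂ z = inj₂ (+≈0⇒≈ z)

    sign-0 : sign 0# ≡ pos 1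
    sign-0 with 0# ≟ 0#
    ... | yes _ = refl
    ... | no ¬p = ⊥-elim (¬p refl)

    sign-1 : sign 1# ≡ ℤ.- (pos 1)
    sign-1 with 1# ≟ 0#
    ... | yes p = ⊥-elim (0≢1 (sym p))
    ... | no _ = refl

    sign-+ : ∀ {a b} → Bit a → Bit b → sign (a + b) ≡ sign a ℤ.* sign b
    sign-+ {b = b} (inj₁ refl) _ = trans (cong sign (+-identityˡ b)) (trans (sym (ℤP.*-identityˡ (sign b))) (cong (ℤ._* sign b) (sym sign-0)))
    sign-+ {a} (inj₂ refl) (inj₁ refl) = trans (cong sign (+-identityʳ a)) (trans (sym (ℤP.*-identityʳ (sign a))) (cong (sign a ℤ.*_) (sym sign-0)))
    sign-+ (inj₂ refl) (inj₂ refl) rewrite char2 | sign-0 | sign-1 = refl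

    sumF-cong : ∀ k {f g : ℕ → Carrier} → (∀ i → f i ≡ g i) → sumF k f ≡ sumF k g
    sumF-cong zero    e = refl
    sumF-cong (suc k) e = cong₂ _+_ (sumF-cong k e) (e k)

    sumF-+ : ∀ k (f g : ℕ → Carrier) → sumF k (λ i → f i + g i) ≡ sumF k f + sumF k g
    sumF-+ zero   f g = sym (+-identityʳ 0#)
    sumF-+ (suc k) f g = trans (cong (_+ (f k + g k)) (sumF-+ k f g))
      (solve 4 (λ a b c d → (a :+ b) :+ (c :+ d) := (a :+ c) :+ (b :+ d)) refl (sumF k f) (sumF k g) (f k) (g k))

    sumF-hom : ∀ k (f : ℕ → Carrier) {S} → Additive S → S (sumF k f) ≡ sumF k (λ i → S (f i))
    sumF-hom zero    f add = additive-0 add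
    sumF-hom (suc k) f add = trans (add _ _) (cong (_+ _) (sumF-hom k f add))

    sumF-suc : ∀ k (f : ℕ → Carrier) → f 0 + sumF k (λ i → f (suc i)) ≡ sumF (suc k) f
    sumF-suc zero    f = +-comm _ _
    sumF-suc (suc k) f = trans (sym (+-assoc (f 0) _ _)) (cong (_+ f (suc k)) (sumF-suc k f))

    sumF-++ : ∀ k l (f : ℕ → Carrier) → sumF (k ℕ.+ l) f ≡ sumF k f + sumF l (λ i → f (k ℕ.+ i))
    sumF-++ k zero    f = trans (cong (λ j → sumF j f) (ℕP.+-identityʳ k)) (sym (+-identityʳ _))
    sumF-++ k (suc l) f = trans (cong (λ j → sumF j f) (ℕP.+-suc k l)) (trans (cong (_+ f (k ℕ.+ l)) (sumF-++ k l f)) (+-assoc _ _ _))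

    Trsub-σ^ : ∀ k x → Trsub k x ≡ sumF k (λ i → σ^ i x)
    Trsub-σ^ k x = sumF-cong k (λ i → pow-2^ x i)

    Tr-σ^ : ∀ x → Tr x ≡ sumF n (λ i → σ^ i x)
    Tr-σ^ = Trsub-σ^ n

    Trsub-add : ∀ k → Additive (Trsub k)
    Trsub-add k x y = trans (Trsub-σ^ k (x + y)) (trans (sumF-cong k (λ i → σ^-add i x y)) (trans (sumF-+ k _ _) (sym (cong₂ _+_ (Trsub-σ^ k x) (Trsub-σ^ k y)))))

    Tr-add : Additive Tr
    Tr-add = Trsub-add n

    Tr-0 : Tr 0# ≡ 0#
    Tr-0 = additive-0 Tr-add

    -- σ shifts the summands cyclically as soon as σ^k x = x. This covers the absolute trace on F
    -- and the subfield trace on the elements fixed by σ^h.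
    σ-Trsub : ∀ k x → σ^ k x ≡ x → σ (Trsub k x) ≡ Trsub k x
    σ-Trsub k x fix = trans (cong σ (Trsub-σ^ k x)) (trans (sumF-hom k (λ i → σ^ i x) σ-add) (trans
      (+-cancelˡ {x} (trans (sumF-suc k (λ i → σ^ i x)) (trans (+-comm (sumF k (λ i → σ^ i x)) _) (cong (_+ sumF k (λ i → σ^ i x)) fix)))) (sym (Trsub-σ^ k x))))

    σ-Tr : ∀ x → σ (Tr x) ≡ Tr x
    σ-Tr x = σ-Trsub n x (σ^n x)

    Tr-bit : ∀ x → Bit (Tr x)
    Tr-bit x = fixed⇒bit (σ-Tr x)

    Tr-of-σ^ : ∀ k x → Tr (σ^ k x) ≡ Tr x
    Tr-of-σ^ zero    x = refl
    Tr-of-σ^ (suc k) x = trans (Tr-σ^ _) (trans (sumF-cong n (λ i → σ^-suc i (σ^ k x))) (trans (sym (sumF-hom n (λ i → σ^ i (σ^ k x)) σ-add))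
      (trans (cong σ (sym (Tr-σ^ (σ^ k x)))) (trans (σ-Tr _) (Tr-of-σ^ k x)))))

    -- Tr is a monic linearised polynomial of degree 2^(n-1), so it cannot vanish identically.
    Tr-surjective : ∃ λ t → Tr t ≡ 1#
    Tr-surjective with search (λ t → Tr t ≟ 1#)
    ... | yes p = p
    ... | no ¬p = ⊥-elim (ℕP.<⇒≱ (ℕP.^-monoʳ-< 2 (s≤s (s≤s z≤n)) (ℕP.≤-reflexive (ℕP.m+[n∸m]≡n n>0))) (begin
        2 ℕ.^ n ≡⟨ trans (sym size) (sym (∑ℕ-1 elements)) ⟩
        ∑ℕ elements (λ _ → 1) ≡⟨ ∑ℕ-cong elements (λ z → sym (isz-0 (vanish z))) ⟩
        ∣ker Tr ∣ ≤⟨ LinM-kernel (n ℕ.∸ 1) linear ⟩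
        2 ℕ.^ (n ℕ.∸ 1) ∎))
      where
      open ℕP.≤-Reasoning
      vanish : ∀ z → Tr z ≡ 0#
      vanish z with Tr-bit z
      ... | inj₁ e = e
      ... | inj₂ e = ⊥-elim (¬p (z , e))
      linear-sum : ∀ k {L} → (∀ z → L z ≡ sumF (suc k) (λ i → σ^ i z)) → LinM k L
      linear-sum zero    e z = trans (e z) (+-identityˡ z)
      linear-sum (suc k) e = (λ z → sumF (suc k) (λ i → σ^ i z)) , 1# , linear-sum k (λ z → refl) , λ z → trans (e z) (trans (sym (sumF-suc (suc k) (λ i → σ^ i z)))
        (trans (+-comm z _) (cong₂ _+_ (sym (sumF-hom (suc k) (λ i → σ^ i z) σ-add)) (sym (*-identityˡ z)))))
      linear : LinM (n ℕ.∸ 1) Tr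
      linear = linear-sum (n ℕ.∸ 1) (λ z → trans (Tr-σ^ z) (cong (λ k → sumF k (λ i → σ^ i z)) (sym (ℕP.m+[n∸m]≡n n>0))))

    -- L represents the polar form of f through the trace pairing; since that pairing is
    -- nondegenerate, ker L is the radical.
    record Quadratic (f L : Carrier → Carrier) : Set where
      field
        bit   : ∀ x → Bit (f x)
        polar : ∀ x y → f (x + y) ≡ (f x + f y) + Tr (y * L x)
        L-add : Additive L

    shiftℤ : ∀ a (f : Carrier → ℤ) → ∑ℤ elements (λ z → f (a + z)) ≡ ∑ℤ elements f
    shiftℤ a = ∑ℤ-inj (a +_) +-cancelˡ unique complete ℕP.≤-refl

    antisymmetric-sum : ∀ a (f : Carrier → ℤ) → (∀ z → f (a + z) ≡ ℤ.- f z) → ∑ℤ elements f ≡ pos 0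
    antisymmetric-sum a f e = ≡-neg⇒0 _ (trans (sym (shiftℤ a f)) (trans (∑ℤ-cong elements e) (∑ℤ-neg elements f)))

    -- Orthogonality of additive characters: for a ≠ 0, translation by x₀ = t/a with Tr t = 1
    -- reverses every sign.
    ∑-sign-Tr : ∀ a → ∑ℤ elements (λ x → sign (Tr (x * a))) ≡ pos (2 ℕ.^ n) ℤ.* pos (isz a)
    ∑-sign-Tr a with a ≟ 0#
    ... | yes refl = trans (∑ℤ-cong elements (λ x → trans (cong sign (trans (cong Tr (zeroʳ x)) Tr-0)) sign-0))
        (trans (∑ℤ-+ elements (λ _ → 1)) (trans (cong pos (trans (∑ℕ-1 elements) size)) (sym (ℤP.*-identityʳ _))))
    ... | no a≢0 = trans (antisymmetric-sum x₀ (λ x → sign (Tr (x * a))) flip) (sym (ℤP.*-zeroʳ (pos (2 ℕ.^ n))))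
      where
      t = proj₁ Tr-surjective
      a' = proj₁ (inverse a a≢0)
      x₀ = t * a'
      Tr-x₀ : Tr (x₀ * a) ≡ 1#
      Tr-x₀ = trans (cong Tr (trans (*-assoc t a' a) (trans (cong (t *_) (trans (*-comm a' a) (proj₂ (inverse a a≢0)))) (*-identityʳ t)))) (proj₂ Tr-surjective)
      flip : ∀ x → sign (Tr ((x₀ + x) * a)) ≡ ℤ.- sign (Tr (x * a))
      flip x = trans (cong sign (trans (cong Tr (distribʳ a x₀ x)) (trans (Tr-add _ _) (cong (_+ Tr (x * a)) Tr-x₀))))
        (trans (sign-+ (inj₂ refl) (Tr-bit _)) (trans (cong (ℤ._* sign (Tr (x * a))) sign-1) (ℤP.-1*i≡-i _)))

    walsh-∑ : ∀ f b → walsh f b ≡ ∑ℤ elements (λ x → sign (f x + Tr (b * x)))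
    walsh-∑ f b = go elements
      where
      go : ∀ xs → sumℤ (map (λ x → sign (f x + Tr (b * x))) xs) ≡ ∑ℤ xs (λ x → sign (f x + Tr (b * x)))
      go []       = refl
      go (x ∷ xs) = cong (λ a → sign (f x + Tr (b * x)) ℤ.+ a) (go xs)

    module _ {f L : Carrier → Carrier} (Q : Quadratic f L) where
      open Quadratic Q

      -- Expanding the square and substituting y = z + x leaves Σ_z (-1)^φ(z) Σ_x (-1)^Tr(x L z), whose
      -- inner sum is 2ⁿ on ker L and 0 elsewhere; φ is additive on ker L.
      module _ (b : Carrier) where
        private
          φ : Carrier → Carrier
          φ x = f x + Tr (b * x)

          φ-bit : ∀ x → Bit (φ x)
          φ-bit x = bit-+ (bit x) (Tr-bit _)

          φ-polar : ∀ x y → φ (x + y) ≡ (φ x + φ y) + Tr (y * L x)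
          φ-polar x y = trans (cong₂ _+_ (polar x y) (trans (cong Tr (distribˡ b x y)) (Tr-add _ _)))
            (solve 5 (λ a b c d e → ((a :+ b) :+ c) :+ (d :+ e) := ((a :+ d) :+ (b :+ e)) :+ c) refl (f x) (f y) (Tr (y * L x)) (Tr (b * x)) (Tr (b * y)))

          χ : Carrier → ℤ
          χ x = sign (φ x)

          χ-product : ∀ x z → χ x ℤ.* χ (z + x) ≡ χ z ℤ.* sign (Tr (x * L z))
          χ-product x z = trans (sym (sign-+ (φ-bit x) (φ-bit (z + x)))) (trans (cong sign (trans (cong (φ x +_) (φ-polar z x))
            (solve 3 (λ a b c → a :+ ((b :+ a) :+ c) := b :+ c) refl (φ x) (φ z) (Tr (x * L z))))) (sign-+ (φ-bit z) (Tr-bit _)))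

          W = ∑ℤ elements χ
          K : ℤ
          K = ∑ℤ elements (λ z → χ z ℤ.* pos (isz (L z)))

          W² : W ℤ.* W ≡ pos (2 ℕ.^ n) ℤ.* K
          W² = begin
            W ℤ.* W ≡⟨ sym (∑ℤ-*ʳ elements W χ) ⟩
            ∑ℤ elements (λ x → χ x ℤ.* W) ≡⟨ ∑ℤ-cong elements (λ x → trans (cong (χ x ℤ.*_) (trans (sym (shiftℤ x χ)) (∑ℤ-cong elements (λ z → cong χ (+-comm x z))))) (sym (∑ℤ-*ˡ elements (χ x) _))) ⟩
            ∑ℤ elements (λ x → ∑ℤ elements (λ z → χ x ℤ.* χ (z + x))) ≡⟨ ∑ℤ-cong elements (λ x → ∑ℤ-cong elements (χ-product x)) ⟩
            ∑ℤ elements (λ x → ∑ℤ elements (λ z → χ z ℤ.* sign (Tr (x * L z)))) ≡⟨ ∑ℤ-swap elements elements _ ⟩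
            ∑ℤ elements (λ z → ∑ℤ elements (λ x → χ z ℤ.* sign (Tr (x * L z)))) ≡⟨ ∑ℤ-cong elements (λ z → trans (∑ℤ-*ˡ elements (χ z) _) (trans (cong (χ z ℤ.*_) (∑-sign-Tr (L z))) (rearrange (χ z) (pos (isz (L z)))))) ⟩
            ∑ℤ elements (λ z → pos (2 ℕ.^ n) ℤ.* (χ z ℤ.* pos (isz (L z)))) ≡⟨ ∑ℤ-*ˡ elements (pos (2 ℕ.^ n)) _ ⟩
            pos (2 ℕ.^ n) ℤ.* K ∎
            where
            open ≡-Reasoning
            rearrange : ∀ a c → a ℤ.* (pos (2 ℕ.^ n) ℤ.* c) ≡ pos (2 ℕ.^ n) ℤ.* (a ℤ.* c)
            rearrange a c = trans (sym (ℤP.*-assoc a (pos (2 ℕ.^ n)) c)) (trans (cong (ℤ._* c) (ℤP.*-comm a (pos (2 ℕ.^ n)))) (ℤP.*-assoc (pos (2 ℕ.^ n)) a c))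

          -- χ restricts to a character of the group ker L. If some z₀ in ker L has φ z₀ = 1,
          -- translation by z₀ negates the sum; otherwise all terms on ker L are 1.
          K-value : K ≡ pos 0 ⊎ K ≡ pos ∣ker L ∣
          K-value with search (λ z → (L z ≟ 0#) ×-dec (φ z ≟ 1#))
          ... | yes (z₀ , Lz₀ , φz₀) = inj₁ (antisymmetric-sum z₀ _ flip)
            where
            flip : ∀ z → χ (z₀ + z) ℤ.* pos (isz (L (z₀ + z))) ≡ ℤ.- (χ z ℤ.* pos (isz (L z)))
            flip z = trans (cong₂ ℤ._*_ χ-flip (cong (λ w → pos (isz w)) (trans (L-add z₀ z) (trans (cong (_+ L z) Lz₀) (+-identityˡ _)))))
              (sym (ℤP.neg-distribˡ-* (χ z) (pos (isz (L z)))))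
              where
              χ-flip : χ (z₀ + z) ≡ ℤ.- χ z
              χ-flip = trans (cong sign (trans (φ-polar z₀ z) (trans (cong₂ (λ u v → (u + φ z) + v) φz₀ (trans (cong (λ w → Tr (z * w)) Lz₀) (trans (cong Tr (zeroʳ z)) Tr-0))) (+-identityʳ _))))
                (trans (sign-+ (inj₂ refl) (φ-bit z)) (trans (cong (ℤ._* χ z) sign-1) (ℤP.-1*i≡-i _)))
          ... | no none = inj₂ (trans (∑ℤ-cong elements term) (∑ℤ-+ elements (λ z → isz (L z))))
            where
            term : ∀ z → χ z ℤ.* pos (isz (L z)) ≡ pos (isz (L z))
            term z with L z ≟ 0#
            ... | no _ = ℤP.*-zeroʳ (χ z)
            ... | yes p with φ-bit z
            ...   | inj₁ e = cong (ℤ._* pos 1) (trans (cong sign e) sign-0)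
            ...   | inj₂ e = ⊥-elim (none (z , p , e))

        walsh² : walsh f b ℤ.* walsh f b ≡ pos 0 ⊎ walsh f b ℤ.* walsh f b ≡ pos (2 ℕ.^ n ℕ.* ∣ker L ∣)
        walsh² rewrite walsh-∑ f b with K-value
        ... | inj₁ e = inj₁ (trans W² (trans (cong (λ k → pos (2 ℕ.^ n) ℤ.* k) e) (ℤP.*-zeroʳ (pos (2 ℕ.^ n)))))
        ... | inj₂ e = inj₂ (trans W² (trans (cong (λ k → pos (2 ℕ.^ n) ℤ.* k) e) (sym (ℤP.pos-* (2 ℕ.^ n) ∣ker L ∣))))

      -- Σ_b W(b) = 2ⁿ (-1)^f(0).
      walsh-nonzero : ¬ (∀ b → walsh f b ℤ.* walsh f b ≡ pos 0)
      walsh-nonzero all0 = not-zero (sign-f0 (bit 0#)) (trans (sym total) (trans (∑ℤ-cong elements W0) (∑ℤ-0 elements)))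
        where
        W0 : ∀ b → walsh f b ≡ pos 0
        W0 b with ℤP.i*j≡0⇒i≡0∨j≡0 (walsh f b) (all0 b)
        ... | inj₁ e = e
        ... | inj₂ e = e
        s = sign (f 0#)
        total : ∑ℤ elements (walsh f) ≡ s ℤ.* pos (2 ℕ.^ n)
        total = begin
          ∑ℤ elements (walsh f) ≡⟨ ∑ℤ-cong elements (λ b → walsh-∑ f b) ⟩
          ∑ℤ elements (λ b → ∑ℤ elements (λ x → sign (f x + Tr (b * x)))) ≡⟨ ∑ℤ-swap elements elements _ ⟩
          ∑ℤ elements (λ x → ∑ℤ elements (λ b → sign (f x + Tr (b * x)))) ≡⟨ ∑ℤ-cong elements (λ x → trans (∑ℤ-cong elements (λ b → sign-+ (bit x) (Tr-bit _))) (trans (∑ℤ-*ˡ elements (sign (f x)) _) (cong (sign (f x) ℤ.*_) (∑-sign-Tr x)))) ⟩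
          ∑ℤ elements (λ x → sign (f x) ℤ.* (pos (2 ℕ.^ n) ℤ.* pos (isz x))) ≡⟨ ∑ℤ-δ _ unique (complete 0#) (λ x ne → trans (cong (λ k → sign (f x) ℤ.* (pos (2 ℕ.^ n) ℤ.* pos k)) (isz-≢ ne)) (trans (cong (sign (f x) ℤ.*_) (ℤP.*-zeroʳ (pos (2 ℕ.^ n)))) (ℤP.*-zeroʳ (sign (f x))))) ⟩
          s ℤ.* (pos (2 ℕ.^ n) ℤ.* pos (isz 0#)) ≡⟨ cong (s ℤ.*_) (trans (cong (λ k → pos (2 ℕ.^ n) ℤ.* pos k) (isz-0 refl)) (ℤP.*-identityʳ _)) ⟩
          s ℤ.* pos (2 ℕ.^ n) ∎
          where open ≡-Reasoning
        sign-f0 : Bit (f 0#) → ¬ (s ≡ pos 0)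
        sign-f0 (inj₁ e) z with trans (sym sign-0) (trans (cong sign (sym e)) z)
        ... | ()
        sign-f0 (inj₂ e) z with trans (sym sign-1) (trans (cong sign (sym e)) z)
        ... | ()
        not-zero : ¬ (s ≡ pos 0) → ¬ (s ℤ.* pos (2 ℕ.^ n) ≡ pos 0)
        not-zero s≢0 e with ℤP.i*j≡0⇒i≡0∨j≡0 s e
        ... | inj₁ z = s≢0 z
        ... | inj₂ z = ℕP.<⇒≢ (ℕP.m^n>0 2 n) (sym (ℤP.+-injective z))

      -- An identically zero spectrum would be s-plateaued for every s. A nonzero Walsh value, which
      -- `walsh-nonzero` guarantees, has square 2^n |ker L| and so determines s.
      Plateaued⇒ker : ∀ s → Plateaued f s → ∣ker L ∣ ≡ 2 ℕ.^ s
      Plateaued⇒ker s pl = decidable-stable (∣ker L ∣ ℕP.≟ 2 ℕ.^ s) λ ne → walsh-nonzero (λ b → case b ne)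
        where
        case : ∀ b → ¬ (∣ker L ∣ ≡ 2 ℕ.^ s) → walsh f b ℤ.* walsh f b ≡ pos 0
        case b ne with pl b | walsh² b
        ... | inj₁ e | _      = e
        ... | inj₂ _ | inj₁ e = e
        ... | inj₂ e | inj₂ e' = ⊥-elim (ne (ℕP.*-cancelˡ-≡ ∣ker L ∣ (2 ℕ.^ s) (2 ℕ.^ n) {{ℕ.>-nonZero (ℕP.m^n>0 2 n)}}
              (trans (ℤP.+-injective (trans (sym e') e)) (ℕP.^-distribˡ-+-* 2 n s))))

      ker⇒Plateaued : ∀ s → ∣ker L ∣ ≡ 2 ℕ.^ s → Plateaued f s
      ker⇒Plateaued s e b with walsh² b
      ... | inj₁ z = inj₁ z
      ... | inj₂ z = inj₂ (trans z (cong pos (trans (cong (2 ℕ.^ n ℕ.*_) e) (sym (ℕP.^-distribˡ-+-* 2 n s)))))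

-- The two classes as quadratic forms, and the counts of their plateaued members.

module PlateauedCounts where

  open FiniteSums
  private module P = BinaryPolynomials
  open P using (_≋_; Mon; Lt; X; X^; gdeg; co; at)
  open ReciprocalPolynomials using (E; D; Mon-E; Lt-c; c*≋scale)
  open Factors using (Rel; Rel-Mon; Tower; Tower-Mon; n+n-injective)
  open GeneratingFunctions
  open GcdCounting
  open FrobeniusOperator
  open WalshSpectrum
  open FieldActions
  open import Data.Bool using (Bool; true; false; _xor_; _∧_; if_then_else_)
  open import Data.Bool.Properties using (∧-identityʳ)
  open import Data.Nat as ℕ using (ℕ; zero; suc; _∸_; _≤_; s≤s; z≤n)
  import Data.Nat.Properties as ℕP
  import Data.Nat.DivMod as ℕD
  import Data.Nat.Divisibility as Div
  open import Data.List using ([]; _∷_; length; map; filter)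
  open import Data.Vec as Vec using (Vec; []; _∷_; _∷ʳ_)
  open import Data.Vec.Properties using (∷ʳ-injective)
  open import Data.Product using (_×_; _,_; proj₁; proj₂)
  open import Data.Sum using (_⊎_; inj₁; inj₂)
  open import Data.Empty using (⊥-elim)
  open import Relation.Nullary using (¬_; Dec; yes; no)
  open import Relation.Binary.Definitions using (tri<; tri≈; tri>)
  open import Relation.Binary.PropositionalEquality using (_≡_; refl; sym; trans; cong; cong₂; subst; module ≡-Reasoning)

  coeff-gen : ∀ {A : Set} {Q : A → Set} (Q? : ∀ x → Dec (Q x)) (κ : A → ℕ) t → (∀ x → Q x → κ x ≡ t) → (∀ x → κ x ≡ t → Q x) →
              ∀ xs → length (filter Q? xs) ≡ coeff (gen xs κ) t
  coeff-gen Q? κ t to from []       = refl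
  coeff-gen Q? κ t to from (x ∷ xs) with Q? x
  ... | yes q = sym (trans (coeff-+ (monoᴺ 1 (κ x)) (gen xs κ) t)
                  (cong₂ ℕ._+_ (trans (cong (λ i → coeff (monoᴺ 1 i) t) (to x q)) (coeff-mono-≡ 1 t)) (sym (coeff-gen Q? κ t to from xs))))
  ... | no ¬q = sym (trans (coeff-+ (monoᴺ 1 (κ x)) (gen xs κ) t)
                  (cong₂ ℕ._+_ (coeff-mono-≢ 1 (κ x) t (λ e → ¬q (from x e))) (sym (coeff-gen Q? κ t to from xs))))

  coeff-gen-none : ∀ {A : Set} (κ : A → ℕ) t → (∀ x → ¬ (κ x ≡ t)) → ∀ xs → coeff (gen xs κ) t ≡ 0
  coeff-gen-none κ t ne []       = refl
  coeff-gen-none κ t ne (x ∷ xs) = trans (coeff-+ (monoᴺ 1 (κ x)) (gen xs κ) t)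
    (cong₂ ℕ._+_ (coeff-mono-≢ 1 (κ x) t (ne x)) (coeff-gen-none κ t ne xs))

  -- The bound κ ≤ n makes the truncated subtraction n ∸ κ injective, so s and t determine each
  -- other; beyond n both sides are 0.
  genCoeff-gen : ∀ {A : Set} n {Q : A → ℕ → Set} (Q? : ∀ x s → Dec (Q x s)) (κ : A → ℕ) → (∀ x → κ x ≤ n) →
                 (∀ x s → Q x s → n ∸ κ x ≡ s) → (∀ x s → n ∸ κ x ≡ s → Q x s) →
                 ∀ xs t → genCoeff n (λ s → length (filter (λ x → Q? x s) xs)) t ≡ coeff (gen xs κ) t
  genCoeff-gen n Q? κ κ≤n to from xs t with t ℕ.≤? n
  ... | yes t≤n = coeff-gen (λ x → Q? x (n ∸ t)) κ t (λ x q → ℕP.∸-cancelˡ-≡ (κ≤n x) t≤n (to x _ q)) (λ x e → from x _ (cong (n ∸_) e)) xs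
  ... | no  t≰n = sym (coeff-gen-none κ t (λ x e → t≰n (subst (_≤ n) e (κ≤n x))) xs)

  codegree : ∀ {g h} → g ≤ h → (h ℕ.+ h) ∸ 2 ℕ.* (h ∸ g) ≡ g ℕ.+ g
  codegree {g} {h} g≤h = trans (cong₂ _∸_ (cong₂ ℕ._+_ (sym split) (sym split)) (cong ((h ∸ g) ℕ.+_) (ℕP.+-identityʳ (h ∸ g))))
    (trans (cong (_∸ ((h ∸ g) ℕ.+ (h ∸ g))) (interchange (h ∸ g) g (h ∸ g) g)) (ℕP.m+n∸m≡n ((h ∸ g) ℕ.+ (h ∸ g)) (g ℕ.+ g)))
    where
    open import Algebra.Properties.CommutativeSemigroup ℕP.+-commutativeSemigroup using (interchange)
    split : (h ∸ g) ℕ.+ g ≡ h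
    split = ℕP.m∸n+n≡m g≤h

  2^-inj : ∀ {a b} → 2 ℕ.^ a ≡ 2 ℕ.^ b → a ≡ b
  2^-inj {a} {b} e with ℕP.<-cmp a b
  ... | tri< a<b _ _ = ⊥-elim (ℕP.<⇒≢ (ℕP.^-monoʳ-< 2 (s≤s (s≤s z≤n)) a<b) e)
  ... | tri≈ _ a≡b _ = a≡b
  ... | tri> _ _ b<a = ⊥-elim (ℕP.<⇒≢ (ℕP.^-monoʳ-< 2 (s≤s (s≤s z≤n)) b<a) (sym e))

  -- The polynomial B(y) with y B(y) = Σ aᵢ (xⁱ + x⁻ⁱ)

  Bpoly : (ℕ → Bool) → ℕ → Poly₂
  Bpoly α zero    = []
  Bpoly α (suc K) = Bpoly α K +₂ ((α K ∷ []) *₂ E (suc K))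

  Lt-Bpoly : ∀ α K → Lt K (Bpoly α K)
  Lt-Bpoly α zero    = P.Lt-[]
  Lt-Bpoly α (suc K) = P.Lt-+ (P.Lt-mono (ℕP.n≤1+n K) (Lt-Bpoly α K)) (P.Lt-* (Lt-c (α K)) (P.bnd (proj₁ (Mon-E K))))

  Bpoly-cong : ∀ {α β} K → (∀ i → i ℕ.< K → α i ≡ β i) → Bpoly α K ≡ Bpoly β K
  Bpoly-cong zero    e = refl
  Bpoly-cong (suc K) e = cong₂ (λ f c → f +₂ ((c ∷ []) *₂ E (suc K))) (Bpoly-cong K (λ i lt → e i (ℕP.m≤n⇒m≤1+n lt))) (e K ℕP.≤-refl)

  -- Triangularity: `E (suc K)` is monic of degree K and the earlier terms have smaller degree, so
  -- the top coefficient reveals α K and the rest follows by induction.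
  Bpoly-injective : ∀ {α β} K → Bpoly α K ≋ Bpoly β K → ∀ i → i ℕ.< K → α i ≡ β i
  Bpoly-injective {α} {β} (suc K) e i lt = go (ℕP.m≤n⇒m<n∨m≡n (ℕP.≤-pred lt))
    where
    top-co : ∀ α → co (Bpoly α (suc K)) K ≡ α K
    top-co α = trans (P.co-+ (Bpoly α K) _ K) (cong₂ _xor_ (P.above (Lt-Bpoly α K) K ℕP.≤-refl)
      (trans (at (c*≋scale (α K) (E (suc K))) K) (trans (P.co-scale (α K) (E (suc K)) K) (trans (cong (α K ∧_) (P.top (proj₁ (Mon-E K)))) (∧-identityʳ (α K))))))
    last : α K ≡ β K
    last = trans (sym (top-co α)) (trans (at e K) (top-co β))
    initial : Bpoly α K ≋ Bpoly β K
    initial = P.trans (P.sym (cancel α)) (P.trans (P.+-cong e (P.reflexive (cong (λ c → (c ∷ []) *₂ E (suc K)) last))) (cancel β))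
      where
      cancel : ∀ α → (Bpoly α (suc K) +₂ ((α K ∷ []) *₂ E (suc K))) ≋ Bpoly α K
      cancel α = P.solve 2 (λ a b → (a P.:+ b) P.:+ b P.:= a) P.refl (Bpoly α K) ((α K ∷ []) *₂ E (suc K))
    go : i ℕ.< K ⊎ i ≡ K → α i ≡ β i
    go (inj₁ i<K) = Bpoly-injective K initial i i<K
    go (inj₂ refl) = last

  lookup-injective : ∀ {K} {a b : Vec Bool K} → (∀ i → i ℕ.< K → lookupℕ a i ≡ lookupℕ b i) → a ≡ b
  lookup-injective {a = []}    {[]}    e = refl
  lookup-injective {a = x ∷ a} {y ∷ b} e = cong₂ _∷_ (e 0 (s≤s z≤n)) (lookup-injective (λ i lt → e (suc i) (s≤s lt)))

  lookup-∷ʳ-init : ∀ {K} (a : Vec Bool K) b i → i ℕ.< K → lookupℕ (a ∷ʳ b) i ≡ lookupℕ a i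
  lookup-∷ʳ-init (x ∷ a) b zero    lt       = refl
  lookup-∷ʳ-init (x ∷ a) b (suc i) (s≤s lt) = lookup-∷ʳ-init a b i lt

  lookup-∷ʳ-last : ∀ {K} (a : Vec Bool K) b → lookupℕ (a ∷ʳ b) K ≡ b
  lookup-∷ʳ-last []      b = refl
  lookup-∷ʳ-last (x ∷ a) b = lookup-∷ʳ-last a b

  -- The triangular change of basis permutes the polynomials of degree below K, so the tuple (aᵢ)
  -- may be replaced by the coefficients of B itself.
  gen-Bpoly : ∀ K (w : Poly₂ → ℕ) → (∀ {f g} → f ≋ g → w f ≡ w g) →
              gen (allVecs K) (λ a → w (Bpoly (lookupℕ a) K)) ≈ᴺ gen (allVecs K) (λ A → w (toPoly A))
  gen-Bpoly K w resp = ≈-trans (gen-cong (allVecs K) (λ a → resp (P.sym (toPoly-toVec (Lt-Bpoly (lookupℕ a) K)))))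
    (∑-inj β β-injective (allVecs-unique K) allVecs-complete ℕP.≤-refl (λ A → monoᴺ 1 (w (toPoly A))))
    where
    β : Vec Bool K → Vec Bool K
    β a = toVec K (Bpoly (lookupℕ a) K)
    β-injective : ∀ {a b} → β a ≡ β b → a ≡ b
    β-injective {a} {b} e = lookup-injective (Bpoly-injective K (toVec-injective (Lt-Bpoly (lookupℕ a) K) (Lt-Bpoly (lookupℕ b) K) e))

  module Quadratics {n : ℕ} (F : FiniteField n) (n>0 : 0 ℕ.< n) where
    open WalshTheory F n>0 public
    open FieldOps F using (Plateaued?)
    open Quadratic

    Quadratic-resp : ∀ {f f' L L'} → (∀ x → f x ≡ f' x) → (∀ x → L x ≡ L' x) → Quadratic f L → Quadratic f' L'
    Quadratic-resp ef eL Q = record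
      { bit = λ x → subst Bit (ef x) (bit Q x)
      ; polar = λ x y → trans (sym (ef (x + y))) (trans (polar Q x y) (cong₂ _+_ (cong₂ _+_ (ef x) (ef y)) (cong (λ w → Tr (y * w)) (eL x))))
      ; L-add = λ x y → trans (sym (eL (x + y))) (trans (L-add Q x y) (cong₂ _+_ (eL x) (eL y))) }

    Quadratic-+ : ∀ {f g L M} → Quadratic f L → Quadratic g M → Quadratic (λ x → f x + g x) (λ x → L x + M x)
    Quadratic-+ {f} {g} {L} {M} Q R = record
      { bit = λ x → bit-+ (bit Q x) (bit R x)
      ; polar = λ x y → trans (cong₂ _+_ (polar Q x y) (polar R x y)) (trans
          (solve 6 (λ a b c d e t → ((a :+ b) :+ c) :+ ((d :+ e) :+ t) := ((a :+ d) :+ (b :+ e)) :+ (c :+ t)) refl (f x) (f y) (Tr (y * L x)) (g x) (g y) (Tr (y * M x)))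
          (cong (((f x + g x) + (f y + g y)) +_) (trans (sym (Tr-add _ _)) (cong Tr (sym (distribˡ y (L x) (M x)))))))
      ; L-add = λ x y → trans (cong₂ _+_ (L-add Q x y) (L-add R x y))
          (solve 4 (λ a b c d → (a :+ b) :+ (c :+ d) := (a :+ c) :+ (b :+ d)) refl (L x) (L y) (M x) (M y)) }

    Quadratic-0 : Quadratic (λ _ → Tr 0#) (λ _ → 0#)
    Quadratic-0 = record
      { bit = λ _ → Tr-bit 0#
      ; polar = λ x y → trans (sym (trans (+-identityˡ _) (cong Tr (zeroʳ y)))) (cong (_+ Tr (y * 0#)) (sym (x+x (Tr 0#))))
      ; L-add = λ _ _ → sym (+-identityʳ 0#) }

    evY-c*D : ∀ c k z → evY ((c ∷ []) *₂ D k) z ≡ emb c * (σ^ k z + ρ^ k z)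
    evY-c*D c k z = trans (AY.ev-* (c ∷ []) (D k) z) (trans (AY.ev-const c _) (cong (emb c *_) (evY-D k z)))

    -- Tr (x yᵟ) = Tr (y x^(1/δ)) for δ = 2^k.
    Quadratic-term : ∀ c k → Quadratic (λ x → Tr (emb c * pow x (2 ℕ.^ k ℕ.+ 1))) (evY ((c ∷ []) *₂ D k))
    Quadratic-term c k = record
      { bit = λ x → Tr-bit _
      ; polar = λ x y → begin
          Tr (e * pow (x + y) (2 ℕ.^ k ℕ.+ 1)) ≡⟨ cong (λ w → Tr (e * w)) (trans (pow-2^+1 (x + y) k) (cong (_* (x + y)) (σ^-add k x y))) ⟩
          Tr (e * ((σ^ k x + σ^ k y) * (x + y))) ≡⟨ cong Tr (solve 5 (λ e p q x y → e :* ((p :+ q) :* (x :+ y)) := (e :* (p :* x) :+ e :* (q :* y)) :+ (y :* (e :* p) :+ q :* (e :* x))) refl e (σ^ k x) (σ^ k y) x y) ⟩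
          Tr ((e * (σ^ k x * x) + e * (σ^ k y * y)) + (y * (e * σ^ k x) + σ^ k y * (e * x))) ≡⟨ trans (Tr-add _ _) (cong₂ _+_ (trans (Tr-add _ _) (sym (cong₂ _+_ (cong (λ w → Tr (e * w)) (pow-2^+1 x k)) (cong (λ w → Tr (e * w)) (pow-2^+1 y k))))) (trans (Tr-add _ _) (cong (Tr (y * (e * σ^ k x)) +_) (adjoint x y)))) ⟩
          (q x + q y) + (Tr (y * (e * σ^ k x)) + Tr (y * (e * ρ^ k x))) ≡⟨ cong ((q x + q y) +_) (trans (sym (Tr-add _ _)) (cong Tr (trans (solve 4 (λ y e p r → y :* (e :* p) :+ y :* (e :* r) := y :* (e :* (p :+ r))) refl y e (σ^ k x) (ρ^ k x)) (cong (y *_) (sym (evY-c*D c k x)))))) ⟩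
          (q x + q y) + Tr (y * evY ((c ∷ []) *₂ D k) x) ∎
      ; L-add = AY.ev-add ((c ∷ []) *₂ D k) }
      where
      open ≡-Reasoning
      e = emb c
      q : Carrier → Carrier
      q x = Tr (e * pow x (2 ℕ.^ k ℕ.+ 1))
      adjoint : ∀ x y → Tr (σ^ k y * (e * x)) ≡ Tr (y * (e * ρ^ k x))
      adjoint x y = trans (cong Tr (trans (cong (σ^ k y *_) (sym (trans (AY.T-emb (σ^-add k) c (ρ^ k x)) (cong (e *_) (σ^ρ^ k x))))) (sym (σ^-* k y (e * ρ^ k x)))))
        (Tr-of-σ^ k _)

    QF : (ℕ → Bool) → ℕ → Carrier → Carrier
    QF α K x = Tr (sumF K (λ k → emb (α k) * pow x (2 ℕ.^ suc k ℕ.+ 1)))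

    Quadratic-QF : ∀ α K → Quadratic (QF α K) (evY (X *₂ Bpoly α K))
    Quadratic-QF α zero    = Quadratic-resp (λ _ → refl) (λ z → sym (AY.ev-zero (P.zeroʳ X) z)) Quadratic-0
    Quadratic-QF α (suc K) = Quadratic-resp (λ x → sym (Tr-add _ _)) combine (Quadratic-+ (Quadratic-QF α K) (Quadratic-term (α K) (suc K)))
      where
      C = α K ∷ []
      combine : ∀ z → evY (X *₂ Bpoly α K) z + evY (C *₂ D (suc K)) z ≡ evY (X *₂ Bpoly α (suc K)) z
      combine z = trans (sym (AY.ev-+ (X *₂ Bpoly α K) (C *₂ D (suc K)) z)) (AY.ev-cong
        (P.solve 4 (λ x b c e → x P.:* b P.:+ c P.:* (x P.:* e) P.:= x P.:* (b P.:+ c P.:* e)) P.refl X (Bpoly α K) C (E (suc K))) z)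

    -- x^(2^h+1) = x σ^h x is fixed by σ^h, so its subfield trace is a bit. The two cross terms of
    -- the polar form are conjugate under σ^h, and T u + T (σ^h u) = Tr u merges them; this is why
    -- σ^h appears once in the operator and not as σ^h + σ^(-h).
    Quadratic-middle : ∀ h → n ≡ h ℕ.+ h → ∀ c → Quadratic (λ x → Trsub h (emb c * pow x (2 ℕ.^ h ℕ.+ 1))) (λ z → emb c * σ^ h z)
    Quadratic-middle h n≡ c = record
      { bit = λ x → fixed⇒bit (σ-Trsub h _ (fixed x))
      ; polar = λ x y → trans (cong T (trans (cong (e *_) (trans (pow-2^+1 (x + y) h) (cong (_* (x + y)) (σ^-add h x y))))
            (solve 5 (λ e p q x y → e :* ((p :+ q) :* (x :+ y)) := (e :* (p :* x) :+ e :* (q :* y)) :+ (y :* (e :* p) :+ q :* (e :* x))) refl e (σ^ h x) (σ^ h y) x y)))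
          (trans (Trsub-add h _ _) (cong₂ _+_ (trans (Trsub-add h _ _) (sym (cong₂ _+_ (cong (λ w → T (e * w)) (pow-2^+1 x h)) (cong (λ w → T (e * w)) (pow-2^+1 y h)))))
            (trans (cong (λ w → T (y * (e * σ^ h x) + w)) (conj x y)) (trans (Trsub-add h _ _) (tower-of-traces (y * (e * σ^ h x)))))))
      ; L-add = λ x y → trans (cong (e *_) (σ^-add h x y)) (distribˡ e _ _) }
      where
      e = emb c
      T = Trsub h
      σ^h² : ∀ z → σ^ h (σ^ h z) ≡ z
      σ^h² z = trans (sym (σ^-+ h h z)) (trans (cong (λ k → σ^ k z) (sym n≡)) (σ^n z))
      fixed : ∀ x → σ^ h (e * pow x (2 ℕ.^ h ℕ.+ 1)) ≡ e * pow x (2 ℕ.^ h ℕ.+ 1)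
      fixed x = trans (AY.T-emb (σ^-add h) c _) (cong (e *_) (trans (cong (σ^ h) (pow-2^+1 x h)) (trans (σ^-* h _ x)
        (trans (cong (_* σ^ h x) (σ^h² x)) (trans (*-comm x _) (sym (pow-2^+1 x h)))))))
      conj : ∀ x y → σ^ h y * (e * x) ≡ σ^ h (y * (e * σ^ h x))
      conj x y = sym (trans (σ^-* h y _) (cong (σ^ h y *_) (trans (AY.T-emb (σ^-add h) c _) (cong (e *_) (σ^h² x)))))
      tower-of-traces : ∀ u → T u + T (σ^ h u) ≡ Tr u
      tower-of-traces u = sym (trans (Tr-σ^ u) (trans (cong (λ k → sumF k (λ i → σ^ i u)) n≡) (trans (sumF-++ h h (λ i → σ^ i u))
        (sym (cong₂ _+_ (Trsub-σ^ h u) (trans (Trsub-σ^ h (σ^ h u)) (sumF-cong h (λ i → trans (sym (σ^-+ i h u)) (cong (λ k → σ^ k u) (ℕP.+-comm i h))))))))))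

    plateaued-count : ∀ {A : Set} (f L : A → Carrier → Carrier) (κ : A → ℕ) → (∀ a → Quadratic (f a) (L a)) → (∀ a → κ a ≤ n) →
                      (∀ a → ∣ker (L a) ∣ ≡ 2 ℕ.^ (n ∸ κ a)) → ∀ xs t →
                      genCoeff n (λ s → length (filter (λ a → Plateaued? (f a) s) xs)) t ≡ coeff (gen xs κ) t
    plateaued-count f L κ Q κ≤n ker xs t = genCoeff-gen n (λ a s → Plateaued? (f a) s) κ κ≤n
      (λ a s pl → 2^-inj (trans (sym (ker a)) (Plateaued⇒ker (Q a) s pl)))
      (λ a s e → ker⇒Plateaued (Q a) s (trans (ker a) (cong (2 ℕ.^_) e))) xs t

    module Classes (e' : ℕ) {K : ℕ} {S : Poly₂} (mS : Mon K S) (cop : P.Coprime X S) (R : Rel (suc e' ℕ.+ K) (X^ (suc e') *₂ S) (xⁿ+1 n))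
                   (n≡ : n ≡ (suc e' ℕ.+ K) ℕ.+ (suc e' ℕ.+ K)) where
      open Annihilated R n≡
      open Twisted (suc e') mS cop R n≡ using (c₀; L; kernel-twisted)

      k = e' ℕ.+ K
      -- f = y p: the factor y common to the operator y B and to f is taken out, which leaves the
      -- exponent e - 1 = e' on y.
      p : Poly₂
      p = X^ e' *₂ S

      mp : Mon k p
      mp = P.Mon-* (P.Mon-X^ e') mS

      Xp : X *₂ p ≋ (X^ (suc e') *₂ S)
      Xp = P.trans (P.sym (P.*-assoc X (X^ e') S)) (P.*-congʳ {S} (P.sym (P.X^suc e')))

      weight-≤ : ∀ g {h} → h ≤ suc k → 2 ℕ.* (h ∸ g) ≤ n
      weight-≤ g {h} h≤ = subst (2 ℕ.* (h ∸ g) ≤_) (trans (cong (suc k ℕ.+_) (ℕP.+-identityʳ (suc k))) (sym n≡))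
        (ℕP.*-monoʳ-≤ 2 (ℕP.≤-trans (ℕP.m∸n≤m h g) h≤))

      ker-QF : ∀ B → ∣ker (evY (X *₂ B)) ∣ ≡ 2 ℕ.^ (n ∸ weight k p B)
      ker-QF B = trans (kernel-XB Xp mp B) (cong (2 ℕ.^_) (sym (trans (cong (_∸ weight k p B) n≡) (codegree {suc (gdeg B p)} {suc k} (s≤s (proj₂ (P.gcd-Mon B mp)))))))

      weight-resp : ∀ {f g} → f ≋ g → weight k p f ≡ weight k p g
      weight-resp {f} {g} e = cong (λ d → 2 ℕ.* (k ∸ d)) (gdeg-resp {f} {g} {p} {p} e P.refl mp)

      C₁ : ∀ k' → k' ≡ k → ∀ t → genCoeff n (λ s → length (filter (λ a → Plateaued? (QF (lookupℕ a) k') s) (allVecs k'))) t ≡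
                                 coeff (Apoly e' *ᴺ Γ K S) t
      C₁ .k refl t = trans (plateaued-count (λ a → QF (lookupℕ a) k) (λ a → evY (X *₂ Bpoly (lookupℕ a) k)) (λ a → weight k p (Bpoly (lookupℕ a) k))
          (λ a → Quadratic-QF (lookupℕ a) k) (λ a → weight-≤ (gdeg (Bpoly (lookupℕ a) k) p) (ℕP.n≤1+n k)) (λ a → ker-QF (Bpoly (lookupℕ a) k)) (allVecs k) t)
        (coeff≡ (≈-trans (gen-Bpoly k (weight k p) weight-resp) (Γ-X^* mS cop e')) t)

      QF₂ : ∀ h → Vec Bool h → Carrier → Carrier
      QF₂ h a x = QF (lookupℕ a) (h ∸ 1) x + Trsub h (emb (lookupℕ a (h ∸ 1)) * pow x (2 ℕ.^ h ℕ.+ 1))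

      twisted : Poly₂ → ℕ
      twisted B = 2 ℕ.* (suc k ∸ gdeg (c₀ +₂ (X *₂ B)) S)

      twisted-resp : ∀ {f g} → f ≋ g → twisted f ≡ twisted g
      twisted-resp {f} {g} e = cong (λ d → 2 ℕ.* (suc k ∸ d)) (gdeg-resp {c₀ +₂ (X *₂ f)} {c₀ +₂ (X *₂ g)} {S} {S} (P.+-congˡ {c₀} (P.*-congˡ {X} e)) P.refl mS)

      κ₂ : Bool → Poly₂ → ℕ
      κ₂ c B = if c then twisted B else weight k p B

      ker-QF₂ : ∀ c B → ∣ker (λ z → evY (X *₂ B) z + emb c * σ^ (suc k) z) ∣ ≡ 2 ℕ.^ (n ∸ κ₂ c B)
      ker-QF₂ false B = trans (∑ℕ-cong elements (λ z → cong isz (trans (cong (evY (X *₂ B) z +_) (zeroˡ _)) (+-identityʳ _)))) (ker-QF B)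
        where open FiniteField F using (elements)
      ker-QF₂ true  B = trans (∑ℕ-cong elements (λ z → cong (λ w → isz (evY (X *₂ B) z + w)) (*-identityˡ _)))
          (trans (kernel-twisted B) (cong (2 ℕ.^_) (sym (trans (cong (_∸ twisted B) n≡) (codegree {gdeg (c₀ +₂ (X *₂ B)) S} {suc k} g≤)))))
        where
        open FiniteField F using (elements)
        g≤ : gdeg (c₀ +₂ (X *₂ B)) S ≤ suc k
        g≤ = ℕP.≤-trans (proj₂ (P.gcd-Mon (c₀ +₂ (X *₂ B)) mS)) (ℕP.m≤n+m K (suc e'))

      κ₂-≤ : ∀ c B → κ₂ c B ≤ n
      κ₂-≤ true  B = weight-≤ (gdeg (c₀ +₂ (X *₂ B)) S) ℕP.≤-refl
      κ₂-≤ false B = weight-≤ (gdeg B p) (ℕP.n≤1+n k)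

      κ : Vec Bool (suc k) → ℕ
      κ a = κ₂ (lookupℕ a k) (Bpoly (lookupℕ a) k)

      -- The coefficient a_h that selects the case is the last entry, whereas `allVecs` branches on
      -- the first; the enumeration is therefore reindexed.
      snoc : Vec Bool k × Vec Bool 1 → Vec Bool (suc k)
      snoc (a , b ∷ []) = a ∷ʳ b

      snoc-injective : ∀ {x y} → snoc x ≡ snoc y → x ≡ y
      snoc-injective {a , b ∷ []} {a' , b' ∷ []} e = cong₂ (λ a b → a , b ∷ []) (proj₁ (∷ʳ-injective a a' e)) (proj₂ (∷ʳ-injective a a' e))

      κ-snoc : ∀ a b → κ (a ∷ʳ b) ≡ κ₂ b (Bpoly (lookupℕ a) k)
      κ-snoc a b = cong₂ κ₂ (lookup-∷ʳ-last a b) (Bpoly-cong k (lookup-∷ʳ-init a b))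

      -- The tuples with a_h = 0 repeat the count of C₁ and give `Apoly e'`; those with a_h = 1
      -- give, by `gen-shifted`, exactly the summand that extends it to `Apoly (suc e')`.
      gen-κ : gen (allVecs (suc k)) κ ≈ᴺ Apoly (suc e') *ᴺ Γ K S
      gen-κ = ≈-trans (∑-pairs k 1 (suc k) (ℕP.+-comm k 1) snoc snoc-injective (λ a → monoᴺ 1 (κ a)))
        (≈-trans (∑-× (allVecs k) (allVecs 1) _)
        (≈-trans (∑-cong (allVecs k) (λ a → +ᴺ-cong (≡⇒≈ (cong (monoᴺ 1) (κ-snoc a true)))
            (≈-trans (+ᴺ-identityʳ _) (≡⇒≈ (cong (monoᴺ 1) (κ-snoc a false))))))
        (≈-trans (∑-∙ (allVecs k) _ _)
        (≈-trans (+ᴺ-cong (≈-trans (gen-Bpoly k twisted twisted-resp) (gen-shifted mS cop (suc e') e' c₀))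
                          (≈-trans (gen-Bpoly k (weight k p) weight-resp) (Γ-X^* mS cop e')))
        (≈-trans (≈-sym (*ᴺ-distribʳ (Γ K S) M (Apoly e')))
        (*ᴺ-congˡ (Γ K S) (≈-trans (+ᴺ-comm M (Apoly e')) (+ᴺ-assoc (1 ∷ []) (sumᴺ e' (λ j → monoᴺ (2 ℕ.^ (j ∸ 1)) (2 ℕ.* j))) M))))))))
        where
        M = monoᴺ (2 ℕ.^ e') (2 ℕ.* suc e')

      C₂ : ∀ h → h ≡ suc k → ∀ t → genCoeff n (λ s → length (filter (λ a → Plateaued? (QF₂ h a) s) (allVecs h))) t ≡
                                   coeff (Apoly (suc e') *ᴺ Γ K S) t
      C₂ .(suc k) refl t = trans (plateaued-count (QF₂ (suc k)) (λ a z → evY (X *₂ Bpoly (lookupℕ a) k) z + emb (lookupℕ a k) * σ^ (suc k) z) κ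
          (λ a → Quadratic-+ (Quadratic-QF (lookupℕ a) k) (Quadratic-middle (suc k) n≡ (lookupℕ a k)))
          (λ a → κ₂-≤ (lookupℕ a k) (Bpoly (lookupℕ a) k)) (λ a → ker-QF₂ (lookupℕ a k) (Bpoly (lookupℕ a) k)) (allVecs (suc k)) t)
        (coeff≡ gen-κ t)

  Mon-xⁿ+1 : ∀ {n} → 0 ℕ.< n → Mon n (xⁿ+1 n)
  Mon-xⁿ+1 {n} n>0 = P.Lt+-Mon (P.Lt-mono n>0 (P.bnd P.Mon-one)) (P.Mon-resp (P.sym (ReciprocalPolynomials.X^≋ n)) (P.Mon-X^ n))

  half-pred : ∀ k → (suc k ℕ.+ suc k ∸ 1) ℕD./ 2 ≡ k
  half-pred k = trans (cong (ℕD._/ 2) (trans (ℕP.+-suc k k) (cong suc (trans (cong (k ℕ.+_) (sym (ℕP.+-identityʳ k))) (ℕP.*-comm 2 k)))))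
    (trans (ℕD.+-distrib-/-∣ʳ 1 {k ℕ.* 2} {2} (Div.n∣m*n k)) (ℕD.m*n/n≡m k 2))

  counts : ∀ {n h} (F : FiniteField n) → n ≡ h ℕ.+ h → 0 ℕ.< n → ∀ v {rs K S} → Tower (2 ℕ.^ v) rs K S → P.Coprime X S →
         ∀ e e' → e ≡ suc e' → Rel (e ℕ.+ K) (X^ e *₂ S) (xⁿ+1 n) →
         ((t : ℕ) → genCoeff n (FieldOps.𝒩 F) t ≡ coeff (Apoly (e ∸ 1) *ᴺ prodᴺ (map (Gpoly v) rs)) t)
       × ((t : ℕ) → genCoeff n (FieldOps.𝓜 F h) t ≡ coeff (Apoly e *ᴺ prodᴺ (map (Gpoly v) rs)) t)
  counts {n} {h} F n≡2h n>0 v {rs} {K} {S} T cop .(suc e') e' refl R =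
      (λ t → trans (C₁ ((n ∸ 1) ℕD./ 2) (trans (cong (λ n → (n ∸ 1) ℕD./ 2) n≡) (half-pred (e' ℕ.+ K))) t) (coeff≡ (*ᴺ-congʳ (Apoly e') (Γ-tower v T)) t))
    , (λ t → trans (C₂ h h≡ t) (coeff≡ (*ᴺ-congʳ (Apoly (suc e')) (Γ-tower v T)) t))
    where
    -- Both sides are degrees of x^n + 1, so the degrees of the individual factors need not be
    -- summed.
    n≡ : n ≡ (suc e' ℕ.+ K) ℕ.+ (suc e' ℕ.+ K)
    n≡ = P.Mon-unique (Mon-xⁿ+1 n>0) (Rel-Mon R)
    h≡ : h ≡ suc (e' ℕ.+ K)
    h≡ = n+n-injective (trans (sym n≡2h) n≡)
    open Quadratics F n>0
    open Classes e' (Tower-Mon T) cop R n≡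

-- Specialisation to n = 2^v m with v = v' + 1 and e = 2^v'.

open import Data.Empty using (⊥-elim)
open import Data.List using (List; map)
open import Data.List.Relation.Unary.All using (All)
open import Data.Nat using (ℕ; zero; suc; _+_; _*_; _^_; _∸_; _<_; z≤n; s≤s)
open import Data.Nat.Divisibility using (_∣_; _∣0)
open import Data.Nat.Properties using (*-assoc; +-identityʳ; *-mono-<; m^n>0; m+[n∸m]≡n)
open import Data.Product using (_×_; _,_)
open import Relation.Nullary using (¬_)
open import Relation.Binary.PropositionalEquality using (_≡_; refl; sym; trans; cong)
open BinaryPolynomials using (≈₂⇒≋)
open Factors using (module Factorisation)
open PlateauedCounts using (counts)

theorem1 : (v' m : ℕ) → ¬ (2 ∣ m) → (rs : List Poly₂)
    → All (λ r → Monic r × PrimeSelfReciprocal r × 2 ∣ deg r) rs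
    → xⁿ+1 (2 ^ suc v' * m) ≈₂ ((x+1 ^₂ (2 ^ suc v')) *₂ prod₂ (map (λ r → r ^₂ (2 ^ suc v')) rs))
    → (F : FiniteField (2 ^ suc v' * m))
    → ((t : ℕ) → genCoeff (2 ^ suc v' * m) (FieldOps.𝒩 F) t
    ≡ coeff (Apoly (2 ^ v' ∸ 1) *ᴺ prodᴺ (map (Gpoly (suc v')) rs)) t)
    × ((t : ℕ) → genCoeff (2 ^ suc v' * m) (FieldOps.𝓜 F (2 ^ v' * m)) t
    ≡ coeff (Apoly (2 ^ v') *ᴺ prodᴺ (map (Gpoly (suc v')) rs)) t)
theorem1 v' m odd rs all hyp F = go factorisation
  where
  open Factorisation v' (2 ^ v') (2 ^ suc v') m refl refl odd rs all (≈₂⇒≋ hyp)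
  h = 2 ^ v' * m
  n≡ : 2 ^ suc v' * m ≡ h + h
  n≡ = trans (*-assoc 2 (2 ^ v') m) (cong (h +_) (+-identityʳ h))
  m>0 : ∀ m → ¬ (2 ∣ m) → 0 < m
  m>0 zero    odd = ⊥-elim (odd (2 ∣0))
  m>0 (suc m) _   = s≤s z≤n
  n>0 : 0 < 2 ^ suc v' * m
  n>0 = *-mono-< {0} {_} {0} (m^n>0 2 (suc v')) (m>0 m odd)
  go : _ → _
  go (K , S , T , cop , R) = counts {h = h} F n≡ n>0 (suc v') T cop (2 ^ v') (2 ^ v' ∸ 1) (sym (m+[n∸m]≡n (m^n>0 2 v'))) R
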